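{- Let $F$ be a $\beta$-acyclic CNF-formula and let $\mathcal{H}=\mathcal{H}(F)=\{\mathrm{var}(C)\mid C\in F\}$ be its hypergraph. One can construct, in time polynomial in $\mathrm{size}(F)$, a decision DNNF $D$ of size $O(\mathrm{size}(F))$ and fan-in at most $|\mathcal{H}|$ computing $F$.
   Context: CNF-formulas: a literal is a variable $x$ or a negated variable $\neg x$; a clause is a finite set of literals; a clause is tautological if it contains some variable both negated and unnegated. A CNF-formula is a finite set of non-tautological clauses. $\mathrm{var}(C)$ is the set of variables of a clause $C$, $\mathrm{var}(F)=\bigcup_{C\in F}\mathrm{var}(C)$, and $\mathrm{size}(F)=\sum_{C\in F}|\mathrm{var}(C)|$. An assignment satisfies a clause if it makes some literal of it true, and satisfies $F$ if it satisfies every clause of $F$; $F$ is identified with the boolean function on $\mathrm{var}(F)$ it induces. Hypergraphs: a hypergraph $\mathcal{H}$ is a finite set of finite sets (edges), with vertex set $V(\mathcal{H})=\bigcup_{e\in\mathcal{H}}e$; $|\mathcal{H}|$ is its number of edges. $\mathcal{H}$ is $\beta$-acyclic if there is an order $(x_1,\dots,x_n)$ of $V(\mathcal{H})$ such that for all $i\le n$ and all $e,f\in\mathcal{H}$ with $x_i\in e\cap f$, either $e\setminus\{x_1,\dots,x_i\}\subseteq f$ or $f\setminus\{x_1,\dots,x_i\}\subseteq e$. A CNF-formula $F$ is $\beta$-acyclic if its hypergraph $\mathcal{H}(F)$ is $\beta$-acyclic. Circuits: a boolean circuit is in Negation Normal Form (NNF) if its inputs are labeled by literals (or by the constants $0,1$)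 and its internal gates are $\wedge$-gates or $\vee$-gates; it has a distinguished output gate and computes the boolean function computed by that gate. The size of $D$ is its number of gates; the fan-in of $D$ is the maximum number of inputs of a gate. For a gate $v$, $D_v$ is the sub-circuit rooted at $v$ and $\mathrm{var}(D_v)$ the set of variables labeling its inputs. An $\wedge$-gate $v$ is decomposable if $\mathrm{var}(D_{v_1})\cap\mathrm{var}(D_{v_2})=\emptyset$ for all distinct inputs $v_1,v_2$ of $v$. A DNNF is an NNF circuit all of whose $\wedge$-gates are decomposable. An $\vee$-gate is a decision gate if it is binary and of the form $(x\wedge v_1)\vee(\neg x\wedge v_2)$ for some variable $x$ and gates $v_1,v_2$. A decision DNNF is a DNNF in which every $\vee$-gate is a decision gate.
   Formalization: If H has exactly one edge, the fan-in bound is 2 instead of 1 (for F = {x ∨ y} a binary decision gate is unavoidable, so the literal bound fails); the size bound is a constant times max(1, size(F)), since a circuit needs a gate even when size(F) = 0. -}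

module Defs where

open import Data.Bool.Base using (Bool; true; false; not; if_then_else_)
open import Data.Bool.ListAction using (any; all)
open import Data.Fin.Base using (Fin; zero; suc; toℕ)
open import Data.List.Base
  using (List; []; _∷_; map; foldr; length; concat; concatMap; filter; take; lookup;
         deduplicate; replicate)
open import Data.Nat.Properties using (_≟_)
open import Data.List.Membership.DecPropositional _≟_ using (_∈?_)
open import Data.List.Membership.Propositional using (_∈_; _∉_)
open import Data.List.Relation.Binary.Disjoint.Propositional using (Disjoint)
open import Data.List.Relation.Binary.Subset.DecPropositional _≟_ using (_⊆?_)
open import Data.List.Relation.Binary.Subset.Propositional using (_⊆_)
open import Data.List.Relation.Unary.AllPairs using (AllPairs)
open import Data.List.Relation.Unary.Unique.Propositional using (Unique)
open import Data.Nat.Base using (ℕ; zero; suc; _+_; _⊔_; _≡ᵇ_)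
open import Data.Nat.ListAction using (sum)
open import Data.Product.Base using (∃; _×_)
open import Data.Sum.Base using (_⊎_)
open import Data.Vec.Base as Vec using (Vec)
open import Function.Bundles using (_⇔_)
open import Relation.Binary.Definitions using (Decidable)
open import Relation.Binary.PropositionalEquality using (_≡_)
open import Relation.Nullary.Decidable using (¬?; _×-dec_)
open import Relation.Nullary.Negation using (¬_)

------------------------------------------------------------------------
-- Finite sets are lists; equality of sets is mutual inclusion.

infix 4 _≐_ _≐?_

_≐_ : {A : Set} → List A → List A → Set
xs ≐ ys = xs ⊆ ys × ys ⊆ xs

Var : Set
Var = ℕ

_≐?_ : Decidable (_≐_ {Var})
xs ≐? ys = (xs ⊆? ys) ×-dec (ys ⊆? xs)

_∖_ : List Var → List Var → List Var
xs ∖ ys = filter (λ x → ¬? (x ∈? ys)) xs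

------------------------------------------------------------------------
-- CNF-formulas

data Literal : Set where
  pos neg : Var → Literal

litVar : Literal → Var
litVar (pos x) = x
litVar (neg x) = x

record Clause : Set where
  field
    literals        : List Literal
    unique          : Unique literals
    nonTautological : ∀ x → pos x ∈ literals → neg x ∉ literals

open Clause public

-- Repetition-free, because a clause is non-tautological and lists each literal
-- once; hence its length is the cardinality of the set of variables.
clauseVars : Clause → List Var
clauseVars C = map litVar (literals C)

record CNF : Set where
  field
    clauses  : List Clause
    distinct : AllPairs (λ C C′ → ¬ literals C ≐ literals C′) clauses

open CNF public

cnfVars : CNF → List Var
cnfVars F = concatMap clauseVars (clauses F)

cnfSize : CNF → ℕ
cnfSize F = sum (map (λ C → length (clauseVars C)) (clauses F))

Assignment : Set
Assignment = Var → Bool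

evalLiteral : Assignment → Literal → Bool
evalLiteral τ (pos x) = τ x
evalLiteral τ (neg x) = not (τ x)

evalClause : Assignment → Clause → Bool
evalClause τ C = any (evalLiteral τ) (literals C)

evalCNF : Assignment → CNF → Bool
evalCNF τ F = all (evalClause τ) (clauses F)

------------------------------------------------------------------------
-- Hypergraphs

-- Edges may be listed repeatedly; repetitions are discounted by ∣_∣.
Hypergraph : Set
Hypergraph = List (List Var)

∣_∣ : Hypergraph → ℕ
∣ H ∣ = length (deduplicate _≐?_ H)

vertices : Hypergraph → List Var
vertices = concat

record IsβEliminationOrder (H : Hypergraph) (xs : List Var) : Set where
  field
    unique    : Unique xs
    enumerate : ∀ x → x ∈ xs ⇔ x ∈ vertices H
    -- Indices start at 0, so the prefix up to and including x_i has length suc i.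
    nested    : ∀ (i : Fin (length xs)) {e f} → e ∈ H → f ∈ H →
                lookup xs i ∈ e → lookup xs i ∈ f →
                (e ∖ take (suc (toℕ i)) xs) ⊆ f ⊎ (f ∖ take (suc (toℕ i)) xs) ⊆ e

βAcyclic : Hypergraph → Set
βAcyclic H = ∃ λ xs → IsβEliminationOrder H xs

hypergraph : CNF → Hypergraph
hypergraph F = map clauseVars (clauses F)

------------------------------------------------------------------------
-- NNF circuits

data Gate (n : ℕ) : Set where
  lit   : Literal → Gate n
  const : Bool → Gate n
  and   : List (Fin n) → Gate n
  or    : List (Fin n) → Gate n

-- The gates in topological order, the newest one last.  A reference counts
-- backwards: zero is the most recent of the gates that precede the reference.
infixl 5 _▷_

data Gates : ℕ → Set where
  []  : Gates zero
  _▷_ : ∀ {n} → Gates n → Gate n → Gates (suc n)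

weaken : ∀ {n} → Gate n → Gate (suc n)
weaken (lit ℓ)   = lit ℓ
weaken (const b) = const b
weaken (and vs)  = and (map suc vs)
weaken (or vs)   = or (map suc vs)

gate : ∀ {n} → Gates n → Fin n → Gate n
gate (G ▷ g) zero    = weaken g
gate (G ▷ g) (suc v) = weaken (gate G v)

evalGate : ∀ {n} → Assignment → Gates n → Fin n → Bool
evalGate τ (G ▷ lit ℓ)   zero    = evalLiteral τ ℓ
evalGate τ (G ▷ const b) zero    = b
evalGate τ (G ▷ and vs)  zero    = all (evalGate τ G) vs
evalGate τ (G ▷ or vs)   zero    = any (evalGate τ G) vs
evalGate τ (G ▷ g)       (suc v) = evalGate τ G v

-- var(D_v)
gateVars : ∀ {n} → Gates n → Fin n → List Var
gateVars (G ▷ lit ℓ)   zero    = litVar ℓ ∷ []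
gateVars (G ▷ const b) zero    = []
gateVars (G ▷ and vs)  zero    = concatMap (gateVars G) vs
gateVars (G ▷ or vs)   zero    = concatMap (gateVars G) vs
gateVars (G ▷ g)       (suc v) = gateVars G v

inputCount : ∀ {n} → Gate n → ℕ
inputCount (lit ℓ)   = 0
inputCount (const b) = 0
inputCount (and vs)  = length vs
inputCount (or vs)   = length vs

maxInputCount : ∀ {n} → Gates n → ℕ
maxInputCount []      = 0
maxInputCount (G ▷ g) = maxInputCount G ⊔ inputCount g

record Circuit : Set where
  field
    size   : ℕ
    gates  : Gates size
    output : Fin size

open Circuit public

fanIn : Circuit → ℕ
fanIn D = maxInputCount (gates D)

evalCircuit : Assignment → Circuit → Bool
evalCircuit τ D = evalGate τ (gates D) (output D)

-- Equality of boolean functions on var(F): besides having the same values, the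
-- circuit reads no variable outside var(F).
record _Computes_ (D : Circuit) (F : CNF) : Set where
  field
    variables : ∀ v → gateVars (gates D) v ⊆ cnfVars F
    values    : ∀ τ → evalCircuit τ D ≡ evalCNF τ F

Decomposable : ∀ {n} → Gates n → List (Fin n) → Set
Decomposable G = AllPairs (λ u v → Disjoint (gateVars G u) (gateVars G v))

data IsDecision {n} (G : Gates n) : List (Fin n) → Set where
  decision : ∀ {x a b ℓ ℓ′ v₁ v₂} →
             gate G a ≡ and (ℓ ∷ v₁ ∷ [])  → gate G ℓ ≡ lit (pos x) →
             gate G b ≡ and (ℓ′ ∷ v₂ ∷ []) → gate G ℓ′ ≡ lit (neg x) →
             IsDecision G (a ∷ b ∷ [])

record IsDecisionDNNF (D : Circuit) : Set where
  field
    decomposable : ∀ v {vs} → gate (gates D) v ≡ and vs → Decomposable (gates D) vs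
    decisions    : ∀ v {vs} → gate (gates D) v ≡ or vs → IsDecision (gates D) vs

------------------------------------------------------------------------
-- Model of computation: first-order, call-by-value recursive programs on binary
-- trees, with one unit of time per evaluation step.  Leaves are nil or atoms, and
-- atoms can only be moved around and compared for equality.  They stand for names
-- of variables, so that running times depend on the size of a formula but not on
-- the magnitude of the numbers that name its variables.

infixr 5 _∙_

data Tree : Set where
  nil  : Tree
  atom : ℕ → Tree
  _∙_  : Tree → Tree → Tree

sameAtom : Tree → Tree → Tree
sameAtom (atom a) (atom b) = if a ≡ᵇ b then nil ∙ nil else nil
sameAtom _        _        = nil

-- Expressions over m unary functions with k variables (de Bruijn) in scope.
-- caseCons e e₁ e₂ continues with e₂, binding head and tail, if e is a pair, and
-- with e₁ otherwise.
data Expr (m : ℕ) : ℕ → Set where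
  var      : ∀ {k} → Fin k → Expr m k
  nil      : ∀ {k} → Expr m k
  cons     : ∀ {k} → Expr m k → Expr m k → Expr m k
  eqAtom   : ∀ {k} → Expr m k → Expr m k → Expr m k
  letIn    : ∀ {k} → Expr m k → Expr m (suc k) → Expr m k
  caseCons : ∀ {k} → Expr m k → Expr m k → Expr m (suc (suc k)) → Expr m k
  call     : ∀ {k} → Fin m → Expr m k → Expr m k

Bodies : ℕ → Set
Bodies m = Vec (Expr m 1) m

-- Eval fs ρ e v t : in environment ρ, e evaluates to v in t steps.
data Eval {m} (fs : Bodies m) : ∀ {k} → Vec Tree k → Expr m k → Tree → ℕ → Set where
  var      : ∀ {k} {ρ : Vec Tree k} i →
             Eval fs ρ (var i) (Vec.lookup ρ i) 1
  nil      : ∀ {k} {ρ : Vec Tree k} →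
             Eval fs ρ nil nil 1
  cons     : ∀ {k} {ρ : Vec Tree k} {e₁ e₂ v₁ v₂ t₁ t₂} →
             Eval fs ρ e₁ v₁ t₁ → Eval fs ρ e₂ v₂ t₂ →
             Eval fs ρ (cons e₁ e₂) (v₁ ∙ v₂) (suc (t₁ + t₂))
  eqAtom   : ∀ {k} {ρ : Vec Tree k} {e₁ e₂ v₁ v₂ t₁ t₂} →
             Eval fs ρ e₁ v₁ t₁ → Eval fs ρ e₂ v₂ t₂ →
             Eval fs ρ (eqAtom e₁ e₂) (sameAtom v₁ v₂) (suc (t₁ + t₂))
  letIn    : ∀ {k} {ρ : Vec Tree k} {e₁ e₂ v₁ v₂ t₁ t₂} →
             Eval fs ρ e₁ v₁ t₁ → Eval fs (v₁ Vec.∷ ρ) e₂ v₂ t₂ →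
             Eval fs ρ (letIn e₁ e₂) v₂ (suc (t₁ + t₂))
  caseNil  : ∀ {k} {ρ : Vec Tree k} {e e₁ e₂ v t₁ t₂} →
             Eval fs ρ e nil t₁ → Eval fs ρ e₁ v t₂ →
             Eval fs ρ (caseCons e e₁ e₂) v (suc (t₁ + t₂))
  caseAtom : ∀ {k} {ρ : Vec Tree k} {e e₁ e₂ a v t₁ t₂} →
             Eval fs ρ e (atom a) t₁ → Eval fs ρ e₁ v t₂ →
             Eval fs ρ (caseCons e e₁ e₂) v (suc (t₁ + t₂))
  caseCons : ∀ {k} {ρ : Vec Tree k} {e e₁ e₂ u w v t₁ t₂} →
             Eval fs ρ e (u ∙ w) t₁ → Eval fs (u Vec.∷ w Vec.∷ ρ) e₂ v t₂ →
             Eval fs ρ (caseCons e e₁ e₂) v (suc (t₁ + t₂))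
  call     : ∀ {k} {ρ : Vec Tree k} {f e u v t₁ t₂} →
             Eval fs ρ e u t₁ → Eval fs (u Vec.∷ Vec.[]) (Vec.lookup fs f) v t₂ →
             Eval fs ρ (call f e) v (suc (t₁ + t₂))

record Program : Set where
  field
    helpers : ℕ
    bodies  : Bodies (suc helpers)

-- The main function is the first one.
_on_Returns_In_ : Program → Tree → Tree → ℕ → Set
P on u Returns v In t = Eval bodies (u Vec.∷ Vec.[]) (Vec.head bodies) v t
  where open Program P

------------------------------------------------------------------------
-- Encodings of formulas and circuits as trees; numbers are in unary.

encodeList : List Tree → Tree
encodeList = foldr _∙_ nil

encodeℕ : ℕ → Tree
encodeℕ n = encodeList (replicate n nil)

encodeLiteral : Literal → Tree
encodeLiteral (pos x) = nil ∙ atom x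
encodeLiteral (neg x) = (nil ∙ nil) ∙ atom x

encodeClause : Clause → Tree
encodeClause C = encodeList (map encodeLiteral (literals C))

encodeCNF : CNF → Tree
encodeCNF F = encodeList (map encodeClause (clauses F))

encodeRefs : ∀ {n} → List (Fin n) → Tree
encodeRefs vs = encodeList (map (λ v → encodeℕ (toℕ v)) vs)

encodeGate : ∀ {n} → Gate n → Tree
encodeGate (lit ℓ)       = encodeℕ 0 ∙ encodeLiteral ℓ
encodeGate (const false) = encodeℕ 1 ∙ encodeℕ 0
encodeGate (const true)  = encodeℕ 1 ∙ encodeℕ 1
encodeGate (and vs)      = encodeℕ 2 ∙ encodeRefs vs
encodeGate (or vs)       = encodeℕ 3 ∙ encodeRefs vs

encodeGates : ∀ {n} → Gates n → Tree
encodeGates []      = nil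
encodeGates (G ▷ g) = encodeGate g ∙ encodeGates G

encodeCircuit : Circuit → Tree
encodeCircuit D = encodeℕ (toℕ (output D)) ∙ encodeGates (gates D)

{-# OPTIONS --safe #-}
-- Let x₁, …, xₙ be a β-elimination order.  A set of clauses that is connected through the
-- variables x₁, …, xᵢ contains a clause, its representative, in which all variables beyond
-- xᵢ of the set occur: among the components of the set with respect to x₁, …, xᵢ₋₁, those
-- that meet at xᵢ have representatives containing xᵢ, and beyond xᵢ these are nested.  If
-- moreover some assignment falsifies all literals beyond xᵢ, then the set is determined by
-- its representative c and by the last variable among x₁, …, xᵢ that occurs in c.  Hence
-- one decision gate per clause and variable of that clause is enough: it branches on the
-- variable, and each branch is the conjunction of the gates of the components of what is
-- left.  The representatives of these components have distinct sets of variables, which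
-- bounds the fan-in.  An order is found greedily, since every vertex that comes first, in
-- some β-elimination order, among the ones not yet eliminated is a nest point.
--
-- Polynomial time: all of this is a composition of primitive recursions over lists, and
-- such a recursion runs in polynomial time as soon as its values have polynomial size.

module Submission where

open import Defs
open import Data.Nat.Base using (ℕ; suc; _*_; _^_; _⊔_; _≤_)
open import Data.Product.Base using (Σ-syntax; ∃-syntax; _×_)
open import Relation.Binary.PropositionalEquality using (_≡_; _≢_)

open import Data.Bool.Base using (Bool; true; false; not; if_then_else_; _∧_; _∨_)
open import Data.Bool.ListAction using (any; all)
open import Data.Bool.Properties using (not-involutive; ∧-identityʳ; ∨-identityʳ)
open import Data.Empty using (⊥-elim)
open import Data.Fin.Base using (Fin; zero; suc; toℕ; _↑ˡ_; _↑ʳ_)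
open import Data.Fin.Properties using (toℕ<n)
open import Data.List.Base
  using (List; []; _∷_; map; length; filter; _++_; foldr; concat; concatMap; lookup; take; replicate)
open import Data.List.Membership.Propositional using (_∈_; _∉_; find)
open import Data.List.Membership.Propositional.Properties
open import Data.List.Properties
  using (length-map; map-∘; map-id; length-filter; filter-accept; filter-reject)
open import Data.List.Relation.Binary.Disjoint.Propositional using (Disjoint)
open import Data.List.Relation.Binary.Subset.Propositional using (_⊆_)
open import Data.List.Relation.Unary.All as All using (All; []; _∷_; all?)
open import Data.List.Relation.Unary.AllPairs as AllPairs using (AllPairs; []; _∷_)
import Data.List.Relation.Unary.AllPairs.Properties as AllPairs
open import Data.List.Relation.Unary.Any as Any using (Any; here; there; any?)
import Data.List.Relation.Unary.Any.Properties as Any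
open import Data.List.Relation.Unary.Unique.Propositional using (Unique)
import Data.List.Relation.Unary.Unique.Propositional.Properties as Unique
open import Data.Nat.Base using (zero; pred; _+_; _∸_; _<_; z≤n; s≤s; s≤s⁻¹; _≡ᵇ_)
open import Data.Nat.ListAction using (sum)
open import Data.Nat.Properties
open import Algebra.Properties.CommutativeSemigroup +-commutativeSemigroup using (x∙yz≈y∙xz)
open import Data.List.Membership.DecPropositional _≟_ using (_∈?_)
open import Data.Nat.Tactic.RingSolver using (solve-∀)
open import Data.Product.Base using (_,_; proj₁; proj₂)
open import Data.Sum.Base as Sum using (_⊎_; inj₁; inj₂; [_,_]; swap)
open import Data.Unit.Base using (⊤; tt)
open import Data.Vec.Base as Vec using (Vec)
open import Data.Vec.Properties using (lookup-++ˡ; lookup-++ʳ)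
open import Function.Base using (_∘_; id)
open import Function.Bundles using (Equivalence)
open import Relation.Binary.Definitions using (Symmetric)
open import Relation.Binary.PropositionalEquality
  using (refl; sym; trans; cong; cong₂; subst; subst₂; module ≡-Reasoning)
open import Relation.Nullary.Decidable
  using (Dec; does; yes; no; _×-dec_; _⊎-dec_; ¬?; map′; dec-true; dec-false)
open import Relation.Nullary.Negation using (¬_)

-- A gate can be shared only if its meaning does not depend on where it is used. The gate of a
-- clause therefore computes what remains of a set of clauses when all literals outside the
-- processed variables count as false (`Sat`), and the set itself is given by `Mem`, which refers to
-- the formula and the clause but to no surrounding set. The core of the proof is that the component
-- at hand coincides with this context-free set; `Closed` is the invariant that makes it so, and
-- branching preserves it.
--
-- The running time raises a different obstacle. Hence the sizes are bounded outright: the number of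
-- gates and the addresses in the table can be bounded without knowing the numbers of inputs, which
-- are bounded afterwards from the table.

Literals : Set
Literals = List Literal

varsOf : Literals → List Var
varsOf = map litVar

-- e ∖ zs ⊆ f
Below : List Var → List Var → List Var → Set
Below zs e f = All (λ v → v ∈ zs ⊎ v ∈ f) e

below? : ∀ zs e f → Dec (Below zs e f)
below? zs e f = all? (λ v → (v ∈? zs) ⊎-dec (v ∈? f)) e

Below-refl : ∀ {zs e} → Below zs e e
Below-refl = All.tabulate inj₂

Below-trans : ∀ {zs e f g} → Below zs e f → Below zs f g → Below zs e g
Below-trans e≤f f≤g = All.map [ inj₁ , All.lookup f≤g ] e≤f

Below-∷ : ∀ {x zs e f} → Below zs e f → Below (x ∷ zs) e f
Below-∷ = All.map [ inj₁ ∘ there , inj₂ ]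

-- Reversed β-elimination orders: the vertex eliminated first is the last one.
data Elim (H : Hypergraph) : List Var → Set where
  []   : Elim H []
  elim : ∀ {x ys} → x ∉ ys →
         (∀ {e f} → e ∈ H → f ∈ H → x ∈ e → x ∈ f → Below (x ∷ ys) e f ⊎ Below (x ∷ ys) f e) →
         Elim H ys → Elim H (x ∷ ys)

Elim-fresh : ∀ {H x ys} → Elim H (x ∷ ys) → x ∉ ys
Elim-fresh (elim x∉ys _ _) = x∉ys

Elim-tail : ∀ {H x ys} → Elim H (x ∷ ys) → Elim H ys
Elim-tail (elim _ _ el) = el

Touch : List Var → Literals → Literals → Set
Touch zs c d = ∃[ z ] z ∈ zs × z ∈ varsOf c × z ∈ varsOf d

-- `P` is a parameter because components arise from two predicates, membership in a given set and
-- nearness to a representative, and comparing the two means changing `P` along a path. The start of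
-- a path need not satisfy it.
data Reach (zs : List Var) (P : Literals → Set) (c : Literals) : Literals → Set where
  origin : Reach zs P c c
  onward : ∀ {d e} → Reach zs P c d → P e → Touch zs d e → Reach zs P c e

Reach-trans : ∀ {zs P c d e} → Reach zs P c d → Reach zs P d e → Reach zs P c e
Reach-trans r origin            = r
Reach-trans r (onward r′ p t) = onward (Reach-trans r r′) p t

Reach-∷ : ∀ {x zs P c d} → Reach zs P c d → Reach (x ∷ zs) P c d
Reach-∷ origin                          = origin
Reach-∷ (onward r p (z , z∈ , z∈c , z∈d)) = onward (Reach-∷ r) p (z , there z∈ , z∈c , z∈d)

AllPairs-lookup : ∀ {A : Set} {R : A → A → Set} → Symmetric R → ∀ {xs x y} →
                  AllPairs R xs → x ∈ xs → y ∈ xs → x ≡ y ⊎ R x y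
AllPairs-lookup R-sym (_ ∷ _)  (here refl) (here refl) = inj₁ refl
AllPairs-lookup R-sym (r ∷ _)  (here refl) (there y∈)  = inj₂ (All.lookup r y∈)
AllPairs-lookup R-sym (r ∷ _)  (there x∈)  (here refl) = inj₂ (R-sym (All.lookup r x∈))
AllPairs-lookup R-sym (_ ∷ rs) (there x∈)  (there y∈)  = AllPairs-lookup R-sym rs x∈ y∈

-- Connected components along an elimination order

module Components {A : Set} (lits : A → Literals) where

  vars : A → List Var
  vars = varsOf ∘ lits

  -- A nonempty set with a distinguished representative.
  Block : Set
  Block = A × List A

  rep : Block → A
  rep = proj₁

  members : Block → List A
  members (r , m) = r ∷ m

  -- The representative of `c` survives, so this is meant for the case that the representative of
  -- `b` lies below that of `c`.
  glue : Block → Block → Block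
  glue b c = rep c , proj₂ c ++ members b

  -- One test suffices: the representatives share the vertex being eliminated, hence are nested
  -- beyond it, and a failed test means the other inclusion.
  absorb : List Var → Block → Block → Block
  absorb zs b c = if does (below? zs (vars (rep b)) (vars (rep c))) then glue b c else glue c b

  -- Testing the representative is enough: all variables of the block that are not yet processed
  -- occur in it.
  touches? : ∀ x b → Dec (x ∈ vars (rep b))
  touches? x b = x ∈? vars (rep b)

  join : List Var → List Block → List Block → List Block
  join zs []       us = us
  join zs (t ∷ ts) us = foldr (absorb zs) t ts ∷ us

  merge : Var → List Var → List Block → List Block
  merge x ys bs = join (x ∷ ys) (filter (touches? x) bs) (filter (¬? ∘ touches? x) bs)

  components : List Var → List A → List Block
  components []       S = map (_, []) S
  components (x ∷ ys) S = merge x ys (components ys S)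

  -- `join` puts the merged block in front, so this retrieves it whenever the last variable was met
  -- by some block.
  firstBlock : List Block → List A
  firstBlock []      = []
  firstBlock (b ∷ _) = members b

  -- `Q` will be having different sets of literals. Entries also carry addresses, so this is not the
  -- same as being different entries.
  module _ (Q : A → A → Set) (Q-sym : Symmetric Q) where

    record Coherent (ys : List Var) (S : List A) (b : Block) : Set where
      field
        within    : ∀ {D} → D ∈ members b → D ∈ S
        dominated : ∀ {D} → D ∈ members b → Below ys (vars D) (vars (rep b))
        connected : ∀ {D E} → D ∈ members b → E ∈ members b →
                    Reach ys (_∈ map lits S) (lits D) (lits E)
        distinct  : AllPairs Q (members b)

    open Coherent

    -- Two uses: disjoint variables yield decomposability, and `Q` yields different representatives,
    -- hence the bound on the fan-in.
    Apart : List Var → Block → Block → Set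
    Apart ys b c = ∀ D E → D ∈ members b → E ∈ members c →
                   Q D E × (∀ {z} → z ∈ ys → z ∈ vars D → z ∉ vars E)

    Apart-sym : ∀ {ys} → Symmetric (Apart ys)
    Apart-sym a E D E∈ D∈ = let (q , n) = a D E D∈ E∈ in
      Q-sym q , λ z∈ z∈E z∈D → n z∈ z∈D z∈E

    record Partition (ys : List Var) (S : List A) (bs : List Block) : Set where
      field
        covered  : ∀ {D} → D ∈ S → ∃[ b ] b ∈ bs × D ∈ members b
        coherent : ∀ {b} → b ∈ bs → Coherent ys S b
        apart    : AllPairs (Apart ys) bs

    open Partition

    Coherent-∷ : ∀ {x ys S b} → Coherent ys S b → Coherent (x ∷ ys) S b
    Coherent-∷ c = record
      { within    = within c
      ; dominated = Below-∷ ∘ dominated c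
      ; connected = λ D∈ E∈ → Reach-∷ (connected c D∈ E∈)
      ; distinct  = distinct c
      }

    Cross : Block → Block → Set
    Cross b c = ∀ {D E} → D ∈ members b → E ∈ members c → Q D E

    glue-coherent : ∀ {x ys S b c} → Coherent (x ∷ ys) S b → Coherent (x ∷ ys) S c →
      x ∈ vars (rep b) → x ∈ vars (rep c) → Cross b c →
      Below (x ∷ ys) (vars (rep b)) (vars (rep c)) → Coherent (x ∷ ys) S (glue b c)
    glue-coherent {x} {ys} {S} {b} {c} B C x∈b x∈c cross b≤c = record
      { within    = λ D∈ → [ within C , within B ] (∈-++⁻ (members c) D∈)
      ; dominated = λ D∈ → [ dominated C , (λ D∈b → Below-trans (dominated B D∈b) b≤c) ]
                             (∈-++⁻ (members c) D∈)
      ; connected = λ D∈ E∈ → conn (∈-++⁻ (members c) D∈) (∈-++⁻ (members c) E∈)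
      ; distinct  = AllPairs.++⁺ (distinct C) (distinct B)
                      (All.tabulate λ E∈ → All.tabulate λ D∈ → Q-sym (cross D∈ E∈))
      }
      where
      conn : ∀ {D E} → D ∈ members c ⊎ D ∈ members b → E ∈ members c ⊎ E ∈ members b →
             Reach (x ∷ ys) (_∈ map lits S) (lits D) (lits E)
      conn (inj₁ D∈) (inj₁ E∈) = connected C D∈ E∈
      conn (inj₂ D∈) (inj₂ E∈) = connected B D∈ E∈
      -- Both representatives contain `x`, so the path crosses from one block to the other through
      -- them.
      conn (inj₁ D∈) (inj₂ E∈) = Reach-trans
        (onward (connected C D∈ (here refl)) (∈-map⁺ lits (within B (here refl)))
              (x , here refl , x∈c , x∈b))
        (connected B (here refl) E∈)
      conn (inj₂ D∈) (inj₁ E∈) = Reach-trans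
        (onward (connected B D∈ (here refl)) (∈-map⁺ lits (within C (here refl)))
              (x , here refl , x∈b , x∈c))
        (connected C (here refl) E∈)

    module _ {H : Hypergraph} {S : List A} (S⊆H : ∀ {D} → D ∈ S → vars D ∈ H) where

      module _ {x ys}
        (nest : ∀ {e f} → e ∈ H → f ∈ H → x ∈ e → x ∈ f →
                Below (x ∷ ys) e f ⊎ Below (x ∷ ys) f e) where

        absorb-coherent : ∀ {b c} → Coherent (x ∷ ys) S b → Coherent (x ∷ ys) S c →
          x ∈ vars (rep b) → x ∈ vars (rep c) → Cross b c →
          let d = absorb (x ∷ ys) b c in
          Coherent (x ∷ ys) S d × x ∈ vars (rep d) ×
          (∀ {D} → D ∈ members d → D ∈ members b ⊎ D ∈ members c) ×
          (∀ {D} → D ∈ members b ⊎ D ∈ members c → D ∈ members d)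
        absorb-coherent {b} {c} B C x∈b x∈c cross
          with below? (x ∷ ys) (vars (rep b)) (vars (rep c))
        ... | yes b≤c = glue-coherent B C x∈b x∈c cross b≤c , x∈c ,
              swap ∘ ∈-++⁻ (members c) , [ ∈-++⁺ʳ (members c) , ∈-++⁺ˡ ]
        ... | no  b≰c = glue-coherent C B x∈c x∈b (λ D∈ E∈ → Q-sym (cross E∈ D∈)) c≤b , x∈b ,
              ∈-++⁻ (members b) , [ ∈-++⁺ˡ , ∈-++⁺ʳ (members b) ]
          where
          c≤b : Below (x ∷ ys) (vars (rep c)) (vars (rep b))
          c≤b = [ ⊥-elim ∘ b≰c , id ]
            (nest (S⊆H (within B (here refl))) (S⊆H (within C (here refl))) x∈b x∈c)

        fold-coherent : ∀ t ts → (∀ {b} → b ∈ t ∷ ts → Coherent (x ∷ ys) S b × x ∈ vars (rep b)) →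
          AllPairs (Apart ys) (t ∷ ts) →
          let d = foldr (absorb (x ∷ ys)) t ts in
          Coherent (x ∷ ys) S d × x ∈ vars (rep d) ×
          (∀ {D} → D ∈ members d → ∃[ b ] b ∈ t ∷ ts × D ∈ members b) ×
          (∀ {D b} → b ∈ t ∷ ts → D ∈ members b → D ∈ members d)
        fold-coherent t [] h _ = let (T , x∈t) = h (here refl) in
          T , x∈t , (λ D∈ → t , here refl , D∈) , λ { (here refl) D∈ → D∈ }
        fold-coherent t (c ∷ cs) h ((tc ∷ tcs) ∷ (ccs ∷ ap)) =
          let (R , x∈R , R⁻ , R⁺) = fold-coherent t cs
                (λ { (here refl) → h (here refl) ; (there b∈) → h (there (there b∈)) }) (tcs ∷ ap)
              (C , x∈c) = h (there (here refl))
              (G , x∈G , G⁻ , G⁺) = absorb-coherent C R x∈c x∈R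
                (λ D∈ E∈ → let (b , b∈ , E∈b) = R⁻ E∈ in
                   proj₁ (All.lookup (Apart-sym tc ∷ ccs) b∈ _ _ D∈ E∈b))
          in G , x∈G ,
             (λ D∈ → [ (λ D∈c → c , there (here refl) , D∈c)
                     , (λ D∈R → let (b , b∈ , D∈b) = R⁻ D∈R in b , weaken∈ b∈ , D∈b) ] (G⁻ D∈)) ,
             λ { (here refl) D∈          → G⁺ (inj₂ (R⁺ (here refl) D∈))
               ; (there (here refl)) D∈  → G⁺ (inj₁ D∈)
               ; (there (there b∈)) D∈   → G⁺ (inj₂ (R⁺ (there b∈) D∈)) }
          where
          weaken∈ : ∀ {b} → b ∈ t ∷ cs → b ∈ t ∷ c ∷ cs
          weaken∈ (here refl) = here refl
          weaken∈ (there b∈)  = there (there b∈)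

      join-partition : ∀ {x ys} bs ts us → x ∉ ys →
        (∀ {e f} → e ∈ H → f ∈ H → x ∈ e → x ∈ f →
           Below (x ∷ ys) e f ⊎ Below (x ∷ ys) f e) →
        Partition ys S bs →
        (∀ {b} → b ∈ bs → b ∈ ts ⊎ b ∈ us) →
        (∀ {b} → b ∈ ts → b ∈ bs × x ∈ vars (rep b)) →
        (∀ {b} → b ∈ us → b ∈ bs × x ∉ vars (rep b)) →
        AllPairs (Apart ys) ts → AllPairs (Apart ys) us →
        Partition (x ∷ ys) S (join (x ∷ ys) ts us)
      join-partition {x} {ys} bs ts us x∉ys nest P split t⁻ u⁻ ap-t ap-u = go ts split t⁻ ap-t
        where
        -- By domination, an `x` in a member would lie in `ys` or in the representative of `u`.
        fresh : ∀ {u E} → u ∈ us → E ∈ members u → x ∉ vars E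
        fresh u∈ E∈ x∈E = let (u∈bs , x∉u) = u⁻ u∈ in
          [ x∉ys , x∉u ] (All.lookup (dominated (coherent P u∈bs) E∈) x∈E)

        apart-∷ : ∀ {b u} → u ∈ us → Apart ys b u → Apart (x ∷ ys) b u
        apart-∷ u∈ a D E D∈ E∈ = proj₁ (a D E D∈ E∈) ,
          λ { (here refl) _   → fresh u∈ E∈
            ; (there z∈)  z∈D → proj₂ (a D E D∈ E∈) z∈ z∈D }

        apart-us : ∀ {vs} → (∀ {u} → u ∈ vs → u ∈ us) → AllPairs (Apart ys) vs →
                   AllPairs (Apart (x ∷ ys)) vs
        apart-us vs⊆ []       = []
        apart-us vs⊆ (a ∷ as) =
          All.tabulate (λ u∈ → apart-∷ (vs⊆ (there u∈)) (All.lookup a u∈)) ∷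
          apart-us (vs⊆ ∘ there) as

        go : ∀ ts → (∀ {b} → b ∈ bs → b ∈ ts ⊎ b ∈ us) →
             (∀ {b} → b ∈ ts → b ∈ bs × x ∈ vars (rep b)) → AllPairs (Apart ys) ts →
             Partition (x ∷ ys) S (join (x ∷ ys) ts us)
        go [] split t⁻ ap-t = record
          { covered  = λ D∈ → let (b , b∈ , D∈b) = covered P D∈ in
              b , [ (λ ()) , id ] (split b∈) , D∈b
          ; coherent = λ u∈ → Coherent-∷ (coherent P (proj₁ (u⁻ u∈)))
          ; apart    = apart-us id ap-u
          }
        go (t ∷ ts) split t⁻ ap-t =
          let (G , x∈G , G⁻ , G⁺) = fold-coherent nest t ts
                (λ b∈ → let (b∈bs , x∈b) = t⁻ b∈ in Coherent-∷ (coherent P b∈bs) , x∈b) ap-t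
          in record
          { covered  = λ D∈ → let (b , b∈ , D∈b) = covered P D∈ in
              [ (λ b∈ts → _ , here refl , G⁺ b∈ts D∈b) , (λ b∈us → b , there b∈us , D∈b) ]
              (split b∈)
          ; coherent = λ { (here refl) → G ; (there u∈) → Coherent-∷ (coherent P (proj₁ (u⁻ u∈))) }
          ; apart    = All.tabulate (λ u∈ → apart-∷ u∈ λ D E D∈ E∈ →
                         let (b , b∈ , D∈b)  = G⁻ D∈
                             (b∈bs , x∈b)    = t⁻ b∈
                             (u∈bs , x∉u)    = u⁻ u∈
                         -- The constituent block `b` meets `x` and `u` does not, so they are
                         -- different blocks and were apart before the merge.
                         in [ (λ { refl → ⊥-elim (x∉u x∈b) }) , (λ a → a D E D∈b E∈) ]
                              (AllPairs-lookup Apart-sym (apart P) b∈bs u∈bs))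
                       ∷ apart-us id ap-u
          }

      components-partition : AllPairs Q S → ∀ {ys} → Elim H ys → Partition ys S (components ys S)
      components-partition qs [] = record
        { covered  = λ D∈ → _ , ∈-map⁺ (_, []) D∈ , here refl
        ; coherent = λ b∈ → singleton (∈-map⁻ (_, []) b∈)
        ; apart    = AllPairs.map⁺ (AllPairs.map
            (λ q → λ { _ _ (here refl) (here refl) → q , λ () }) qs)
        }
        where
        singleton : ∀ {b} → ∃[ D ] D ∈ S × b ≡ (D , []) → Coherent [] S b
        singleton (D , D∈ , refl) = record
          { within    = λ { (here refl) → D∈ }
          ; dominated = λ { (here refl) → Below-refl }
          ; connected = λ { (here refl) (here refl) → origin }
          ; distinct  = [] ∷ []
          }
      components-partition qs {x ∷ ys} (elim x∉ys nest el) =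
        join-partition bs (filter (touches? x) bs) (filter (¬? ∘ touches? x) bs) x∉ys nest P
          (λ {b} b∈ → split b∈ (touches? x b))
          (∈-filter⁻ (touches? x)) (∈-filter⁻ (¬? ∘ touches? x))
          (AllPairs.filter⁺ (touches? x) (apart P)) (AllPairs.filter⁺ (¬? ∘ touches? x) (apart P))
        where
        bs = components ys S
        P  = components-partition qs el
        split : ∀ {b} → b ∈ bs → Dec (x ∈ vars (rep b)) → _
        split b∈ (yes x∈) = inj₁ (∈-filter⁺ (touches? x) b∈ x∈)
        split b∈ (no x∉)  = inj₂ (∈-filter⁺ (¬? ∘ touches? x) b∈ x∉)

-- Literals, assignments and sub-formulas

pos-injective : ∀ {x y} → pos x ≡ pos y → x ≡ y
pos-injective refl = refl

neg-injective : ∀ {x y} → neg x ≡ neg y → x ≡ y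
neg-injective refl = refl

infix 4 _≟ᴸ_ _∈ᴸ?_

_≟ᴸ_ : (ℓ ℓ′ : Literal) → Dec (ℓ ≡ ℓ′)
pos x ≟ᴸ pos y = map′ (cong pos) pos-injective (x ≟ y)
pos x ≟ᴸ neg y = no λ ()
neg x ≟ᴸ pos y = no λ ()
neg x ≟ᴸ neg y = map′ (cong neg) neg-injective (x ≟ y)

_∈ᴸ?_ : (ℓ : Literal) (c : Literals) → Dec (ℓ ∈ c)
ℓ ∈ᴸ? c = any? (ℓ ≟ᴸ_) c

Sub : List Var → Literals → Literals → Set
Sub zs c d = All (λ ℓ → litVar ℓ ∈ zs ⊎ ℓ ∈ d) c

sub? : ∀ zs c d → Dec (Sub zs c d)
sub? zs c d = all? (λ ℓ → (litVar ℓ ∈? zs) ⊎-dec (ℓ ∈ᴸ? d)) c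

Sub-refl : ∀ {zs c} → Sub zs c c
Sub-refl = All.tabulate inj₂

Sub-trans : ∀ {zs c d e} → Sub zs c d → Sub zs d e → Sub zs c e
Sub-trans c≤d d≤e = All.map [ inj₁ , All.lookup d≤e ] c≤d

Sub-∷ : ∀ {x zs c d} → Sub zs c d → Sub (x ∷ zs) c d
Sub-∷ = All.map (Sum.map₁ there)

Falsifies : Assignment → List Var → Literals → Set
Falsifies σ zs c = All (λ ℓ → litVar ℓ ∈ zs ⊎ evalLiteral σ ℓ ≡ false) c

evalLiteral-complement : ∀ σ ℓ ℓ′ → litVar ℓ ≡ litVar ℓ′ → ℓ ≢ ℓ′ →
                         evalLiteral σ ℓ′ ≡ not (evalLiteral σ ℓ)
evalLiteral-complement σ (pos x) (pos y) refl ℓ≢ = ⊥-elim (ℓ≢ refl)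
evalLiteral-complement σ (pos x) (neg y) refl ℓ≢ = refl
evalLiteral-complement σ (neg x) (pos y) refl ℓ≢ = sym (not-involutive (σ x))
evalLiteral-complement σ (neg x) (neg y) refl ℓ≢ = ⊥-elim (ℓ≢ refl)

falsified-unique : ∀ σ {ℓ ℓ′} → litVar ℓ ≡ litVar ℓ′ →
                   evalLiteral σ ℓ ≡ false → evalLiteral σ ℓ′ ≡ false → ℓ ≡ ℓ′
falsified-unique σ {ℓ} {ℓ′} x≡ f f′ with ℓ ≟ᴸ ℓ′
... | yes ℓ≡ = ℓ≡
... | no  ℓ≢ with () ← trans (sym f′) (trans (evalLiteral-complement σ ℓ ℓ′ x≡ ℓ≢) (cong not f))

-- A variable has only one literal that is false under `σ`, so beyond `zs` the variables of either
-- clause determine its literals. This turns nesting of edges into a condition on clauses in which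
-- `σ` no longer occurs.
Below⇒Sub : ∀ {σ zs c d} → Falsifies σ zs c → Falsifies σ zs d →
            Below zs (varsOf c) (varsOf d) → Sub zs c d
Below⇒Sub {σ} {zs} {c} {d} fc fd c≤d = All.tabulate λ {ℓ} ℓ∈ →
  [ inj₁
  , (λ f → [ inj₁ , (λ x∈ → let (ℓ′ , ℓ′∈ , x≡) = ∈-map⁻ litVar x∈ in
       [ (λ x∈zs → inj₁ (subst (_∈ zs) (sym x≡) x∈zs))
       , (λ f′ → inj₂ (subst (_∈ d) (sym (falsified-unique σ x≡ f f′)) ℓ′∈))
       ] (All.lookup fd ℓ′∈)) ]
     (All.lookup c≤d (∈-map⁺ litVar ℓ∈)))
  ] (All.lookup fc ℓ∈)

≐-refl : {A : Set} {xs : List A} → xs ≐ xs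
≐-refl = (λ x∈ → x∈) , (λ x∈ → x∈)

≐-sym : {A : Set} → Symmetric (_≐_ {A})
≐-sym (⊆ , ⊇) = ⊇ , ⊆

≐-trans : {A : Set} {xs ys zs : List A} → xs ≐ ys → ys ≐ zs → xs ≐ zs
≐-trans (⊆₁ , ⊇₁) (⊆₂ , ⊇₂) = ⊆₂ ∘ ⊆₁ , ⊇₁ ∘ ⊇₂

module _ {A : Set} {R : A → A → Set} (R-sym : Symmetric R)
         (R-trans : ∀ {x y z} → R x y → R y z → R x z) where

  remove : ∀ {x ys} → Any (R x) ys → ∃[ zs ] length ys ≡ suc (length zs) ×
           (∀ {y} → ¬ R x y → Any (R y) ys → Any (R y) zs)
  remove {ys = y ∷ ys} (here r)  = ys , refl , λ where
    ¬r (here r′) → ⊥-elim (¬r (R-trans r (R-sym r′)))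
    ¬r (there a) → a
  remove {ys = y ∷ ys} (there a) = let (zs , eq , f) = remove a in
    y ∷ zs , cong suc eq , λ where
      ¬r (here r′)  → here r′
      ¬r (there a′) → there (f ¬r a′)

  -- Pigeonhole modulo `R`: each entry of `xs` uses up one partner in `ys`, which by transitivity no
  -- unrelated entry needs. It counts edges up to mutual inclusion and, with equality, the variables
  -- of a clause.
  length-≤ : ∀ {xs ys} → AllPairs (λ x y → ¬ R x y) xs →
             (∀ {x} → x ∈ xs → Any (R x) ys) → length xs ≤ length ys
  length-≤ {[]}     _        _ = z≤n
  length-≤ {x ∷ xs} (r ∷ rs) h = let (zs , eq , f) = remove (h (here refl)) in
    ≤-trans (s≤s (length-≤ rs λ y∈ → f (All.lookup r y∈) (h (there y∈)))) (≤-reflexive (sym eq))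

∣∣-≥ : ∀ {H es} → AllPairs (λ e f → ¬ e ≐ f) es → es ⊆ H → length es ≤ ∣ H ∣
∣∣-≥ {H} {es} ap es⊆H = length-≤ {R = _≐_} (λ {e} {f} → ≐-sym {x = e} {f})
  (λ {e} {f} {g} → ≐-trans {xs = e} {f} {g}) ap λ {e} e∈ →
  Any.deduplicate⁺ _≐?_ (λ {f} {g} g≐f e≐f → ≐-trans {xs = e} {f} {g} e≐f (≐-sym {x = g} {f} g≐f))
    (Any.map (λ { refl → ≐-refl {xs = e} }) (es⊆H e∈))

refute : Literals → Assignment
refute c x = does (neg x ∈ᴸ? c)

refute-falsifies : ∀ {c} → (∀ x → pos x ∈ c → neg x ∉ c) → ∀ {ℓ} → ℓ ∈ c →
                   evalLiteral (refute c) ℓ ≡ false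
refute-falsifies {c} nt {pos x} ℓ∈ = dec-false (neg x ∈ᴸ? c) (nt x ℓ∈)
refute-falsifies {c} nt {neg x} ℓ∈ = cong not (dec-true (neg x ∈ᴸ? c) ℓ∈)

-- `evalLiteral (λ _ → true) ℓ` is the sign of `ℓ`, the value of its variable that makes it true.
satisfy : Literal → Assignment → Assignment
satisfy ℓ σ y = if does (y ≟ litVar ℓ) then evalLiteral (λ _ → true) ℓ else σ y

evalLiteral-satisfy : ∀ ℓ σ → evalLiteral (satisfy ℓ σ) ℓ ≡ true
evalLiteral-satisfy (pos x) σ rewrite dec-true (x ≟ x) refl = refl
evalLiteral-satisfy (neg x) σ rewrite dec-true (x ≟ x) refl = refl

evalLiteral-satisfy-≢ : ∀ ℓ σ ℓ′ → litVar ℓ′ ≢ litVar ℓ →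
                        evalLiteral (satisfy ℓ σ) ℓ′ ≡ evalLiteral σ ℓ′
evalLiteral-satisfy-≢ ℓ σ (pos y) ≢ rewrite dec-false (y ≟ litVar ℓ) ≢ = refl
evalLiteral-satisfy-≢ ℓ σ (neg y) ≢ rewrite dec-false (y ≟ litVar ℓ) ≢ = refl

-- Literals outside `zs` count as false, whatever `τ` says about them.
Sat : List Var → Assignment → Literals → Set
Sat zs τ c = ∃[ ℓ ] ℓ ∈ c × litVar ℓ ∈ zs × evalLiteral τ ℓ ≡ true

-- Sets of clauses split off at a variable

module Selections {A : Set} (lits : A → Literals) where

  open Components lits

  near : List Var → List A → Literals → List A
  near zs T c = filter (λ E → sub? zs (lits E) c) T

  -- For a variable x of c: the clauses that form one component with c.
  key : Var → List Var → List A → Literals → List A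
  key x ys T c = firstBlock (components (x ∷ ys) (near (x ∷ ys) T c))

  -- What is left when `ℓ` is true. The complementary literal need not be deleted, since
  -- satisfaction relative to the earlier variables ignores it.
  restrict : Literal → List A → List A
  restrict ℓ K = filter (λ E → ¬? (ℓ ∈ᴸ? lits E)) K

-- Context-free sub-formulas and their agreement with components

module Keys (F : List Literals) where

  Near : List Var → Literals → Literals → Set
  Near zs c d = d ∈ F × Sub zs d c

  -- The clauses in the sub-formula that the pointer of the clause c stands for once the
  -- variables in ys have been processed.
  Mem : List Var → Literals → Literals → Set
  Mem []       c d = d ≡ c
  Mem (x ∷ ys) c d with x ∈? varsOf c
  ... | yes _ = Reach (x ∷ ys) (Near (x ∷ ys) c) c d
  ... | no  _ = Mem ys c d

  Reach-Near-Sub : ∀ {zs c d} → Reach zs (Near zs c) c d → Sub zs d c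
  Reach-Near-Sub origin              = Sub-refl
  Reach-Near-Sub (onward _ (_ , s) _) = s

  Mem-Sub : ∀ ys {c d} → Mem ys c d → Sub ys d c
  Mem-Sub []       refl = Sub-refl
  Mem-Sub (x ∷ ys) {c} m with x ∈? varsOf c
  ... | yes _ = Reach-Near-Sub m
  ... | no  _ = Sub-∷ (Mem-Sub ys m)

  Mem-∈ : ∀ {x ys c d} → x ∈ varsOf c →
          (Reach (x ∷ ys) (Near (x ∷ ys) c) c d → Mem (x ∷ ys) c d) ×
          (Mem (x ∷ ys) c d → Reach (x ∷ ys) (Near (x ∷ ys) c) c d)
  Mem-∈ {x} {c = c} x∈ with x ∈? varsOf c
  ... | yes _ = id , id
  ... | no x∉ = ⊥-elim (x∉ x∈)

  Mem-∉ : ∀ {x ys c d} → x ∉ varsOf c →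
          (Mem ys c d → Mem (x ∷ ys) c d) × (Mem (x ∷ ys) c d → Mem ys c d)
  Mem-∉ {x} {c = c} x∉ with x ∈? varsOf c
  ... | yes x∈ = ⊥-elim (x∉ x∈)
  ... | no _   = id , id

  module _ {A : Set} (lits : A → Literals) where

    open Components lits

    Distinct : A → A → Set
    Distinct D E = ¬ lits D ≐ lits E

    Distinct-sym : Symmetric Distinct
    Distinct-sym {D} {E} n = n ∘ ≐-sym {x = lits E} {lits D}

    foldr-absorb-touches : ∀ {x zs} t ts → x ∈ vars (rep t) → (∀ {b} → b ∈ ts → x ∈ vars (rep b)) →
                           x ∈ vars (rep (foldr (absorb zs) t ts))
    foldr-absorb-touches t []       x∈ _ = x∈
    foldr-absorb-touches {x} {zs} t (c ∷ cs) x∈ h =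
      lemma (foldr-absorb-touches t cs x∈ (h ∘ there)) (h (here refl))
      where
      lemma : ∀ {b} → x ∈ vars (rep b) → x ∈ vars (rep c) → x ∈ vars (rep (absorb zs c b))
      lemma {b} x∈b x∈c with does (below? zs (vars (rep c)) (vars (rep b)))
      ... | true  = x∈b
      ... | false = x∈c

    -- Each block is an old one missing `x` or the merged one. This dichotomy mirrors the two cases
    -- of `Mem`.
    merge-∈ : ∀ {x ys bs b} → b ∈ merge x ys bs →
              (b ∈ bs × x ∉ vars (rep b)) ⊎
              (members b ≡ firstBlock (merge x ys bs) × x ∈ vars (rep b))
    merge-∈ {x} {ys} {bs} = go (filter (touches? x) bs) (proj₂ ∘ ∈-filter⁻ (touches? x) {xs = bs})
      where
      us = filter (¬? ∘ touches? x) bs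
      go : ∀ ts → (∀ {b} → b ∈ ts → x ∈ vars (rep b)) → ∀ {b} → b ∈ join (x ∷ ys) ts us →
           (b ∈ bs × x ∉ vars (rep b)) ⊎
           (members b ≡ firstBlock (join (x ∷ ys) ts us) × x ∈ vars (rep b))
      go []       h b∈          = inj₁ (∈-filter⁻ (¬? ∘ touches? x) b∈)
      go (t ∷ ts) h (here refl) =
        inj₂ (refl , foldr-absorb-touches t ts (h (here refl)) (h ∘ there))
      go (t ∷ ts) h (there b∈)  = inj₁ (∈-filter⁻ (¬? ∘ touches? x) b∈)

    private
      Partition′ = Partition Distinct (λ {D} {E} → Distinct-sym {D} {E})

    module _ {ys S bs} (P : Partition′ ys S bs) where
      open Partition P
      open Coherent

      closed-block : ∀ {b D E} → b ∈ bs → D ∈ members b → E ∈ S → Touch ys (lits D) (lits E) →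
                     E ∈ members b
      closed-block {b} b∈ D∈ E∈ (z , z∈ , z∈D , z∈E) =
        let (c , c∈ , E∈c) = covered E∈ in
        [ (λ { refl → E∈c }) , (λ a → ⊥-elim (proj₂ (a _ _ D∈ E∈c) z∈ z∈D z∈E)) ]
          (AllPairs-lookup (λ {b} {c} → Apart-sym Distinct (λ {D} {E} → Distinct-sym {D} {E}) {ys} {b} {c}) apart b∈ c∈)

      closed-block′ : ∀ {b c d} → b ∈ bs → c ∈ map lits (members b) → d ∈ map lits S → Touch ys c d →
                      d ∈ map lits (members b)
      closed-block′ b∈ c∈ d∈ t with ∈-map⁻ lits c∈ | ∈-map⁻ lits d∈
      ... | D , D∈ , refl | E , E∈ , refl = ∈-map⁺ lits (closed-block b∈ D∈ E∈ t)

      module _ {b R} (b∈ : b ∈ bs) (R∈ : R ∈ members b) (P : Literals → Set)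
               (P-b : ∀ {D} → D ∈ members b → P (lits D))
               (P-S : ∀ {c d} → c ∈ map lits (members b) → P d → Touch ys c d → d ∈ map lits S)
        where

        -- A path that starts in the block never leaves it: the next clause satisfies `P` and
        -- touches the block, hence lies in `S`, and a block contains every clause of `S` that it
        -- touches. The start may be any member, not only the representative.
        Reach⇒∈ : ∀ {d} → Reach ys P (lits R) d → d ∈ map lits (members b)
        Reach⇒∈ origin         = ∈-map⁺ lits R∈
        Reach⇒∈ (onward r p t) = closed-block′ b∈ (Reach⇒∈ r) (P-S (Reach⇒∈ r) p t) t

        private
          -- A path through `S` stays in the block for the same reason, and there `P` holds.
          strengthen : ∀ {d} → Reach ys (_∈ map lits S) (lits R) d →
                       d ∈ map lits (members b) × Reach ys P (lits R) d
          strengthen origin = ∈-map⁺ lits R∈ , origin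
          strengthen (onward r p t) with strengthen r
          ... | c∈ , r′ with closed-block′ b∈ c∈ p t
          ... | d∈ with ∈-map⁻ lits d∈
          ... | D , D∈ , refl = d∈ , onward r′ (P-b D∈) t

        ∈⇒Reach : ∀ {D} → D ∈ members b → Reach ys P (lits R) (lits D)
        ∈⇒Reach D∈ = proj₂ (strengthen (connected (coherent b∈) R∈ D∈))

    -- Without this saturation, a path of clauses near a representative could run through clauses of
    -- `F` outside the set, and the set could not be recovered from the representative.
    Closed : List Var → List A → Set
    Closed ys S = ∀ {D R d} → D ∈ S → R ∈ S → d ∈ F → Touch ys (lits D) d → Sub ys d (lits R) →
                  d ∈ map lits S

    Closed-∷⁻ : ∀ {x ys S} → Closed (x ∷ ys) S → Closed ys S
    Closed-∷⁻ cl D∈ R∈ d∈ (z , z∈ , z∈D , z∈d) s = cl D∈ R∈ d∈ (z , there z∈ , z∈D , z∈d) (Sub-∷ s)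

    module _ {S} (S⊆F : ∀ {D} → D ∈ S → lits D ∈ F) (S-distinct : AllPairs Distinct S) (σ : Assignment)
      where

      partition : ∀ {ys} → Elim (map varsOf F) ys → Partition′ ys S (components ys S)
      partition = components-partition _ _ (λ D∈ → ∈-map⁺ varsOf (S⊆F D∈)) S-distinct

      -- By induction on `ys`. If the representative misses `x`, the block is an old one. If it
      -- contains `x`, domination and falsification make all members near the representative, and
      -- closedness puts every near clause that touches the block into `S`; so reachability in `S`
      -- and through near clauses agree.
      block-Mem : ∀ {ys} → Elim (map varsOf F) ys → Closed ys S → ∀ {b} → b ∈ components ys S →
                  (∀ {D} → D ∈ members b → Falsifies σ ys (lits D)) →
                  (∀ {d} → Mem ys (lits (rep b)) d → d ∈ map lits (members b)) ×
                  (∀ {D} → D ∈ members b → Mem ys (lits (rep b)) (lits D))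
      block-Mem {[]} _ _ b∈ _ with ∈-map⁻ (_, []) b∈
      ... | D , D∈ , refl = here , λ { (here refl) → refl }
      block-Mem {x ∷ ys} el@(elim x∉ys _ el′) cl {b} b∈ f with merge-∈ {bs = components ys S} b∈
      ... | inj₁ (b∈′ , x∉b) =
        let (M⁻ , M⁺) = block-Mem el′ (Closed-∷⁻ cl) b∈′ f′ in
        M⁻ ∘ proj₂ (Mem-∉ x∉b) , proj₁ (Mem-∉ x∉b) ∘ M⁺
        where
        open Partition (partition el′)
        open Coherent (coherent b∈′)
        -- Dropping `x` from the exempted variables is harmless here: the representative lacks `x`,
        -- hence so do all members.
        f′ : ∀ {D} → D ∈ members b → Falsifies σ ys (lits D)
        f′ D∈ = All.tabulate λ ℓ∈ →
          [ (λ { (here refl) → ⊥-elim ([ x∉ys , x∉b ]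
                   (All.lookup (dominated D∈) (∈-map⁺ litVar ℓ∈)))
               ; (there x∈)  → inj₁ x∈ })
          , inj₂ ] (All.lookup (f D∈) ℓ∈)
      ... | inj₂ (_ , x∈b) =
        Reach⇒∈ P b∈ (here refl) (Near (x ∷ ys) (lits (rep b))) near near-S ∘ proj₂ (Mem-∈ x∈b) ,
        proj₁ (Mem-∈ x∈b) ∘ ∈⇒Reach P b∈ (here refl) (Near (x ∷ ys) (lits (rep b))) near near-S
        where
        P = partition el
        open Partition P
        open Coherent (coherent b∈)
        near : ∀ {D} → D ∈ members b → Near (x ∷ ys) (lits (rep b)) (lits D)
        near D∈ = S⊆F (within D∈) , Below⇒Sub {σ} (f D∈) (f (here refl)) (dominated D∈)
        near-S : ∀ {c d} → c ∈ map lits (members b) → Near (x ∷ ys) (lits (rep b)) d →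
                 Touch (x ∷ ys) c d → d ∈ map lits S
        near-S c∈ (d∈ , s) t with ∈-map⁻ lits c∈
        ... | D , D∈ , refl = cl (within D∈) (within (here refl)) d∈ t s

-- Branching on a variable

module Cofactors (F : List Literals) {A : Set} (lits : A → Literals) where

  open Keys F
  open Components lits
  open Selections lits

  -- The conditions under which every component of `S` is the set that its representative stands
  -- for. They hold for each branch of a decision and for the whole formula at the end.
  record Separable (ys : List Var) (S : List A) : Set where
    field
      ⊆F        : ∀ {D} → D ∈ S → lits D ∈ F
      pairwise  : AllPairs (Distinct lits) S
      σ         : Assignment
      falsified : ∀ {D} → D ∈ S → Falsifies σ ys (lits D)
      closed    : Closed lits ys S

  module Separation {ys S} (sep : Separable ys S) (el : Elim (map varsOf F) ys) where

    open Separable sep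
    private P = partition lits ⊆F pairwise σ el
    open Partition P public
    open Coherent

    Mem⇔ : ∀ {b} → b ∈ components ys S →
           (∀ {d} → Mem ys (lits (rep b)) d → d ∈ map lits (members b)) ×
           (∀ {D} → D ∈ members b → Mem ys (lits (rep b)) (lits D))
    Mem⇔ b∈ = block-Mem lits ⊆F pairwise σ el closed b∈ (falsified ∘ within (coherent b∈))

    member : ∀ {b D} → b ∈ components ys S → D ∈ members b → D ∈ S
    member b∈ = within (coherent b∈)

    -- Representatives of different blocks have different sets of variables. If these sets were
    -- equal, apartness would leave no variable of `ys` in them; all their literals would be false
    -- under one assignment, and equal variables would then give equal clauses.
    length-components : length (components ys S) ≤ ∣ map varsOf F ∣
    length-components = ≤-trans (≤-reflexive (sym (length-map (vars ∘ rep) (components ys S))))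
      (∣∣-≥ (AllPairs.map⁺ (pairs id apart))
        λ e∈ → let (b , b∈ , e≡) = ∈-map⁻ (vars ∘ rep) e∈ in
          subst (_∈ map varsOf F) (sym e≡) (∈-map⁺ varsOf (⊆F (member b∈ (here refl)))))
      where
      agree : ∀ {b c} → b ∈ components ys S → c ∈ components ys S →
              (∀ {z} → z ∈ ys → z ∈ vars (rep b) → z ∉ vars (rep c)) →
              vars (rep b) ⊆ vars (rep c) → lits (rep b) ⊆ lits (rep c)
      agree {b} {c} b∈ c∈ n b⊆c ℓ∈ =
        [ (λ x∈ys → ⊥-elim (n x∈ys (∈-map⁺ litVar ℓ∈) (b⊆c (∈-map⁺ litVar ℓ∈)))) , id ]
          (All.lookup (Below⇒Sub {Separable.σ sep} (falsified (member b∈ (here refl)))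
             (falsified (member c∈ (here refl))) (All.tabulate (λ x∈ → inj₂ (b⊆c x∈)))) ℓ∈)

      pairs : ∀ {bs} → (∀ {b} → b ∈ bs → b ∈ components ys S) →
              AllPairs (Apart _ (λ {D} {E} → Distinct-sym lits {D} {E}) ys) bs →
              AllPairs (λ b c → ¬ vars (rep b) ≐ vars (rep c)) bs
      pairs bs⊆ []       = []
      pairs bs⊆ (a ∷ as) = All.tabulate (λ c∈ (b⊆c , c⊆b) →
          let (q , n) = All.lookup a c∈ _ _ (here refl) (here refl) in
          q ( agree (bs⊆ (here refl)) (bs⊆ (there c∈)) n b⊆c
            , agree (bs⊆ (there c∈)) (bs⊆ (here refl)) (λ z∈ z∈c z∈b → n z∈ z∈b z∈c) c⊆b))
        ∷ pairs (bs⊆ ∘ there) as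

  module Cofactor {T x ys R} (T⊆F : ∀ {D} → D ∈ T → lits D ∈ F) (F⊆T : ∀ {d} → d ∈ F → d ∈ map lits T)
    (T-distinct : AllPairs (Distinct lits) T) (R∈T : R ∈ T) (x∈R : x ∈ vars R)
    (R-nonTaut : ∀ y → pos y ∈ lits R → neg y ∉ lits R)
    (el : Elim (map varsOf F) (x ∷ ys)) where

    private
      c = lits R
      N = near (x ∷ ys) T c
      K = key x ys T c

      N⁻ : ∀ {D} → D ∈ N → D ∈ T × Sub (x ∷ ys) (lits D) c
      N⁻ = ∈-filter⁻ (λ E → sub? (x ∷ ys) (lits E) c)

      N-near : ∀ {d} → d ∈ F → Sub (x ∷ ys) d c → d ∈ map lits N
      N-near d∈ s with ∈-map⁻ lits (F⊆T d∈)
      ... | D , D∈ , refl = ∈-map⁺ lits (∈-filter⁺ (λ E → sub? (x ∷ ys) (lits E) c) D∈ s)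

      N⊆F : ∀ {D} → D ∈ N → lits D ∈ F
      N⊆F = T⊆F ∘ proj₁ ∘ N⁻

      N-distinct : AllPairs (Distinct lits) N
      N-distinct = AllPairs.filter⁺ _ T-distinct

      R∈N : R ∈ N
      R∈N = ∈-filter⁺ (λ E → sub? (x ∷ ys) (lits E) c) R∈T Sub-refl

      P = partition lits N⊆F N-distinct (refute c) el
      module P = Partition P

      x∉ys : x ∉ ys
      x∉ys = Elim-fresh el

      el′ : Elim (map varsOf F) ys
      el′ = Elim-tail el

      -- The block of `R` is the merged one in front, because a block whose representative lacks `x`
      -- cannot contain `R`. Its representative may be another clause than `R`.
      bK : ∃[ b ] b ∈ components (x ∷ ys) N × R ∈ members b × members b ≡ K
      bK with P.covered R∈N
      ... | b , b∈ , R∈b with merge-∈ lits {bs = components ys N} b∈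
      ... | inj₁ (b∈′ , x∉b) =
        ⊥-elim ([ x∉ys , x∉b ] (All.lookup
          (Coherent.dominated (Partition.coherent (partition lits N⊆F N-distinct (refute c) el′) b∈′) R∈b) x∈R))
      ... | inj₂ (eq , _) = b , b∈ , R∈b , eq

      K⊆N : ∀ {D} → D ∈ K → D ∈ N
      K⊆N with b , b∈ , _ , eq ← bK = Coherent.within (P.coherent b∈) ∘ subst (_ ∈_) (sym eq)

    Mem⇒∈key : ∀ {d} → Mem (x ∷ ys) c d → d ∈ map lits K
    Mem⇒∈key with b , b∈ , R∈b , eq ← bK =
      subst (λ K → _ ∈ map lits K) eq ∘
      Reach⇒∈ lits P b∈ R∈b (Near (x ∷ ys) c) (λ D∈ → let n = Coherent.within (P.coherent b∈) D∈ in
          N⊆F n , proj₂ (N⁻ n)) (λ _ (d∈ , s) _ → N-near d∈ s) ∘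
      proj₂ (Mem-∈ x∈R)

    ∈key⇒Mem : ∀ {D} → D ∈ K → Mem (x ∷ ys) c (lits D)
    ∈key⇒Mem with b , b∈ , R∈b , eq ← bK =
      proj₁ (Mem-∈ x∈R) ∘
      ∈⇒Reach lits P b∈ R∈b (Near (x ∷ ys) c) (λ D∈ → let n = Coherent.within (P.coherent b∈) D∈ in
          N⊆F n , proj₂ (N⁻ n)) (λ _ (d∈ , s) _ → N-near d∈ s) ∘
      subst (_ ∈_) (sym eq)

    key⊆T : ∀ {D} → D ∈ K → D ∈ T
    key⊆T = proj₁ ∘ N⁻ ∘ K⊆N

    module _ (ℓ : Literal) (ℓ-x : litVar ℓ ≡ x) where

      restrict⁻ : ∀ {D} → D ∈ restrict ℓ K → D ∈ K × ℓ ∉ lits D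
      restrict⁻ = ∈-filter⁻ (λ E → ¬? (ℓ ∈ᴸ? lits E))

      restrict⁺ : ∀ {D} → D ∈ K → ℓ ∉ lits D → D ∈ restrict ℓ K
      restrict⁺ = ∈-filter⁺ (λ E → ¬? (ℓ ∈ᴸ? lits E))

      -- Outside `x ∷ ys` the members only have literals of `c`, which `refute c` falsifies. On `x`
      -- the surviving clauses can only have the complement of `ℓ`, so the assignment is changed
      -- there to satisfy `ℓ`.
      restrict-separable : Separable ys (restrict ℓ K)
      restrict-separable = record
        { ⊆F        = N⊆F ∘ K⊆N ∘ proj₁ ∘ restrict⁻
        ; pairwise  = AllPairs.filter⁺ _ K-distinct
        ; σ         = satisfy ℓ (refute c)
        ; falsified = λ D∈ → let (D∈K , ℓ∉) = restrict⁻ D∈ in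
            All.tabulate λ {ℓ′} ℓ′∈ →
              let other : litVar ℓ′ ≡ x → evalLiteral (satisfy ℓ (refute c)) ℓ′ ≡ false
                  other x≡ = trans (evalLiteral-complement _ ℓ ℓ′ (trans ℓ-x (sym x≡))
                                      (λ { refl → ℓ∉ ℓ′∈ }))
                                   (cong not (evalLiteral-satisfy ℓ (refute c)))
              in [ (λ { (here x≡) → inj₂ (other x≡) ; (there y∈) → inj₁ y∈ })
                 , (λ ℓ′∈c → inj₂ (kept ℓ′ ℓ′∈c other (litVar ℓ′ ≟ litVar ℓ))) ]
                 (All.lookup (proj₂ (N⁻ (K⊆N D∈K))) ℓ′∈)
        ; closed    = closed
        }
        where
        K-distinct : AllPairs (Distinct lits) K
        K-distinct with b , b∈ , _ , eq ← bK =
          subst (AllPairs (Distinct lits)) eq (Coherent.distinct (P.coherent b∈))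

        kept : ∀ ℓ′ → ℓ′ ∈ c → (litVar ℓ′ ≡ x → evalLiteral (satisfy ℓ (refute c)) ℓ′ ≡ false) →
               Dec (litVar ℓ′ ≡ litVar ℓ) → evalLiteral (satisfy ℓ (refute c)) ℓ′ ≡ false
        kept ℓ′ _   other (yes x≡) = other (trans x≡ ℓ-x)
        kept ℓ′ ℓ′∈ other (no x≢)  =
          trans (evalLiteral-satisfy-≢ ℓ (refute c) ℓ′ x≢) (refute-falsifies R-nonTaut ℓ′∈)

        closed : Closed lits ys (restrict ℓ K)
        closed {D} {R′} D∈ R′∈ d∈ (z , z∈ , z∈D , z∈d) s
          with b , b∈ , R∈b , eq ← bK
          with ∈-map⁻ lits (closed-block′ lits P b∈
                 (∈-map⁺ lits (subst (D ∈_) (sym eq) (proj₁ (restrict⁻ D∈))))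
                 (N-near d∈ (Sub-trans (Sub-∷ s) (proj₂ (N⁻ (K⊆N (proj₁ (restrict⁻ R′∈)))))))
                 (z , there z∈ , z∈D , z∈d))
        -- The new clause is included in `R′` beyond `ys`, and `x` is not in `ys`. Since `R′` lacks
        -- `ℓ`, the new clause lacks it too and survives the restriction.
        ... | E , E∈ , refl = ∈-map⁺ lits (restrict⁺ (subst (E ∈_) eq E∈) λ ℓ∈ →
          [ (λ x∈ → x∉ys (subst (_∈ ys) ℓ-x x∈)) , proj₂ (restrict⁻ R′∈) ] (All.lookup s ℓ∈))

      restrict-sound : ∀ {τ} → evalLiteral τ ℓ ≡ true →
        (∀ {D} → D ∈ restrict ℓ K → Sat ys τ (lits D)) →
        ∀ {d} → Mem (x ∷ ys) c d → Sat (x ∷ ys) τ d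
      restrict-sound τℓ h m with ∈-map⁻ lits (Mem⇒∈key m)
      ... | D , D∈ , refl with ℓ ∈ᴸ? lits D
      ... | yes ℓ∈ = ℓ , ℓ∈ , here ℓ-x , τℓ
      ... | no  ℓ∉ = let (ℓ′ , ℓ′∈ , y∈ , τℓ′) = h (restrict⁺ D∈ ℓ∉) in
                     ℓ′ , ℓ′∈ , there y∈ , τℓ′

      restrict-complete : ∀ {τ} → evalLiteral τ ℓ ≡ true →
        (∀ {d} → Mem (x ∷ ys) c d → Sat (x ∷ ys) τ d) →
        ∀ {D} → D ∈ restrict ℓ K → Sat ys τ (lits D)
      restrict-complete {τ} τℓ h D∈ with restrict⁻ D∈
      ... | D∈K , ℓ∉ with h (∈key⇒Mem D∈K)
      ... | ℓ′ , ℓ′∈ , there y∈ , τℓ′ = ℓ′ , ℓ′∈ , y∈ , τℓ′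
      ... | ℓ′ , ℓ′∈ , here x≡  , τℓ′
        with () ← trans (sym τℓ′) (trans (evalLiteral-complement τ ℓ ℓ′ (trans ℓ-x (sym x≡))
                                            (λ { refl → ℓ∉ ℓ′∈ })) (cong not τℓ))

-- Circuits

evalGate-suc : ∀ τ {n} (G : Gates n) g v → evalGate τ (G ▷ g) (suc v) ≡ evalGate τ G v
evalGate-suc τ G (lit ℓ)   v = refl
evalGate-suc τ G (const b) v = refl
evalGate-suc τ G (and vs)  v = refl
evalGate-suc τ G (or vs)   v = refl

gateVars-suc : ∀ {n} (G : Gates n) g v → gateVars (G ▷ g) (suc v) ≡ gateVars G v
gateVars-suc G (lit ℓ)   v = refl
gateVars-suc G (const b) v = refl
gateVars-suc G (and vs)  v = refl
gateVars-suc G (or vs)   v = refl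

Decomposable-suc : ∀ {n} (G : Gates n) g {vs} → Decomposable G vs → Decomposable (G ▷ g) (map suc vs)
Decomposable-suc G g = AllPairs.map⁺ ∘ AllPairs.map λ {u} {v} →
  subst₂ Disjoint (sym (gateVars-suc G g u)) (sym (gateVars-suc G g v))

IsDecision-suc : ∀ {n} {G : Gates n} {g vs} → IsDecision G vs → IsDecision (G ▷ g) (map suc vs)
IsDecision-suc (decision p q r s) =
  decision (cong weaken p) (cong weaken q) (cong weaken r) (cong weaken s)

-- Stated relative to the preceding gates, so that it can be checked when the gate is added;
-- `legal-decomposable` and `legal-decision` carry it over to the finished circuit, where references
-- are shifted.
LegalGate : ∀ {n} → Gates n → Gate n → Set
LegalGate G (lit ℓ)   = ⊤
LegalGate G (const b) = ⊤
LegalGate G (and vs)  = Decomposable G vs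
LegalGate G (or vs)   = IsDecision G vs

Legal : ∀ {n} → Gates n → Set
Legal []      = ⊤
Legal (G ▷ g) = Legal G × LegalGate G g

legal-decomposable : ∀ {n} (G : Gates n) → Legal G → ∀ v {vs} → gate G v ≡ and vs → Decomposable G vs
legal-decomposable (G ▷ and vs) (_ , d) zero refl = Decomposable-suc G (and vs) d
legal-decomposable (G ▷ g) (L , _) (suc v) eq with gate G v in eq′ | eq
... | and vs | refl = Decomposable-suc G g (legal-decomposable G L v eq′)

legal-decision : ∀ {n} (G : Gates n) → Legal G → ∀ v {vs} → gate G v ≡ or vs → IsDecision G vs
legal-decision (G ▷ or vs) (_ , d) zero refl = IsDecision-suc d
legal-decision (G ▷ g) (L , _) (suc v) eq with gate G v in eq′ | eq
... | or vs | refl = IsDecision-suc (legal-decision G L v eq′)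

-- The address a denotes the a-th gate counted from the oldest one; unlike references,
-- addresses do not change when gates are added.
ref : ∀ n → ℕ → Fin (suc n)
ref zero    a = zero
ref (suc n) a = if does (a ≤? n) then suc (ref n a) else zero

ref-suc : ∀ {n a} → a ≤ n → ref (suc n) a ≡ suc (ref n a)
ref-suc {n} {a} a≤n rewrite dec-true (a ≤? n) a≤n = refl

ref-newest : ∀ n → ref n n ≡ zero
ref-newest zero    = refl
ref-newest (suc n) rewrite dec-false (suc n ≤? n) (<-irrefl refl) = refl

toℕ-ref : ∀ n a → toℕ (ref n a) ≡ n ∸ a
toℕ-ref zero    a = sym (0∸n≡0 a)
toℕ-ref (suc n) a with a ≤? n
... | yes a≤n = trans (cong toℕ (ref-suc a≤n))
                  (trans (cong suc (toℕ-ref n a)) (sym (+-∸-assoc 1 a≤n)))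
... | no  a≰n rewrite dec-false (a ≤? n) a≰n = sym (m≤n⇒m∸n≡0 (≰⇒> a≰n))

-- Having at least one gate gives every address a meaning; the number is the address of the newest
-- gate.
Net : Set
Net = Σ[ n ∈ ℕ ] Gates (suc n)

newest : Net → ℕ
newest = proj₁

value : Assignment → Net → ℕ → Bool
value τ (n , G) a = evalGate τ G (ref n a)

support : Net → ℕ → List Var
support (n , G) a = gateVars G (ref n a)

infix 4 _≼_

record _≼_ (M N : Net) : Set where
  field
    newest-≤  : newest M ≤ newest N
    value-≡   : ∀ τ {a} → a ≤ newest M → value τ N a ≡ value τ M a
    support-≡ : ∀ {a} → a ≤ newest M → support N a ≡ support M a

open _≼_ public

≼-refl : ∀ {N} → N ≼ N
≼-refl = record { newest-≤ = ≤-refl ; value-≡ = λ _ _ → refl ; support-≡ = λ _ → refl }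

≼-trans : ∀ {M N O} → M ≼ N → N ≼ O → M ≼ O
≼-trans p q = record
  { newest-≤  = ≤-trans (newest-≤ p) (newest-≤ q)
  ; value-≡   = λ τ a≤ → trans (value-≡ q τ (≤-trans a≤ (newest-≤ p))) (value-≡ p τ a≤)
  ; support-≡ = λ a≤ → trans (support-≡ q (≤-trans a≤ (newest-≤ p))) (support-≡ p a≤)
  }

≼-push : ∀ {n} (G : Gates (suc n)) g → (n , G) ≼ (suc n , G ▷ g)
≼-push G g = record
  { newest-≤  = n≤1+n _
  ; value-≡   = λ τ a≤ → trans (cong (evalGate τ (G ▷ g)) (ref-suc a≤)) (evalGate-suc τ G g _)
  ; support-≡ = λ a≤ → trans (cong (gateVars (G ▷ g)) (ref-suc a≤)) (gateVars-suc G g _)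
  }

pushAnd : List ℕ → Net → Net
pushAnd ps (n , G) = suc n , G ▷ and (map (ref n) ps)

literalGates : Var → Net → Net
literalGates x (n , G) = 2 + n , G ▷ lit (pos x) ▷ lit (neg x)

-- Computes (x ∧ ⋀ ps) ∨ (¬ x ∧ ⋀ qs).
emit : Var → List ℕ → List ℕ → Net → Net
emit x ps qs N = let (n , G) = pushAnd qs (pushAnd ps (literalGates x N)) in
  3 + n , G
    ▷ and (suc (suc (suc zero)) ∷ suc zero ∷ [])
    ▷ and (suc (suc (suc zero)) ∷ suc zero ∷ [])
    ▷ or (suc zero ∷ zero ∷ [])

all-cong : {A : Set} {f g : A → Bool} → ∀ xs → (∀ {x} → x ∈ xs → f x ≡ g x) → all f xs ≡ all g xs
all-cong []       h = refl
all-cong (x ∷ xs) h = cong₂ _∧_ (h (here refl)) (all-cong xs (h ∘ there))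

all-true⁺ : {A : Set} {f : A → Bool} → ∀ xs → (∀ {x} → x ∈ xs → f x ≡ true) → all f xs ≡ true
all-true⁺ []       h = refl
all-true⁺ (x ∷ xs) h = cong₂ _∧_ (h (here refl)) (all-true⁺ xs (h ∘ there))

all-true⁻ : {A : Set} {f : A → Bool} → ∀ {xs} → all f xs ≡ true → ∀ {x} → x ∈ xs → f x ≡ true
all-true⁻ {f = f} {y ∷ ys} eq x∈ with f y in fy
all-true⁻ {f = f} {y ∷ ys} eq (here refl) | true = fy
all-true⁻ {f = f} {y ∷ ys} eq (there x∈)  | true = all-true⁻ eq x∈

all-map : {A B : Set} (f : B → Bool) (g : A → B) → ∀ xs → all f (map g xs) ≡ all (f ∘ g) xs
all-map f g []       = refl
all-map f g (x ∷ xs) = cong (f (g x) ∧_) (all-map f g xs)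

pushAnd-support : ∀ ps N {z} → z ∈ support (pushAnd ps N) (newest (pushAnd ps N)) →
                  ∃[ p ] p ∈ ps × z ∈ support N p
pushAnd-support ps (n , G) z∈ rewrite ref-newest (suc n)
  with v , v∈ , z∈v ← find (∈-concatMap⁻ (gateVars G) {xs = map (ref n) ps} z∈)
  with p , p∈ , refl ← ∈-map⁻ (ref n) v∈ = p , p∈ , z∈v

module Emit (x : Var) (ps qs : List ℕ) (n : ℕ) (G : Gates (suc n))
  (ps≤ : ∀ {p} → p ∈ ps → p ≤ n) (qs≤ : ∀ {q} → q ∈ qs → q ≤ n) where

  private
    N N₁ N₂ N₃ : Net
    N  = n , G
    N₁ = literalGates x N
    N₂ = pushAnd ps N₁
    N₃ = pushAnd qs N₂
    N≼N₁ : N ≼ N₁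
    N≼N₁ = ≼-trans (≼-push _ _) (≼-push _ _)
    N≼N₂ : N ≼ N₂
    N≼N₂ = ≼-trans N≼N₁ (≼-push _ _)
    N≼N₃ : N ≼ N₃
    N≼N₃ = ≼-trans N≼N₂ (≼-push _ _)

  emit-≼ : N ≼ emit x ps qs N
  emit-≼ = ≼-trans N≼N₃ (≼-trans (≼-push _ _) (≼-trans (≼-push _ _) (≼-push _ _)))

  -- Address `7 + n` is the decision gate: two literals, two conjunctions of pointers and two
  -- guarded branches precede it. The guarded branches have the same references because adding the
  -- first shifts the second from the positive literal and `ps` to the negative one and `qs`.
  emit-value : ∀ τ → value τ (emit x ps qs N) (7 + n) ≡
               (if τ x then all (value τ N) ps else all (value τ N) qs)
  emit-value τ = trans (cong (evalGate τ (proj₂ (emit x ps qs N))) (ref-newest (7 + n))) (trans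
    (cong₂ (λ a b → (τ x ∧ (a ∧ true)) ∨ ((not (τ x) ∧ (b ∧ true)) ∨ false))
      (trans (all-map _ _ ps) (all-cong ps λ p∈ → value-≡ N≼N₁ τ (ps≤ p∈)))
      (trans (all-map _ _ qs) (all-cong qs λ q∈ → value-≡ N≼N₂ τ (qs≤ q∈))))
    (lemma (τ x) _ _))
    where
    lemma : ∀ c a b → (c ∧ (a ∧ true)) ∨ ((not c ∧ (b ∧ true)) ∨ false) ≡ (if c then a else b)
    lemma true  a b = trans (∨-identityʳ _) (∧-identityʳ a)
    lemma false a b = trans (∨-identityʳ _) (∧-identityʳ b)

  vars₁ : ∀ {z} → z ∈ gateVars (proj₂ N₂) zero → ∃[ p ] p ∈ ps × z ∈ support N p
  vars₁ {z} z∈ =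
    let (p , p∈ , z∈p) = pushAnd-support ps N₁
          (subst (λ v → z ∈ gateVars (proj₂ N₂) v) (sym (ref-newest (3 + n))) z∈)
    in p , p∈ , subst (z ∈_) (support-≡ N≼N₁ (ps≤ p∈)) z∈p

  vars₂ : ∀ {z} → z ∈ gateVars (proj₂ N₃) zero → ∃[ q ] q ∈ qs × z ∈ support N q
  vars₂ {z} z∈ =
    let (q , q∈ , z∈q) = pushAnd-support qs N₂
          (subst (λ v → z ∈ gateVars (proj₂ N₃) v) (sym (ref-newest (4 + n))) z∈)
    in q , q∈ , subst (z ∈_) (support-≡ N≼N₂ (qs≤ q∈)) z∈q

  emit-support : ∀ {z} → z ∈ support (emit x ps qs N) (7 + n) →
                 z ≡ x ⊎ ∃[ p ] (p ∈ ps ⊎ p ∈ qs) × z ∈ support N p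
  emit-support {z} z∈
    with subst (λ v → z ∈ gateVars (proj₂ (emit x ps qs N)) v) (ref-newest (7 + n)) z∈
  ... | here z≡ = inj₁ z≡
  ... | there z∈₁ with ∈-++⁻ (gateVars (proj₂ N₂) zero ++ []) z∈₁
  ...   | inj₁ z∈₂ with ∈-++⁻ (gateVars (proj₂ N₂) zero) z∈₂
  ...     | inj₁ z∈₃ = let (p , p∈ , z∈p) = vars₁ z∈₃ in inj₂ (p , inj₁ p∈ , z∈p)
  emit-support {z} _ | there z∈₁ | inj₂ (here z≡) = inj₁ z≡
  emit-support {z} _ | there z∈₁ | inj₂ (there z∈₂)
    with ∈-++⁻ (gateVars (proj₂ N₃) zero ++ []) z∈₂
  ... | inj₁ z∈₃ with ∈-++⁻ (gateVars (proj₂ N₃) zero) z∈₃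
  ...   | inj₁ z∈₄ = let (q , q∈ , z∈q) = vars₂ z∈₄ in inj₂ (q , inj₂ q∈ , z∈q)

  module _ (x∉ps : ∀ {p} → p ∈ ps → x ∉ support N p) (x∉qs : ∀ {q} → q ∈ qs → x ∉ support N q)
           (ps-disjoint : AllPairs (λ p q → Disjoint (support N p) (support N q)) ps)
           (qs-disjoint : AllPairs (λ p q → Disjoint (support N p) (support N q)) qs) where

    private
      disjoint-pairs : ∀ {M} → N ≼ M → ∀ {rs} → (∀ {r} → r ∈ rs → r ≤ n) →
        AllPairs (λ p q → Disjoint (support N p) (support N q)) rs →
        AllPairs (λ p q → Disjoint (support M p) (support M q)) rs
      disjoint-pairs N≼M rs≤ []       = []
      disjoint-pairs N≼M rs≤ (d ∷ ds) =
        All.tabulate (λ q∈ → subst₂ Disjoint (sym (support-≡ N≼M (rs≤ (here refl))))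
                               (sym (support-≡ N≼M (rs≤ (there q∈)))) (All.lookup d q∈)) ∷
        disjoint-pairs N≼M (rs≤ ∘ there) ds

    emit-legal : Legal G → Legal (proj₂ (emit x ps qs N))
    emit-legal L =
      (((((((L , tt) , tt) ,
        AllPairs.map⁺ (disjoint-pairs N≼N₁ ps≤ ps-disjoint)) ,
        AllPairs.map⁺ (disjoint-pairs N≼N₂ qs≤ qs-disjoint)) ,
        ((λ { (here refl , z∈) → let (p , p∈ , z∈p) = vars₁ z∈ in x∉ps p∈ z∈p }) ∷ []) ∷ [] ∷ []) ,
        ((λ { (here refl , z∈) → let (q , q∈ , z∈q) = vars₂ z∈ in x∉qs q∈ z∈q }) ∷ []) ∷ [] ∷ []) ,
        decision refl refl refl refl)

-- Greedy elimination

-- An implication written as a disjunction, so that its decision procedure is a Boolean combination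
-- of simpler tests and can be programmed as such.
NestedAt : List Var → Var → List Var → List Var → Set
NestedAt ys x e f = x ∉ e ⊎ x ∉ f ⊎ Below (x ∷ ys) e f ⊎ Below (x ∷ ys) f e

nestedAt? : ∀ ys x e f → Dec (NestedAt ys x e f)
nestedAt? ys x e f = ¬? (x ∈? e) ⊎-dec ¬? (x ∈? f) ⊎-dec
                     below? (x ∷ ys) e f ⊎-dec below? (x ∷ ys) f e

Eligible : Hypergraph → List Var → Var → Set
Eligible H ys x = x ∉ ys × All (λ e → All (NestedAt ys x e) H) H

eligible? : ∀ H ys x → Dec (Eligible H ys x)
eligible? H ys x = ¬? (x ∈? ys) ×-dec all? (λ e → all? (nestedAt? ys x e) H) H

prepend : List Var → List Var → List Var
prepend []      ys = ys
prepend (x ∷ _) ys = x ∷ ys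

grow : Hypergraph → List Var → List Var
grow H ys = prepend (filter (eligible? H ys) (concat H)) ys

-- The list only serves as a counter for the rounds.
greedy : Hypergraph → List Var → List Var
greedy H = foldr (λ _ → grow H) []

eliminationOrder : Hypergraph → List Var
eliminationOrder H = greedy H (concat H)

module _ (H : Hypergraph) where

  prepend-elim : ∀ {ys} → Elim H ys → ys ⊆ concat H →
    ∀ es → (∀ {x} → x ∈ es → x ∈ concat H × Eligible H ys x) →
    Elim H (prepend es ys) × prepend es ys ⊆ concat H
  prepend-elim el ys⊆ []       _ = el , ys⊆
  prepend-elim {ys} el ys⊆ (x ∷ _) h = let (x∈ , x∉ys , nest) = h (here refl) in
    elim x∉ys (λ e∈ f∈ x∈e x∈f →
        [ (λ x∉e → ⊥-elim (x∉e x∈e)) , [ (λ x∉f → ⊥-elim (x∉f x∈f)) , id ] ]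
          (All.lookup (All.lookup nest e∈) f∈)) el ,
    λ { (here refl) → x∈ ; (there y∈) → ys⊆ y∈ }

  grow-elim : ∀ {ys} → Elim H ys → ys ⊆ concat H → Elim H (grow H ys) × grow H ys ⊆ concat H
  grow-elim {ys} el ys⊆ = prepend-elim el ys⊆ _ (∈-filter⁻ (eligible? H ys))

  greedy-elim : ∀ ks → Elim H (greedy H ks) × greedy H ks ⊆ concat H
  greedy-elim []       = [] , λ ()
  greedy-elim (k ∷ ks) = let (el , ⊆H) = greedy-elim ks in grow-elim el ⊆H

  remaining : List Var → List Var
  remaining ys = filter (λ v → ¬? (v ∈? ys)) (concat H)

  remaining-shrinks : ∀ {x ys} L → x ∈ L → x ∉ ys →
    length (filter (λ v → ¬? (v ∈? x ∷ ys)) L) < length (filter (λ v → ¬? (v ∈? ys)) L)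
  remaining-shrinks {x} {ys} L x∈ x∉ys = strict L x∈
    where
    P? = λ v → ¬? (v ∈? x ∷ ys)
    Q? = λ v → ¬? (v ∈? ys)
    -- `k` is 0 for the weak inequality and 1 for the strict one.
    extend : ∀ k v L → Dec (v ∈ x ∷ ys) → Dec (v ∈ ys) →
             k + length (filter P? L) ≤ length (filter Q? L) →
             k + length (filter P? (v ∷ L)) ≤ length (filter Q? (v ∷ L))
    extend k v L (yes v∈) (yes v∈′) l
      rewrite filter-reject P? {v} {L} (λ n → n v∈) | filter-reject Q? {v} {L} (λ n → n v∈′) = l
    extend k v L (yes v∈) (no v∉)   l
      rewrite filter-reject P? {v} {L} (λ n → n v∈) | filter-accept Q? {v} {L} v∉ = m≤n⇒m≤1+n l
    extend k v L (no v∉)  (yes v∈)  l = ⊥-elim (v∉ (there v∈))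
    extend k v L (no v∉)  (no v∉′)  l
      rewrite filter-accept P? {v} {L} v∉ | filter-accept Q? {v} {L} v∉′
            | +-suc k (length (filter P? L)) = s≤s l
    weak : ∀ L → length (filter P? L) ≤ length (filter Q? L)
    weak []      = z≤n
    weak (v ∷ L) = extend 0 v L (v ∈? x ∷ ys) (v ∈? ys) (weak L)
    strict : ∀ L → x ∈ L → length (filter P? L) < length (filter Q? L)
    strict (v ∷ L) (here refl)
      rewrite filter-reject P? {v} {L} (λ n → n (here refl)) | filter-accept Q? {v} {L} x∉ys =
      s≤s (weak L)
    strict (v ∷ L) (there x∈) = extend 1 v L (v ∈? x ∷ ys) (v ∈? ys) (strict L x∈)

  -- Nestedness beyond a prefix of `xs` implies nestedness beyond any larger set. The prefix that
  -- ends with the first vertex missing from `ys` is contained in `ys` together with that vertex.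
  first-missing : ∀ {ys v} xs → v ∈ xs → v ∉ ys →
    ∃[ i ] lookup xs i ∉ ys × (∀ {u} → u ∈ take (suc (toℕ i)) xs → u ∈ lookup xs i ∷ ys)
  first-missing {ys} (x ∷ xs) v∈ v∉ with x ∈? ys
  ... | no  x∉ = zero , x∉ , λ { (here refl) → here refl }
  first-missing {ys} (x ∷ xs) (here refl) v∉ | yes x∈ = ⊥-elim (v∉ x∈)
  first-missing {ys} (x ∷ xs) (there v∈)  v∉ | yes x∈ = let (i , i∉ , h) = first-missing xs v∈ v∉ in
    suc i , i∉ , λ { (here refl) → there x∈ ; (there u∈) → h u∈ }

  -- Among the vertices not yet eliminated, the first one in a β-elimination order is eligible.
  eligible-exists : βAcyclic H → ∀ {ys v} → v ∈ concat H → v ∉ ys → ∃[ x ] x ∈ concat H × Eligible H ys x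
  eligible-exists (xs , β) {ys} {v} v∈ v∉ =
    let (i , i∉ , h) = first-missing xs (Equivalence.from (enumerate v) v∈) v∉
        x = lookup xs i
    in x , Equivalence.to (enumerate x) (∈-lookup i) , i∉ ,
       All.tabulate λ {e} e∈ → All.tabulate λ {f} f∈ → at e f
         (λ x∈e x∈f → comparable e f h (nested i e∈ f∈ x∈e x∈f))
    where
    open IsβEliminationOrder β
    below : ∀ {ps zs} e f → (∀ {u} → u ∈ ps → u ∈ zs) → (e ∖ ps) ⊆ f → Below zs e f
    below {ps} {zs} e f h e⊆f = All.tabulate λ {u} u∈ → go u∈ (u ∈? ps)
      where
      go : ∀ {u} → u ∈ e → Dec (u ∈ ps) → u ∈ zs ⊎ u ∈ f
      go u∈ (yes u∈ps) = inj₁ (h u∈ps)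
      go u∈ (no u∉ps)  = inj₂ (e⊆f (∈-filter⁺ (λ u → ¬? (u ∈? ps)) u∈ u∉ps))
    comparable : ∀ {ps zs} e f → (∀ {u} → u ∈ ps → u ∈ zs) →
                 (e ∖ ps) ⊆ f ⊎ (f ∖ ps) ⊆ e → Below zs e f ⊎ Below zs f e
    comparable e f h (inj₁ e⊆f) = inj₁ (below e f h e⊆f)
    comparable e f h (inj₂ f⊆e) = inj₂ (below f e h f⊆e)
    at : ∀ {x} e f → (x ∈ e → x ∈ f → Below (x ∷ ys) e f ⊎ Below (x ∷ ys) f e) → NestedAt ys x e f
    at {x} e f h with x ∈? e | x ∈? f
    ... | no x∉e  | _       = inj₁ x∉e
    ... | yes x∈e | no x∉f  = inj₂ (inj₁ x∉f)
    ... | yes x∈e | yes x∈f = inj₂ (inj₂ (h x∈e x∈f))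

  module _ (β : βAcyclic H) where

    -- If nothing is eligible, then by `eligible-exists` nothing remains, and truncated subtraction
    -- makes the bound true at zero. Otherwise the added vertex leaves the list. So one round for
    -- each entry of `concat H` exhausts it.
    prepend-progress : ∀ {ys} es → (∀ {x} → x ∈ es → x ∈ concat H × Eligible H ys x) →
      (∀ {x} → x ∈ concat H → Eligible H ys x → x ∈ es) →
      length (remaining (prepend es ys)) ≤ length (remaining ys) ∸ 1
    prepend-progress {ys} [] _ h with remaining ys in eq
    ... | []    = z≤n
    ... | v ∷ _ with ∈-filter⁻ (λ v → ¬? (v ∈? ys)) {xs = concat H} (subst (v ∈_) (sym eq) (here refl))
    ...   | v∈ , v∉ with eligible-exists β v∈ v∉
    ...     | x , x∈ , e with () ← h x∈ e
    prepend-progress {ys} (x ∷ _) h _ = let (x∈ , x∉ys , _) = h (here refl) in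
      ∸-monoˡ-≤ 1 (remaining-shrinks (concat H) x∈ x∉ys)

    greedy-progress : ∀ ks → length (remaining (greedy H ks)) ≤ length (concat H) ∸ length ks
    greedy-progress []       = length-filter _ (concat H)
    greedy-progress (k ∷ ks) = ≤-trans
      (prepend-progress _ (∈-filter⁻ (eligible? H (greedy H ks))) (∈-filter⁺ (eligible? H (greedy H ks))))
      (≤-trans (∸-monoˡ-≤ 1 (greedy-progress ks))
        (≤-reflexive (trans (∸-+-assoc (length (concat H)) (length ks) 1)
          (cong (length (concat H) ∸_) (+-comm (length ks) 1)))))

    eliminationOrder-complete : ∀ {v} → v ∈ concat H → v ∈ eliminationOrder H
    eliminationOrder-complete {v} v∈ with v ∈? eliminationOrder H
    ... | yes v∈′ = v∈′
    ... | no  v∉  with remaining (eliminationOrder H)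
                     | ∈-filter⁺ (λ v → ¬? (v ∈? eliminationOrder H)) v∈ v∉
                     | ≤-trans (greedy-progress (concat H)) (≤-reflexive (n∸n≡0 (length (concat H))))
    ...   | _ ∷ _ | _ | ()

Elim-unique : ∀ {H ys} → Elim H ys → Unique ys
Elim-unique []               = []
Elim-unique (elim x∉ _ el) = All.tabulate (λ y∈ x≡y → x∉ (subst (_∈ _) (sym x≡y) y∈)) ∷ Elim-unique el

-- The circuit of a formula

-- A clause together with the address of a gate.
Entry : Set
Entry = Literals × ℕ

open Components {Entry} proj₁
open Selections {Entry} proj₁

pointers : List Var → List Entry → List ℕ
pointers ys S = map (proj₂ ∘ rep) (components ys S)

State : Set
State = Net × List Entry

emitKey : Var → List Var → List Entry → Net → Net
emitKey x ys K =
  emit x (pointers ys (restrict (pos x) K)) (pointers ys (restrict (neg x) K))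

enter : Literals → State → State
enter c (N , T) = N , (c , newest N) ∷ T

-- Branches are read off the table `T` of the previous stage, whose pointers are valid for `ys`;
-- `T′` collects the table for `x ∷ ys`.
visit : Var → List Var → List Entry → Entry → State → State
visit x ys T (c , p) (N , T′) =
  if does (x ∈? varsOf c)
  then enter c (emitKey x ys (key x ys T c) N , T′)
  else (N , (c , p) ∷ T′)

stage : Var → List Var → State → State
stage x ys (N , T) = foldr (visit x ys T) (N , []) T

-- Before any variable is processed, all literals count as false and no clause is satisfied; hence
-- the common constant gate at address 0.
build : List Literals → List Var → State
build F []       = (0 , [] ▷ const false) , map (_, 0) F
build F (x ∷ ys) = stage x ys (build F ys)

finish : List Var → State → Net
finish xs (N , T) = pushAnd (pointers xs T) N

AllVars : ∀ {n} → Gates n → List Var → Set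
AllVars G zs = ∀ v {z} → z ∈ gateVars G v → z ∈ zs

allVars-push : ∀ {n zs} {G : Gates n} g → AllVars G zs → (∀ {z} → z ∈ gateVars (G ▷ g) zero → z ∈ zs) → AllVars (G ▷ g) zs
allVars-push         g a h zero    z∈ = h z∈
allVars-push {G = G} g a h (suc v) z∈ = a v (subst (_ ∈_) (gateVars-suc G g v) z∈)

allVars-concatMap : ∀ {n zs} (G : Gates n) → AllVars G zs → ∀ vs {z} → z ∈ concatMap (gateVars G) vs → z ∈ zs
allVars-concatMap G a vs z∈ =
  let (v , _ , z∈v) = find (∈-concatMap⁻ (gateVars G) {xs = vs} z∈) in a v z∈v

allVars-and : ∀ {n zs} {G : Gates n} {vs} → AllVars G zs → AllVars (G ▷ and vs) zs
allVars-and {G = G} {vs = vs} a = allVars-push (and vs) a (allVars-concatMap G a vs)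

allVars-or : ∀ {n zs} {G : Gates n} {vs} → AllVars G zs → AllVars (G ▷ or vs) zs
allVars-or {G = G} {vs = vs} a = allVars-push (or vs) a (allVars-concatMap G a vs)

allVars-lit : ∀ {n zs} {G : Gates n} {ℓ} → litVar ℓ ∈ zs → AllVars G zs → AllVars (G ▷ lit ℓ) zs
allVars-lit {ℓ = ℓ} x∈ a = allVars-push (lit ℓ) a λ { (here refl) → x∈ }

emit-allVars : ∀ {zs x ps qs N} → x ∈ zs → AllVars (proj₂ N) zs → AllVars (proj₂ (emit x ps qs N)) zs
emit-allVars x∈ a =
  allVars-or (allVars-and (allVars-and (allVars-and (allVars-and
    (allVars-lit {ℓ = neg _} x∈ (allVars-lit {ℓ = pos _} x∈ a))))))

emit-maxInputCount : ∀ {x ps qs N w} → maxInputCount (proj₂ N) ≤ w → length ps ≤ w → length qs ≤ w →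
                     2 ≤ w → maxInputCount (proj₂ (emit x ps qs N)) ≤ w
emit-maxInputCount {ps = ps} {qs} m≤ ps≤ qs≤ 2≤ =
  ⊔-lub (⊔-lub (⊔-lub (⊔-lub (⊔-lub (⊔-lub (⊔-lub m≤ z≤n) z≤n)
    (≤-trans (≤-reflexive (length-map _ ps)) ps≤))
    (≤-trans (≤-reflexive (length-map _ qs)) qs≤)) 2≤) 2≤) 2≤

-- Counting incidences

occ : Var → List Literals → ℕ
occ x F = length (filter (λ c → x ∈? varsOf c) F)

occs : List Var → List Literals → ℕ
occs []       F = 0
occs (x ∷ ys) F = occ x F + occs ys F

occs-[] : ∀ xs → occs xs [] ≡ 0
occs-[] []       = refl
occs-[] (x ∷ xs) = occs-[] xs

occs-∷ : ∀ xs c F → occs xs (c ∷ F) ≡ length (filter (_∈? varsOf c) xs) + occs xs F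
occs-∷ []       c F = refl
occs-∷ (x ∷ xs) c F = go (x ∈? varsOf c)
  where
  open ≡-Reasoning
  m = length (filter (_∈? varsOf c) xs)
  go : Dec (x ∈ varsOf c) →
       occs (x ∷ xs) (c ∷ F) ≡ length (filter (_∈? varsOf c) (x ∷ xs)) + occs (x ∷ xs) F
  go (yes x∈) = begin
    occ x (c ∷ F) + occs xs (c ∷ F)
      ≡⟨ cong₂ (λ l k → length l + k) (filter-accept (λ c → x ∈? varsOf c) x∈) (occs-∷ xs c F) ⟩
    suc (occ x F) + (m + occs xs F)
      ≡⟨ cong suc (x∙yz≈y∙xz (occ x F) m (occs xs F)) ⟩
    suc m + (occ x F + occs xs F)
      ≡⟨ cong (λ l → length l + (occ x F + occs xs F)) (filter-accept (_∈? varsOf c) x∈) ⟨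
    length (filter (_∈? varsOf c) (x ∷ xs)) + occs (x ∷ xs) F ∎
  go (no x∉) = begin
    occ x (c ∷ F) + occs xs (c ∷ F)
      ≡⟨ cong₂ (λ l k → length l + k) (filter-reject (λ c → x ∈? varsOf c) x∉) (occs-∷ xs c F) ⟩
    occ x F + (m + occs xs F)
      ≡⟨ x∙yz≈y∙xz (occ x F) m (occs xs F) ⟩
    m + (occ x F + occs xs F)
      ≡⟨ cong (λ l → length l + (occ x F + occs xs F)) (filter-reject (_∈? varsOf c) x∉) ⟨
    length (filter (_∈? varsOf c) (x ∷ xs)) + occs (x ∷ xs) F ∎

-- Double counting of the incidences between clauses and variables.
occs-≤ : ∀ {xs} → Unique xs → ∀ F → occs xs F ≤ sum (map (length ∘ varsOf) F)
occs-≤ {xs} u []      = ≤-reflexive (occs-[] xs)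
occs-≤ {xs} u (c ∷ F) = ≤-trans (≤-reflexive (occs-∷ xs c F))
  (+-mono-≤ (length-≤ {R = _≡_} sym trans (Unique.filter⁺ (_∈? varsOf c) u)
               (proj₂ ∘ ∈-filter⁻ (_∈? varsOf c) {xs = xs}))
            (occs-≤ u F))

-- Correctness of the stages

module Assembly (F : List Literals) (F-distinct : AllPairs (λ c d → ¬ c ≐ d) F)
  (F-nonTaut : ∀ {c} → c ∈ F → ∀ x → pos x ∈ c → neg x ∉ c)
  (w : ℕ) (w-edges : ∣ map varsOf F ∣ ≤ w) (w-2 : ∀ {c} → c ∈ F → 2 ≤ w) where

  open Keys F
  open Cofactors F {Entry} proj₁

  -- `sound` and `complete` say that the gate computes the set of `c` relative to `ys`. `reads`
  -- confines its variables to those of that set, so that blocks that are apart give disjoint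
  -- supports.
  record Valid (ys : List Var) (N : Net) (c : Literals) (p : ℕ) : Set where
    field
      below    : p ≤ newest N
      sound    : ∀ {τ} → value τ N p ≡ true → ∀ {d} → Mem ys c d → Sat ys τ d
      complete : ∀ {τ} → (∀ {d} → Mem ys c d → Sat ys τ d) → value τ N p ≡ true
      reads    : ∀ {z} → z ∈ support N p → z ∈ ys × ∃[ d ] Mem ys c d × z ∈ varsOf d

  open Valid

  valid-≼ : ∀ {ys M N c p} → M ≼ N → Valid ys M c p → Valid ys N c p
  valid-≼ M≼N V = record
    { below    = ≤-trans (below V) (newest-≤ M≼N)
    ; sound    = λ v → sound V (trans (sym (value-≡ M≼N _ (below V))) v)
    ; complete = λ h → trans (value-≡ M≼N _ (below V)) (complete V h)
    ; reads    = λ z∈ → reads V (subst (_ ∈_) (support-≡ M≼N (below V)) z∈)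
    }

  -- By `Mem-Sub` the clauses of the set are included in `c` beyond `ys`, so none of them contains
  -- `x`. Keeping the pointer without a new gate confines the cost to actual incidences.
  valid-skip : ∀ {x ys N c p} → x ∉ ys → x ∉ varsOf c → Valid ys N c p → Valid (x ∷ ys) N c p
  valid-skip {x} {ys} {N} {c} x∉ys x∉c V = record
    { below    = below V
    ; sound    = λ v m → let (ℓ , ℓ∈ , y∈ , τℓ) = sound V v (proj₂ (Mem-∉ x∉c) m) in
                         ℓ , ℓ∈ , there y∈ , τℓ
    ; complete = λ h → complete V λ m → strip m (h (proj₁ (Mem-∉ x∉c) m))
    ; reads    = λ z∈ → let (z∈ys , d , m , z∈d) = reads V z∈ in
                        there z∈ys , d , proj₁ (Mem-∉ x∉c) m , z∈d
    }
    where
    strip : ∀ {τ d} → Mem ys c d → Sat (x ∷ ys) τ d → Sat ys τ d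
    strip m (ℓ , ℓ∈ , there y∈ , τℓ)  = ℓ , ℓ∈ , y∈ , τℓ
    strip m (ℓ , ℓ∈ , here refl , τℓ) =
      ⊥-elim ([ x∉ys , (λ ℓ∈c → x∉c (∈-map⁺ litVar ℓ∈c)) ] (All.lookup (Mem-Sub ys m) ℓ∈))

  -- The blocks cover `S`, and by `Mem⇔` the pointer of each representative computes its whole
  -- block; so the conjunction of the pointers computes `S`.
  module Conjunction {ys S N} (sep : Separable ys S) (el : Elim (map varsOf F) ys)
    (V : ∀ {c p} → (c , p) ∈ S → Valid ys N c p) where

    open Separation sep el

    private
      pointer : ∀ {p} → p ∈ pointers ys S → ∃[ b ] b ∈ components ys S × p ≡ proj₂ (rep b)
      pointer = ∈-map⁻ (proj₂ ∘ rep)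

      V′ : ∀ {b} → b ∈ components ys S → Valid ys N (proj₁ (rep b)) (proj₂ (rep b))
      V′ b∈ = V (member b∈ (here refl))

    ∧-below : ∀ {p} → p ∈ pointers ys S → p ≤ newest N
    ∧-below p∈ with pointer p∈
    ... | b , b∈ , refl = below (V′ b∈)

    ∧-sound : ∀ {τ} → all (value τ N) (pointers ys S) ≡ true → ∀ {D} → D ∈ S → Sat ys τ (proj₁ D)
    ∧-sound eq D∈ = let (b , b∈ , D∈b) = covered D∈ in
      sound (V′ b∈) (all-true⁻ eq (∈-map⁺ (proj₂ ∘ rep) b∈)) (proj₂ (Mem⇔ b∈) D∈b)

    ∧-complete : ∀ {τ} → (∀ {D} → D ∈ S → Sat ys τ (proj₁ D)) → all (value τ N) (pointers ys S) ≡ true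
    ∧-complete {τ} h = all-true⁺ (pointers ys S) go
      where
      sat : ∀ {b d} → b ∈ components ys S → Mem ys (proj₁ (rep b)) d → Sat ys τ d
      sat b∈ m with ∈-map⁻ proj₁ (proj₁ (Mem⇔ b∈) m)
      ... | D , D∈ , refl = h (member b∈ D∈)
      go : ∀ {p} → p ∈ pointers ys S → value τ N p ≡ true
      go p∈ with pointer p∈
      ... | b , b∈ , refl = complete (V′ b∈) (sat b∈)

    private
      reads′ : ∀ {b z} → b ∈ components ys S → z ∈ support N (proj₂ (rep b)) →
               z ∈ ys × ∃[ D ] D ∈ members b × z ∈ varsOf (proj₁ D)
      reads′ b∈ z∈ with reads (V′ b∈) z∈
      ... | z∈ys , d , m , z∈d with ∈-map⁻ proj₁ (proj₁ (Mem⇔ b∈) m)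
      ... | D , D∈ , refl = z∈ys , D , D∈ , z∈d

    ∧-reads : ∀ {p z} → p ∈ pointers ys S → z ∈ support N p →
              z ∈ ys × ∃[ D ] D ∈ S × z ∈ varsOf (proj₁ D)
    ∧-reads p∈ z∈ with pointer p∈
    ... | b , b∈ , refl with reads′ b∈ z∈
    ... | z∈ys , D , D∈ , z∈D = z∈ys , D , member b∈ D∈ , z∈D

    ∧-disjoint : AllPairs (λ p q → Disjoint (support N p) (support N q)) (pointers ys S)
    ∧-disjoint = AllPairs.map⁺ (pairs id apart)
      where
      pairs : ∀ {bs} → (∀ {b} → b ∈ bs → b ∈ components ys S) →
              AllPairs (Apart _ (λ {D} {E} → Distinct-sym proj₁ {D} {E}) ys) bs →
              AllPairs (λ b c → Disjoint (support N (proj₂ (rep b))) (support N (proj₂ (rep c)))) bs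
      pairs bs⊆ []       = []
      pairs bs⊆ (a ∷ as) = All.tabulate (λ c∈ (z∈b , z∈c) →
          let (z∈ys , D , D∈ , z∈D) = reads′ (bs⊆ (here refl)) z∈b
              (_    , E , E∈ , z∈E) = reads′ (bs⊆ (there c∈)) z∈c
          in proj₂ (All.lookup a c∈ D E D∈ E∈) z∈ys z∈D z∈E)
        ∷ pairs (bs⊆ ∘ there) as

    ∧-length : length (pointers ys S) ≤ w
    ∧-length = ≤-trans (≤-reflexive (length-map _ (components ys S)))
                 (≤-trans length-components w-edges)

  record Stage (ys : List Var) (L : List Literals) (m : ℕ) (S : State) : Set where
    N = proj₁ S
    T = proj₂ S
    field
      table  : map proj₁ T ≡ L
      legal  : Legal (proj₂ N)
      vars⊆  : AllVars (proj₂ N) ys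
      inputs : maxInputCount (proj₂ N) ≤ w
      count  : newest N ≡ 7 * m
      valid  : ∀ {c p} → (c , p) ∈ T → Valid ys N c p

  module Visit {x ys} (el : Elim (map varsOf F) (x ∷ ys)) {N₀ T m} (St : Stage ys F m (N₀ , T)) where

    open Stage St using (table; legal; vars⊆; inputs; count; valid)

    T⊆F : ∀ {D} → D ∈ T → proj₁ D ∈ F
    T⊆F D∈ = subst (_ ∈_) table (∈-map⁺ proj₁ D∈)

    F⊆T : ∀ {d} → d ∈ F → d ∈ map proj₁ T
    F⊆T {d} = subst (d ∈_) (sym table)

    T-distinct : AllPairs (Distinct {Entry} proj₁) T
    T-distinct = AllPairs.map⁻ (subst (AllPairs _) (sym table) F-distinct)

    module Occurs {c p} (R∈T : (c , p) ∈ T) (x∈c : x ∈ varsOf c) {N} (N₀≼N : N₀ ≼ N) where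

      open Cofactor {T} {x} {ys} {c , p} T⊆F F⊆T T-distinct R∈T x∈c
             (F-nonTaut (T⊆F R∈T)) el

      K = key x ys T c

      module Branch (ℓ : Literal) (ℓ-x : litVar ℓ ≡ x) where
        sep = restrict-separable ℓ ℓ-x
        open Conjunction {N = N} sep (Elim-tail el)
          (λ D∈ → valid-≼ N₀≼N (valid (key⊆T (proj₁ (restrict⁻ ℓ ℓ-x D∈))))) public

        ps = pointers ys (restrict ℓ K)

        reads-key : ∀ {p z} → p ∈ ps → z ∈ support N p →
                    z ∈ ys × ∃[ d ] Mem (x ∷ ys) c d × z ∈ varsOf d
        reads-key p∈ z∈ = let (z∈ys , D , D∈ , z∈D) = ∧-reads p∈ z∈ in
          z∈ys , proj₁ D , ∈key⇒Mem (proj₁ (restrict⁻ ℓ ℓ-x D∈)) , z∈D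

      module P = Branch (pos x) refl
      module Q = Branch (neg x) refl
      module E = Emit x P.ps Q.ps (proj₁ N) (proj₂ N) P.∧-below Q.∧-below

      N′ = emitKey x ys K N

      new-valid : Valid (x ∷ ys) N′ c (newest N′)
      new-valid = record
        { below    = ≤-refl
        ; sound    = λ {τ} v → split-sound τ (trans (sym (E.emit-value τ)) v)
        ; complete = λ {τ} h → trans (E.emit-value τ) (split-complete τ h)
        ; reads    = λ z∈ → new-reads (E.emit-support z∈)
        }
        where
        split-sound : ∀ τ → (if τ x then all (value τ N) P.ps else all (value τ N) Q.ps) ≡ true →
                      ∀ {d} → Mem (x ∷ ys) c d → Sat (x ∷ ys) τ d
        split-sound τ v with τ x in τx
        ... | true  = restrict-sound (pos x) refl τx (P.∧-sound v)
        ... | false = restrict-sound (neg x) refl (cong not τx) (Q.∧-sound v)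
        split-complete : ∀ τ → (∀ {d} → Mem (x ∷ ys) c d → Sat (x ∷ ys) τ d) →
                         (if τ x then all (value τ N) P.ps else all (value τ N) Q.ps) ≡ true
        split-complete τ h with τ x in τx
        ... | true  = P.∧-complete (restrict-complete (pos x) refl τx h)
        ... | false = Q.∧-complete (restrict-complete (neg x) refl (cong not τx) h)
        new-reads : ∀ {z} → z ≡ x ⊎ ∃[ p ] (p ∈ P.ps ⊎ p ∈ Q.ps) × z ∈ support N p →
                    z ∈ x ∷ ys × ∃[ d ] Mem (x ∷ ys) c d × z ∈ varsOf d
        new-reads (inj₁ refl) = here refl , c , proj₁ (Mem-∈ x∈c) origin , x∈c
        new-reads (inj₂ (p , inj₁ p∈ , z∈)) = let (z∈ys , m) = P.reads-key p∈ z∈ in there z∈ys , m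
        new-reads (inj₂ (p , inj₂ p∈ , z∈)) = let (z∈ys , m) = Q.reads-key p∈ z∈ in there z∈ys , m

      new-legal : Legal (proj₂ N) → Legal (proj₂ N′)
      new-legal = E.emit-legal
        (λ p∈ x∈ → Elim-fresh el (proj₁ (P.∧-reads p∈ x∈)))
        (λ q∈ x∈ → Elim-fresh el (proj₁ (Q.∧-reads q∈ x∈)))
        P.∧-disjoint Q.∧-disjoint

    visit-all : ∀ L → (∀ {R} → R ∈ L → R ∈ T) →
      let S = foldr (visit x ys T) (N₀ , []) L in
      N₀ ≼ proj₁ S × Stage (x ∷ ys) (map proj₁ L) (occ x (map proj₁ L) + m) S
    visit-all []            _  = ≼-refl , record
      { table  = refl
      ; legal  = legal
      ; vars⊆  = λ v z∈ → there (vars⊆ v z∈)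
      ; inputs = inputs
      ; count  = count
      ; valid  = λ ()
      }
    visit-all ((c , p) ∷ L) L⊆ with visit-all L (L⊆ ∘ there) | x ∈? varsOf c
    ... | N₀≼N , I | no x∉c = N₀≼N , record
      { table  = cong (c ∷_) I.table
      ; legal  = I.legal
      ; vars⊆  = I.vars⊆
      ; inputs = I.inputs
      ; count  = I.count
      ; valid  = λ where
          (here refl) → valid-skip (Elim-fresh el) x∉c (valid-≼ N₀≼N (valid (L⊆ (here refl))))
          (there R∈)  → I.valid R∈
      }
      where module I = Stage I
    ... | N₀≼N , I | yes x∈c = ≼-trans N₀≼N E.emit-≼ , record
      { table  = cong (c ∷_) I.table
      ; legal  = new-legal I.legal
      ; vars⊆  = emit-allVars (here refl) I.vars⊆
      -- The clause being visited shows that the formula is nonempty, which is what allows binary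
      -- gates within `w`.
      ; inputs = emit-maxInputCount {x} {P.ps} {Q.ps} {N = I.N} I.inputs P.∧-length Q.∧-length
                   (w-2 (T⊆F (L⊆ (here refl))))
      ; count  = trans (cong (7 +_) I.count) (sym (*-suc 7 (occ x (map proj₁ L) + m)))
      ; valid  = λ where
          (here refl) → new-valid
          (there R∈)  → valid-≼ E.emit-≼ (I.valid R∈)
      }
      where
      module I = Stage I
      open Occurs (L⊆ (here refl)) x∈c N₀≼N

  build-stage : ∀ {ys} → Elim (map varsOf F) ys → Stage ys F (occs ys F) (build F ys)
  build-stage [] = record
    { table  = trans (sym (map-∘ F)) (map-id F)
    ; legal  = tt , tt
    ; vars⊆  = λ { zero () ; (suc ()) }
    ; inputs = z≤n
    ; count  = refl
    ; valid  = λ R∈ → initial (∈-map⁻ (_, 0) R∈)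
    }
    where
    initial : ∀ {c p} → ∃[ d ] d ∈ F × (c , p) ≡ (d , 0) → Valid [] (0 , [] ▷ const false) c p
    initial (c , _ , refl) = record
      { below    = z≤n
      ; sound    = λ ()
      ; complete = λ h → let (_ , _ , x∈ , _) = h refl in ⊥-elim (∉[] x∈)
      ; reads    = λ ()
      }
  build-stage {x ∷ ys} el = subst (λ L → Stage (x ∷ ys) L (occ x L + occs ys F) (build F (x ∷ ys)))
    (Stage.table St) (proj₂ (Visit.visit-all el St (proj₂ (build F ys)) id))
    where St = build-stage (Elim-tail el)

  module Final {xs} (el : Elim (map varsOf F) xs) (all∈xs : ∀ {c x} → c ∈ F → x ∈ varsOf c → x ∈ xs) where

    St = build-stage el
    module St = Stage St

    T⊆F : ∀ {D} → D ∈ St.T → proj₁ D ∈ F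
    T⊆F D∈ = subst (_ ∈_) St.table (∈-map⁺ proj₁ D∈)

    sep : Separable xs St.T
    sep = record
      { ⊆F        = T⊆F
      ; pairwise  = AllPairs.map⁻ (subst (AllPairs _) (sym St.table) F-distinct)
      -- No variable lies beyond `xs`, so any assignment serves.
      ; σ         = λ _ → true
      ; falsified = λ D∈ → All.tabulate λ ℓ∈ → inj₁ (all∈xs (T⊆F D∈) (∈-map⁺ litVar ℓ∈))
      -- The table lists all clauses of `F`, so it cannot miss one.
      ; closed    = λ _ _ d∈ _ _ → subst (_ ∈_) (sym St.table) d∈
      }

    open Conjunction {N = St.N} sep el St.valid

    N : Net
    N = finish xs (build F xs)

    final-legal : Legal (proj₂ N)
    final-legal = St.legal , AllPairs.map⁺ ∧-disjoint

    final-inputs : maxInputCount (proj₂ N) ≤ w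
    final-inputs = ⊔-lub St.inputs (≤-trans (≤-reflexive (length-map _ (pointers xs St.T))) ∧-length)

    final-size : newest N ≡ suc (7 * occs xs F)
    final-size = cong suc St.count

    final-vars : AllVars (proj₂ N) xs
    final-vars = allVars-and St.vars⊆

    final-sound : ∀ {τ} → evalGate τ (proj₂ N) zero ≡ true → ∀ {c} → c ∈ F → Sat xs τ c
    final-sound {τ} v c∈ with ∈-map⁻ proj₁ (subst (_ ∈_) (sym St.table) c∈)
    ... | D , D∈ , refl = ∧-sound (trans (sym (all-map _ _ (pointers xs St.T))) v) D∈

    final-complete : ∀ {τ} → (∀ {c} → c ∈ F → Sat xs τ c) → evalGate τ (proj₂ N) zero ≡ true
    final-complete h = trans (all-map _ _ (pointers xs St.T)) (∧-complete λ D∈ → h (T⊆F D∈))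

-- Computability in polynomial time

infixl 6 _⊕_
infixl 7 _⊗_

-- Syntax instead of functions, so that monotonicity, substitution and an explicit monomial bound
-- follow by recursion.
data Poly : Set where
  con     : ℕ → Poly
  arg       : Poly
  _⊕_ _⊗_ : Poly → Poly → Poly

⟪_⟫ : Poly → ℕ → ℕ
⟪ con c ⟫ n = c
⟪ arg ⟫     n = n
⟪ p ⊕ q ⟫ n = ⟪ p ⟫ n + ⟪ q ⟫ n
⟪ p ⊗ q ⟫ n = ⟪ p ⟫ n * ⟪ q ⟫ n

⟪⟫-mono : ∀ p {m n} → m ≤ n → ⟪ p ⟫ m ≤ ⟪ p ⟫ n
⟪⟫-mono (con c) m≤n = ≤-refl
⟪⟫-mono arg       m≤n = m≤n
⟪⟫-mono (p ⊕ q) m≤n = +-mono-≤ (⟪⟫-mono p m≤n) (⟪⟫-mono q m≤n)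
⟪⟫-mono (p ⊗ q) m≤n = *-mono-≤ (⟪⟫-mono p m≤n) (⟪⟫-mono q m≤n)

infixr 9 _⟨_⟩

_⟨_⟩ : Poly → Poly → Poly
con c   ⟨ r ⟩ = con c
arg       ⟨ r ⟩ = r
(p ⊕ q) ⟨ r ⟩ = p ⟨ r ⟩ ⊕ q ⟨ r ⟩
(p ⊗ q) ⟨ r ⟩ = p ⟨ r ⟩ ⊗ q ⟨ r ⟩

⟪⟫-⟨⟩ : ∀ p r n → ⟪ p ⟨ r ⟩ ⟫ n ≡ ⟪ p ⟫ (⟪ r ⟫ n)
⟪⟫-⟨⟩ (con c) r n = refl
⟪⟫-⟨⟩ arg       r n = refl
⟪⟫-⟨⟩ (p ⊕ q) r n = cong₂ _+_ (⟪⟫-⟨⟩ p r n) (⟪⟫-⟨⟩ q r n)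
⟪⟫-⟨⟩ (p ⊗ q) r n = cong₂ _*_ (⟪⟫-⟨⟩ p r n) (⟪⟫-⟨⟩ q r n)

≤-⟨⟩ : ∀ p r {m n} → m ≤ ⟪ r ⟫ n → ⟪ p ⟫ m ≤ ⟪ p ⟨ r ⟩ ⟫ n
≤-⟨⟩ p r {m} {n} m≤ = ≤-trans (⟪⟫-mono p m≤) (≤-reflexive (sym (⟪⟫-⟨⟩ p r n)))

-- The sum of exponents is a cruder choice than the maximum, but it dominates both; the base `suc n`
-- is positive, so larger exponents give larger powers.
coefficient exponent : Poly → ℕ
coefficient (con c) = c
coefficient arg       = 1
coefficient (p ⊕ q) = coefficient p + coefficient q
coefficient (p ⊗ q) = coefficient p * coefficient q
exponent (con c) = 0
exponent arg       = 1
exponent (p ⊕ q) = exponent p + exponent q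
exponent (p ⊗ q) = exponent p + exponent q

monomial-bound : ∀ p n → ⟪ p ⟫ n ≤ coefficient p * suc n ^ exponent p
monomial-bound (con c) n = ≤-reflexive (sym (*-identityʳ c))
monomial-bound arg       n =
  ≤-trans (n≤1+n n) (≤-reflexive (sym (trans (*-identityˡ _) (*-identityʳ (suc n)))))
monomial-bound (p ⊕ q) n = begin
  ⟪ p ⟫ n + ⟪ q ⟫ n
    ≤⟨ +-mono-≤ (monomial-bound p n) (monomial-bound q n) ⟩
  a * suc n ^ k + b * suc n ^ l
    ≤⟨ +-mono-≤ (*-monoʳ-≤ a (^-monoʳ-≤ (suc n) (m≤m+n k l)))
                (*-monoʳ-≤ b (^-monoʳ-≤ (suc n) (m≤n+m l k))) ⟩
  a * suc n ^ (k + l) + b * suc n ^ (k + l)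
    ≡⟨ *-distribʳ-+ (suc n ^ (k + l)) a b ⟨
  (a + b) * suc n ^ (k + l) ∎
  where
  open ≤-Reasoning
  a = coefficient p
  b = coefficient q
  k = exponent p
  l = exponent q
monomial-bound (p ⊗ q) n = begin
  ⟪ p ⟫ n * ⟪ q ⟫ n
    ≤⟨ *-mono-≤ (monomial-bound p n) (monomial-bound q n) ⟩
  (a * suc n ^ k) * (b * suc n ^ l)
    ≡⟨ [m*n]*[o*p]≡[m*o]*[n*p] a (suc n ^ k) b (suc n ^ l) ⟩
  (a * b) * (suc n ^ k * suc n ^ l)
    ≡⟨ cong ((a * b) *_) (^-distribˡ-+-* (suc n) k l) ⟨
  (a * b) * suc n ^ (k + l) ∎
  where
  open ≤-Reasoning
  a = coefficient p
  b = coefficient q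
  k = exponent p
  l = exponent q

treeSize : Tree → ℕ
treeSize nil      = 1
treeSize (atom a) = 1
treeSize (u ∙ v)  = suc (treeSize u + treeSize v)

record Encoding : Set₁ where
  constructor encoding
  field
    {Carrier} : Set
    encode    : Carrier → Tree

open Encoding public

size′ : (A : Encoding) → Carrier A → ℕ
size′ A a = treeSize (encode A a)

infixr 2 _⊠_

_⊠_ : Encoding → Encoding → Encoding
A ⊠ B = encoding {Carrier A × Carrier B} λ (a , b) → encode A a ∙ encode B b

ListE : Encoding → Encoding
ListE A = encoding {List (Carrier A)} λ as → encodeList (map (encode A) as)

-- The code finds its argument in the variable zero of any nonempty scope, and its
-- helper functions wherever φ places them.
record Computable (A B : Encoding) (f : Carrier A → Carrier B) : Set where
  field
    helpers   : ℕ
    code      : ∀ {m} (φ : Fin helpers → Fin m) {j} → Expr m (suc j)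
    bodies    : ∀ {m} (φ : Fin helpers → Fin m) → Vec (Expr m 1) helpers
    time size : Poly
    run       : ∀ {m} (fs : Bodies m) φ →
                (∀ i → Vec.lookup fs (φ i) ≡ Vec.lookup (bodies φ) i) →
                ∀ {j} (ρ : Vec Tree j) a →
                ∃[ t ] Eval fs (encode A a Vec.∷ ρ) (code φ) (encode B (f a)) t ×
                       t ≤ ⟪ time ⟫ (size′ A a)
    size-≤    : ∀ a → size′ B (f a) ≤ ⟪ size ⟫ (size′ A a)

open Computable

private variable
  A B C Γ : Encoding

para : {A B : Set} → B → (A → List A → B → B) → List A → B
para z s []       = z
para z s (x ∷ xs) = s x xs (para z s xs)

abstract

  -- Programs see only encodings, so a change of type that keeps the encoded values costs nothing.
  castC : ∀ {f : Carrier A → Carrier B} {g : Carrier A → Carrier C} →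
          (∀ a → encode B (f a) ≡ encode C (g a)) → Computable A B f → Computable A C g
  castC eq F = record
    { helpers = helpers F
    ; code    = code F
    ; bodies  = bodies F
    ; time    = time F
    ; size    = size F
    ; run     = λ fs φ h ρ a → let (t , e , t≤) = run F fs φ h ρ a in
                t , subst (λ v → Eval fs _ _ v t) (eq a) e , t≤
    ; size-≤  = λ a → subst (λ v → treeSize v ≤ _) (eq a) (size-≤ F a)
    }

  idC : Computable A A id
  idC = record
    { helpers = 0
    ; code    = λ φ → var zero
    ; bodies  = λ φ → Vec.[]
    ; time    = con 1
    ; size    = arg
    ; run     = λ fs φ h ρ a → 1 , var zero , ≤-refl
    ; size-≤  = λ a → ≤-refl
    }

  nilC : ∀ {f : Carrier A → Carrier B} → (∀ a → nil ≡ encode B (f a)) → Computable A B f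
  nilC eq = castC {B = encoding id} {f = λ _ → nil} eq record
    { helpers = 0
    ; code    = λ φ → nil
    ; bodies  = λ φ → Vec.[]
    ; time    = con 1
    ; size    = con 1
    ; run     = λ fs φ h ρ a → 1 , nil , ≤-refl
    ; size-≤  = λ a → ≤-refl
    }

  fstC : Computable (A ⊠ B) A proj₁
  fstC {A} {B} = record
    { helpers = 0
    ; code    = λ φ → caseCons (var zero) nil (var zero)
    ; bodies  = λ φ → Vec.[]
    ; time    = con 3
    ; size    = arg
    ; run     = λ fs φ h ρ a → 3 , caseCons (var zero) (var zero) , ≤-refl
    ; size-≤  = λ (a , b) → m≤n⇒m≤1+n (m≤m+n (size′ A a) _)
    }

  sndC : Computable (A ⊠ B) B proj₂
  sndC {A} {B} = record
    { helpers = 0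
    ; code    = λ φ → caseCons (var zero) nil (var (suc zero))
    ; bodies  = λ φ → Vec.[]
    ; time    = con 3
    ; size    = arg
    ; run     = λ fs φ h ρ a → 3 , caseCons (var zero) (var (suc zero)) , ≤-refl
    ; size-≤  = λ (a , b) → m≤n⇒m≤1+n (m≤n+m (size′ B b) _)
    }

  infixr 9 _∘C_

  _∘C_ : ∀ {g : Carrier B → Carrier C} {f : Carrier A → Carrier B} →
         Computable B C g → Computable A B f → Computable A C (g ∘ f)
  _∘C_ {f = f} G F = record
    { helpers = helpers F + helpers G
    ; code    = λ φ → letIn (code F (φ ∘ (_↑ˡ helpers G))) (code G (φ ∘ (helpers F ↑ʳ_)))
    ; bodies  = λ φ → bodies F (φ ∘ (_↑ˡ helpers G)) Vec.++ bodies G (φ ∘ (helpers F ↑ʳ_))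
    ; time    = con 1 ⊕ (time F ⊕ time G ⟨ size F ⟩)
    ; size    = size G ⟨ size F ⟩
    ; run     = λ fs φ h ρ a →
        let (t₁ , e₁ , t₁≤) = run F fs (φ ∘ (_↑ˡ helpers G))
              (λ i → trans (h (i ↑ˡ helpers G)) (lookup-++ˡ (bodies F _) _ i)) ρ a
            (t₂ , e₂ , t₂≤) = run G fs (φ ∘ (helpers F ↑ʳ_))
              (λ i → trans (h (helpers F ↑ʳ i)) (lookup-++ʳ (bodies F _) _ i)) (_ Vec.∷ ρ) (f a)
        in suc (t₁ + t₂) , letIn e₁ e₂ ,
           s≤s (+-mono-≤ t₁≤ (≤-trans t₂≤ (≤-⟨⟩ (time G) (size F) (size-≤ F a))))
    ; size-≤  = λ a → ≤-trans (size-≤ G (f a)) (≤-⟨⟩ (size G) (size F) (size-≤ F a))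
    }

  infixr 4 _,C_

  _,C_ : ∀ {f : Carrier Γ → Carrier A} {g : Carrier Γ → Carrier B} →
         Computable Γ A f → Computable Γ B g → Computable Γ (A ⊠ B) (λ γ → f γ , g γ)
  F ,C G = record
    { helpers = helpers F + helpers G
    ; code    = λ φ → cons (code F (φ ∘ (_↑ˡ helpers G))) (code G (φ ∘ (helpers F ↑ʳ_)))
    ; bodies  = λ φ → bodies F (φ ∘ (_↑ˡ helpers G)) Vec.++ bodies G (φ ∘ (helpers F ↑ʳ_))
    ; time    = con 1 ⊕ (time F ⊕ time G)
    ; size    = con 1 ⊕ (size F ⊕ size G)
    ; run     = λ fs φ h ρ a →
        let (t₁ , e₁ , t₁≤) = run F fs (φ ∘ (_↑ˡ helpers G))
              (λ i → trans (h (i ↑ˡ helpers G)) (lookup-++ˡ (bodies F _) _ i)) ρ a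
            (t₂ , e₂ , t₂≤) = run G fs (φ ∘ (helpers F ↑ʳ_))
              (λ i → trans (h (helpers F ↑ʳ i)) (lookup-++ʳ (bodies F _) _ i)) ρ a
        in suc (t₁ + t₂) , cons e₁ e₂ , s≤s (+-mono-≤ t₁≤ t₂≤)
    ; size-≤  = λ a → s≤s (+-mono-≤ (size-≤ F a) (size-≤ G a))
    }

  sameAtomC : ∀ {f g : Carrier Γ → Var} →
              Computable Γ (encoding atom) f → Computable Γ (encoding atom) g →
              Computable Γ (encoding id) (λ γ → sameAtom (atom (f γ)) (atom (g γ)))
  sameAtomC {f = f} {g} F G = record
    { helpers = helpers F + helpers G
    ; code    = λ φ → eqAtom (code F (φ ∘ (_↑ˡ helpers G))) (code G (φ ∘ (helpers F ↑ʳ_)))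
    ; bodies  = λ φ → bodies F (φ ∘ (_↑ˡ helpers G)) Vec.++ bodies G (φ ∘ (helpers F ↑ʳ_))
    ; time    = con 1 ⊕ (time F ⊕ time G)
    ; size    = con 3
    ; run     = λ fs φ h ρ a →
        let (t₁ , e₁ , t₁≤) = run F fs (φ ∘ (_↑ˡ helpers G))
              (λ i → trans (h (i ↑ˡ helpers G)) (lookup-++ˡ (bodies F _) _ i)) ρ a
            (t₂ , e₂ , t₂≤) = run G fs (φ ∘ (helpers F ↑ʳ_))
              (λ i → trans (h (helpers F ↑ʳ i)) (lookup-++ʳ (bodies F _) _ i)) ρ a
        in suc (t₁ + t₂) , eqAtom e₁ e₂ , s≤s (+-mono-≤ t₁≤ t₂≤)
    ; size-≤  = λ a → bound (f a ≡ᵇ g a)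
    }
    where
    bound : ∀ b → treeSize (if b then nil ∙ nil else nil) ≤ 3
    bound true  = ≤-refl
    bound false = s≤s z≤n

length≤size : ∀ (A : Encoding) xs → length xs ≤ size′ (ListE A) xs
length≤size A []       = z≤n
length≤size A (x ∷ xs) = s≤s (≤-trans (length≤size A xs) (m≤n+m _ (size′ A x)))

-- The bound `q` is demanded for all lists, since the results on all suffixes of `l γ` are passed to
-- the step.
module Recursion
  {Γ A B : Encoding} {l : Carrier Γ → List (Carrier A)} {z : Carrier Γ → Carrier B}
  {s : Carrier A × List (Carrier A) × Carrier B × Carrier Γ → Carrier B}
  (L : Computable Γ (ListE A) l) (Z : Computable Γ B z)
  (S : Computable (A ⊠ ListE A ⊠ B ⊠ Γ) B s)
  (q : Poly)
  (q-bound : ∀ γ xs → size′ B (para (z γ) (λ h t r → s (h , t , r , γ)) xs) ≤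
                      ⟪ q ⟫ (size′ (ListE A) xs + size′ Γ γ))
  where

  result : Carrier Γ → List (Carrier A) → Carrier B
  result γ = para (z γ) (λ h t r → s (h , t , r , γ))

  hL = helpers L
  hZ = helpers Z
  hS = helpers S

  -- The argument is a pair of the list and the environment. After both matches succeed the scope is
  -- head, tail, list, environment, argument; the result of the recursive call then comes in front.
  -- Each `letIn` puts the input of the called code into variable zero.
  loop : ∀ {m} (φ : Fin (suc (hL + (hZ + hS))) → Fin m) → Expr m 1
  loop φ =
    caseCons (var zero) nil
      (caseCons (var zero)
        (letIn (var (suc zero)) (code Z (φ ∘ suc ∘ (hL ↑ʳ_) ∘ (_↑ˡ hS))))
        (letIn (call (φ zero) (cons (var (suc zero)) (var (suc (suc (suc zero))))))
          (letIn (cons (var (suc zero)) (cons (var (suc (suc zero)))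
                   (cons (var zero) (var (suc (suc (suc (suc zero))))))))
            (code S (φ ∘ suc ∘ (hL ↑ʳ_) ∘ (hZ ↑ʳ_))))))

  bodies′ : ∀ {m} (φ : Fin (suc (hL + (hZ + hS))) → Fin m) →
            Vec (Expr m 1) (suc (hL + (hZ + hS)))
  bodies′ φ = loop φ Vec.∷
    (bodies L (φ ∘ suc ∘ (_↑ˡ (hZ + hS))) Vec.++
     (bodies Z (φ ∘ suc ∘ (hL ↑ʳ_) ∘ (_↑ˡ hS)) Vec.++
      bodies S (φ ∘ suc ∘ (hL ↑ʳ_) ∘ (hZ ↑ʳ_))))

  -- Bounds the size of the step's argument when the list has size at most M.
  stepArg : ℕ → ℕ → ℕ
  stepArg M n = 3 + (M + (M + (⟪ q ⟫ (M + n) + n)))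

  -- 17 and 6 count the evaluation steps of the loop itself, in a round and at the empty list.
  loopTime : ℕ → ℕ → List (Carrier A) → ℕ
  loopTime M n xs = length xs * (17 + ⟪ time S ⟫ (stepArg M n)) + (6 + ⟪ time Z ⟫ n)

  module _ {m} (fs : Bodies m) (φ : Fin (suc (hL + (hZ + hS))) → Fin m)
           (h : ∀ i → Vec.lookup fs (φ i) ≡ Vec.lookup (bodies′ φ) i) where

    runZ : ∀ {j} (ρ : Vec Tree j) γ → _
    runZ = run Z fs (φ ∘ suc ∘ (hL ↑ʳ_) ∘ (_↑ˡ hS)) λ i →
      trans (h (suc (hL ↑ʳ (i ↑ˡ hS))))
        (trans (lookup-++ʳ (bodies L _) _ (i ↑ˡ hS)) (lookup-++ˡ (bodies Z _) _ i))

    runS : ∀ {j} (ρ : Vec Tree j) γ → _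
    runS = run S fs (φ ∘ suc ∘ (hL ↑ʳ_) ∘ (hZ ↑ʳ_)) λ i →
      trans (h (suc (hL ↑ʳ (hZ ↑ʳ i))))
        (trans (lookup-++ʳ (bodies L _) _ (hZ ↑ʳ i)) (lookup-++ʳ (bodies Z _) _ i))

    runLoop : ∀ γ M xs → size′ (ListE A) xs ≤ M →
      ∃[ t ] Eval fs ((encode (ListE A) xs ∙ encode Γ γ) Vec.∷ Vec.[]) (loop φ)
               (encode B (result γ xs)) t × t ≤ loopTime M (size′ Γ γ) xs
    runLoop γ M []       _ =
      let (t , e , t≤) = runZ _ γ in
      _ , caseCons (var zero) (caseNil (var zero) (letIn (var (suc zero)) e)) ,
      +-monoʳ-≤ 6 t≤
    runLoop γ M (x ∷ xs) xs≤ =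
      let (t₁ , e₁ , t₁≤) = runLoop γ M xs (≤-trans (m≤n⇒m≤1+n (m≤n+m _ (size′ A x))) xs≤)
          (t₂ , e₂ , t₂≤) = runS _ (x , xs , result γ xs , γ)
      in _ ,
         caseCons (var zero) (caseCons (var zero)
           (letIn (call (cons (var (suc zero)) (var (suc (suc (suc zero)))))
                     (subst (λ e → Eval fs _ e _ t₁) (sym (h zero)) e₁))
             (letIn (cons (var (suc zero)) (cons (var (suc (suc zero)))
                      (cons (var zero) (var (suc (suc (suc (suc zero)))))))) e₂))) ,
         bound t₁ t₂ t₁≤ (≤-trans t₂≤ (⟪⟫-mono (time S) arg≤))
      where
      n = size′ Γ γ
      x≤  = ≤-trans (m≤n⇒m≤1+n (m≤m+n (size′ A x) _)) xs≤
      xs≤′ = ≤-trans (m≤n⇒m≤1+n (m≤n+m _ (size′ A x))) xs≤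
      arg≤ : size′ (A ⊠ ListE A ⊠ B ⊠ Γ) (x , xs , result γ xs , γ) ≤ stepArg M n
      arg≤ = s≤s (≤-trans (+-mono-≤ x≤ (s≤s (+-mono-≤ xs≤′
               (s≤s (+-monoˡ-≤ n (≤-trans (q-bound γ xs) (⟪⟫-mono q (+-monoˡ-≤ n xs≤′))))))))
               (≤-reflexive (trans (+-suc M _) (cong suc
                 (trans (cong (M +_) (+-suc M _)) (+-suc M _))))))
      bound : ∀ t₁ t₂ → t₁ ≤ loopTime M n xs → t₂ ≤ ⟪ time S ⟫ (stepArg M n) →
              suc (1 + suc (1 + suc (suc (3 + t₁) + suc (7 + t₂)))) ≤ loopTime M n (x ∷ xs)
      bound t₁ t₂ t₁≤ t₂≤ = begin
        suc (1 + suc (1 + suc (suc (3 + t₁) + suc (7 + t₂))))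
          ≡⟨ cong (9 +_) (+-comm t₁ (8 + t₂)) ⟩
        17 + (t₂ + t₁)
          ≡⟨ +-assoc 17 t₂ t₁ ⟨
        17 + t₂ + t₁
          ≤⟨ +-mono-≤ (+-monoʳ-≤ 17 t₂≤) t₁≤ ⟩
        17 + ⟪ time S ⟫ (stepArg M n) + loopTime M n xs
          ≡⟨ +-assoc (17 + ⟪ time S ⟫ (stepArg M n)) _ _ ⟨
        loopTime M n (x ∷ xs) ∎
        where open ≤-Reasoning

  stepArgP : Poly
  stepArgP = con 3 ⊕ (size L ⊕ (size L ⊕ (q ⟨ size L ⊕ arg ⟩ ⊕ arg)))

  stepArgP-correct : ∀ n → ⟪ stepArgP ⟫ n ≡ stepArg (⟪ size L ⟫ n) n
  stepArgP-correct n = cong (λ k → 3 + (⟪ size L ⟫ n + (⟪ size L ⟫ n + (k + n))))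
                         (⟪⟫-⟨⟩ q (size L ⊕ arg) n)

  abstract

    paraC : Computable Γ B (λ γ → result γ (l γ))
    paraC = record
      { helpers = suc (hL + (hZ + hS))
      ; code    = λ φ → call (φ zero) (cons (code L (φ ∘ suc ∘ (_↑ˡ (hZ + hS)))) (var zero))
      ; bodies  = bodies′
      ; time    = con 3 ⊕ (time L ⊕ (size L ⊗ (con 17 ⊕ time S ⟨ stepArgP ⟩) ⊕ (con 6 ⊕ time Z)))
      ; size    = q ⟨ size L ⊕ arg ⟩
      ; run     = λ fs φ h ρ γ →
          let (t₁ , e₁ , t₁≤) = run L fs (φ ∘ suc ∘ (_↑ˡ (hZ + hS)))
                (λ i → trans (h (suc (i ↑ˡ (hZ + hS)))) (lookup-++ˡ (bodies L _) _ i)) ρ γ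
              (t₂ , e₂ , t₂≤) = runLoop fs φ h γ _ (l γ) (size-≤ L γ)
          in _ , call (cons e₁ (var zero)) (subst (λ e → Eval fs _ e _ t₂) (sym (h zero)) e₂) ,
             time-bound γ t₁ t₂ t₁≤ t₂≤
      ; size-≤  = λ γ → ≤-trans (q-bound γ (l γ))
                    (≤-⟨⟩ q (size L ⊕ arg) (+-monoˡ-≤ (size′ Γ γ) (size-≤ L γ)))
      }
      where
      time-bound : ∀ γ t₁ t₂ → t₁ ≤ ⟪ time L ⟫ (size′ Γ γ) →
        t₂ ≤ loopTime (⟪ size L ⟫ (size′ Γ γ)) (size′ Γ γ) (l γ) →
        suc (suc (t₁ + 1) + t₂) ≤ 3 + (⟪ time L ⟫ (size′ Γ γ) +
          (⟪ size L ⟫ (size′ Γ γ) * (17 + ⟪ time S ⟨ stepArgP ⟩ ⟫ (size′ Γ γ)) +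
            (6 + ⟪ time Z ⟫ (size′ Γ γ))))
      time-bound γ t₁ t₂ t₁≤ t₂≤ = begin
        2 + (t₁ + 1 + t₂)
          ≡⟨ cong (λ t → 2 + (t + t₂)) (+-comm t₁ 1) ⟩
        3 + (t₁ + t₂)
          ≤⟨ +-monoʳ-≤ 3 (+-mono-≤ t₁≤ (≤-trans t₂≤ (+-monoˡ-≤ _
               (*-mono-≤ (≤-trans (length≤size A (l γ)) (size-≤ L γ))
                 (+-monoʳ-≤ 17 (≤-⟨⟩ (time S) stepArgP
                   (≤-reflexive (sym (stepArgP-correct (size′ Γ γ)))))))))) ⟩
        _ ∎
        where open ≤-Reasoning

open Recursion using (paraC) public

-- Computable operations on Booleans and lists

extC : ∀ {f g : Carrier A → Carrier B} → (∀ a → f a ≡ g a) → Computable A B f → Computable A B g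
extC {B = B} f≗g = castC (λ a → cong (encode B) (f≗g a))

BoolE VarE LiteralE ℕE : Encoding
BoolE    = encoding λ b → if b then nil ∙ nil else nil
VarE     = encoding atom
LiteralE = encoding encodeLiteral
ℕE       = encoding encodeℕ

[]C : Computable Γ (ListE A) (λ _ → [])
[]C = nilC λ _ → refl

infixr 5 _∷C_

_∷C_ : ∀ {f : Carrier Γ → Carrier A} {g : Carrier Γ → List (Carrier A)} →
       Computable Γ A f → Computable Γ (ListE A) g → Computable Γ (ListE A) (λ γ → f γ ∷ g γ)
F ∷C G = castC (λ _ → refl) (F ,C G)

caseList : {A B : Set} → B → (A → List A → B) → List A → B
caseList n c []       = n
caseList n c (x ∷ xs) = c x xs

caseListC : ∀ {l : Carrier Γ → List (Carrier A)} {n : Carrier Γ → Carrier B}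
  {c : Carrier A × List (Carrier A) × Carrier Γ → Carrier B} →
  Computable Γ (ListE A) l → Computable Γ B n → Computable (A ⊠ ListE A ⊠ Γ) B c →
  Computable Γ B (λ γ → caseList (n γ) (λ h t → c (h , t , γ)) (l γ))
caseListC {Γ} {A} {B} {l} {n} {c} L N C =
  extC (λ γ → para≡case γ (l γ))
    (paraC L N (C ∘C (fstC ,C fstC ∘C sndC ,C sndC ∘C sndC ∘C sndC))
       (size N ⊕ size C ⟨ con 1 ⊕ arg ⟩) bound)
  where
  para≡case : ∀ γ xs → para (n γ) (λ h t _ → c (h , t , γ)) xs ≡
                       caseList (n γ) (λ h t → c (h , t , γ)) xs
  para≡case γ []       = refl
  para≡case γ (x ∷ xs) = refl
  bound : ∀ γ xs → _
  bound γ []       = ≤-trans (size-≤ N γ)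
    (≤-trans (⟪⟫-mono (size N) (n≤1+n _)) (m≤m+n _ _))
  bound γ (x ∷ xs) = ≤-trans (size-≤ C (x , xs , γ)) (≤-trans
    (≤-⟨⟩ (size C) (con 1 ⊕ arg) (≤-reflexive (cong suc
       (trans (+-suc (size′ A x) _) (cong suc (sym (+-assoc (size′ A x) _ _)))))))
    (m≤n+m _ _))

-- A Boolean is encoded like a list of at most one trivial entry, which reduces branching to
-- `caseListC`.
ifC : ∀ {b : Carrier Γ → Bool} {t e : Carrier Γ → Carrier B} →
      Computable Γ BoolE b → Computable Γ B t → Computable Γ B e →
      Computable Γ B (λ γ → if b γ then t γ else e γ)
ifC {b = b} {t} {e} P T E =
  extC (λ γ → case≡if (b γ) γ)
    (caseListC {A = encoding {⊤} (λ _ → nil)} {l = units ∘ b}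
      (castC (λ γ → encode-units (b γ)) P) E (T ∘C sndC ∘C sndC))
  where
  units : Bool → List ⊤
  units b = if b then tt ∷ [] else []
  encode-units : ∀ b → encode BoolE b ≡ encode (ListE (encoding {⊤} (λ _ → nil))) (units b)
  encode-units true  = refl
  encode-units false = refl
  case≡if : ∀ b γ → caseList (e γ) (λ _ _ → t γ) (units b) ≡ (if b then t γ else e γ)
  case≡if true  γ = refl
  case≡if false γ = refl

trueC : Computable Γ BoolE (λ _ → true)
trueC = castC (λ _ → refl) (nilC {B = encoding {Tree} id} {f = λ _ → nil} (λ _ → refl) ,C
                            nilC {B = encoding {Tree} id} {f = λ _ → nil} (λ _ → refl))

falseC : Computable Γ BoolE (λ _ → false)
falseC = nilC λ _ → refl

notC : ∀ {b : Carrier Γ → Bool} → Computable Γ BoolE b → Computable Γ BoolE (not ∘ b)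
notC {b = b} P = extC (λ γ → lemma (b γ)) (ifC P falseC trueC)
  where
  lemma : ∀ b → (if b then false else true) ≡ not b
  lemma true  = refl
  lemma false = refl

infixr 6 _∧C_
infixr 5 _∨C_

_∧C_ : ∀ {b c : Carrier Γ → Bool} → Computable Γ BoolE b → Computable Γ BoolE c →
       Computable Γ BoolE (λ γ → b γ ∧ c γ)
_∧C_ {b = b} {c} P Q = extC (λ γ → lemma (b γ) (c γ)) (ifC P Q falseC)
  where
  lemma : ∀ b c → (if b then c else false) ≡ b ∧ c
  lemma true  c = refl
  lemma false c = refl

_∨C_ : ∀ {b c : Carrier Γ → Bool} → Computable Γ BoolE b → Computable Γ BoolE c →
       Computable Γ BoolE (λ γ → b γ ∨ c γ)
_∨C_ {b = b} {c} P Q = extC (λ γ → lemma (b γ) (c γ)) (ifC P trueC Q)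
  where
  lemma : ∀ b c → (if b then true else c) ≡ b ∨ c
  lemma true  c = refl
  lemma false c = refl

size-Bool : ∀ b → size′ BoolE b ≤ 3
size-Bool true  = ≤-refl
size-Bool false = s≤s z≤n

≟C : ∀ {f g : Carrier Γ → Var} → Computable Γ VarE f → Computable Γ VarE g →
     Computable Γ BoolE (λ γ → does (f γ ≟ g γ))
-- `does` of the equality test reduces to the Boolean test inside `sameAtom`.
≟C F G = castC (λ _ → refl) (sameAtomC F G)

module _ {P : Carrier Γ → Carrier A → Set} (P? : ∀ γ a → Dec (P γ a))
         {l : Carrier Γ → List (Carrier A)}
         (L : Computable Γ (ListE A) l) (D : Computable (A ⊠ Γ) BoolE (λ (a , γ) → does (P? γ a)))
  where

  private
    D′ : ∀ {B} → Computable (A ⊠ ListE A ⊠ B ⊠ Γ) BoolE (λ (a , _ , _ , γ) → does (P? γ a))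
    D′ = D ∘C (fstC ,C sndC ∘C sndC ∘C sndC)

  allC : Computable Γ BoolE (λ γ → does (all? (P? γ) (l γ)))
  allC = extC (λ γ → lemma γ (l γ))
    (paraC L trueC (D′ ∧C fstC ∘C sndC ∘C sndC) (con 3) (λ _ _ → size-Bool _))
    where
    lemma : ∀ γ xs → para true (λ h _ r → does (P? γ h) ∧ r) xs ≡ does (all? (P? γ) xs)
    lemma γ []       = refl
    lemma γ (x ∷ xs) = cong (does (P? γ x) ∧_) (lemma γ xs)

  anyC : Computable Γ BoolE (λ γ → does (any? (P? γ) (l γ)))
  anyC = extC (λ γ → lemma γ (l γ))
    (paraC L falseC (D′ ∨C fstC ∘C sndC ∘C sndC) (con 3) (λ _ _ → size-Bool _))
    where
    lemma : ∀ γ xs → para false (λ h _ r → does (P? γ h) ∨ r) xs ≡ does (any? (P? γ) xs)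
    lemma γ []       = refl
    lemma γ (x ∷ xs) = cong (does (P? γ x) ∨_) (lemma γ xs)

  filterC : Computable Γ (ListE A) (λ γ → filter (P? γ) (l γ))
  filterC = extC (λ γ → lemma γ (l γ))
    (paraC L []C (ifC D′ (fstC ∷C fstC ∘C sndC ∘C sndC) (fstC ∘C sndC ∘C sndC)) arg
      (λ γ xs → ≤-trans (bound γ xs) (m≤m+n _ _)))
    where
    step : Carrier Γ → Carrier A → List (Carrier A) → List (Carrier A) → List (Carrier A)
    step γ h _ r = if does (P? γ h) then h ∷ r else r
    lemma : ∀ γ xs → para [] (step γ) xs ≡ filter (P? γ) xs
    lemma γ []       = refl
    lemma γ (x ∷ xs) with does (P? γ x)
    ... | true  = cong (x ∷_) (lemma γ xs)
    ... | false = lemma γ xs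
    bound : ∀ γ xs → size′ (ListE A) (para [] (step γ) xs) ≤ size′ (ListE A) xs
    bound γ []       = ≤-refl
    bound γ (x ∷ xs) with does (P? γ x)
    ... | true  = s≤s (+-monoʳ-≤ (size′ A x) (bound γ xs))
    ... | false = m≤n⇒m≤1+n (≤-trans (bound γ xs) (m≤n+m _ (size′ A x)))

-- A fold whose step adds to the result at most an amount that does not depend on it.
module _ {l : Carrier Γ → List (Carrier A)} {z : Carrier Γ → Carrier B}
  {s : Carrier A × List (Carrier A) × Carrier B × Carrier Γ → Carrier B}
  (L : Computable Γ (ListE A) l) (Z : Computable Γ B z)
  (S : Computable (A ⊠ ListE A ⊠ B ⊠ Γ) B s)
  (p : Poly)
  (s-bound : ∀ h t r γ → size′ B (s (h , t , r , γ)) ≤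
             size′ B r + ⟪ p ⟫ (size′ (ListE A) (h ∷ t) + size′ Γ γ))
  where

  private
    bound : ∀ γ N xs → size′ (ListE A) xs + size′ Γ γ ≤ N →
            size′ B (para (z γ) (λ h t r → s (h , t , r , γ)) xs) ≤
            ⟪ size Z ⟫ (size′ Γ γ) + length xs * ⟪ p ⟫ N
    bound γ N []       _   = ≤-trans (size-≤ Z γ) (m≤m+n _ 0)
    bound γ N (x ∷ xs) xs≤ = begin
      _ ≤⟨ s-bound x xs _ γ ⟩
      _ ≤⟨ +-mono-≤ (bound γ N xs (≤-trans (+-monoˡ-≤ _ (m≤n⇒m≤1+n (m≤n+m _ (size′ A x)))) xs≤))
                    (⟪⟫-mono p xs≤) ⟩
      ⟪ size Z ⟫ (size′ Γ γ) + length xs * ⟪ p ⟫ N + ⟪ p ⟫ N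
        ≡⟨ +-assoc (⟪ size Z ⟫ (size′ Γ γ)) _ _ ⟩
      ⟪ size Z ⟫ (size′ Γ γ) + (length xs * ⟪ p ⟫ N + ⟪ p ⟫ N)
        ≡⟨ cong (⟪ size Z ⟫ (size′ Γ γ) +_) (+-comm (length xs * ⟪ p ⟫ N) _) ⟩
      _ ∎
      where open ≤-Reasoning

  additiveC : Computable Γ B (λ γ → para (z γ) (λ h t r → s (h , t , r , γ)) (l γ))
  additiveC = paraC L Z S (size Z ⊕ arg ⊗ p) λ γ xs → ≤-trans (bound γ _ xs ≤-refl)
    (+-mono-≤ (⟪⟫-mono (size Z) (m≤n+m _ _))
      (*-monoˡ-≤ _ (≤-trans (length≤size A xs) (m≤m+n _ _))))

para-foldr : ∀ {A B : Set} (z : B) (s : A → B → B) xs → para z (λ h _ → s h) xs ≡ foldr s z xs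
para-foldr z s []       = refl
para-foldr z s (x ∷ xs) = cong (s x) (para-foldr z s xs)

mapC : ∀ {l : Carrier Γ → List (Carrier A)} {f : Carrier A × Carrier Γ → Carrier B} →
       Computable Γ (ListE A) l → Computable (A ⊠ Γ) B f →
       Computable Γ (ListE B) (λ γ → map (λ a → f (a , γ)) (l γ))
mapC {Γ} {A} {B} {l} {f} L F = extC (λ γ → lemma γ (l γ))
  (additiveC L []C (F ∘C (fstC ,C sndC ∘C sndC ∘C sndC) ∷C fstC ∘C sndC ∘C sndC)
    (con 1 ⊕ size F)
    (λ h t r γ → ≤-trans
      (s≤s (+-monoˡ-≤ _ (≤-trans (size-≤ F (h , γ))
        (⟪⟫-mono (size F) (s≤s (+-monoˡ-≤ (size′ Γ γ) (m≤m+n _ _)))))))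
      (≤-reflexive (trans (cong suc (+-comm _ (size′ (ListE B) r))) (sym (+-suc _ _))))))
  where
  lemma : ∀ γ xs → para [] (λ h _ r → f (h , γ) ∷ r) xs ≡ map (λ a → f (a , γ)) xs
  lemma γ []       = refl
  lemma γ (x ∷ xs) = cong (_ ∷_) (lemma γ xs)

size-++ : ∀ (A : Encoding) xs ys → suc (size′ (ListE A) (xs ++ ys)) ≡ size′ (ListE A) xs + size′ (ListE A) ys
size-++ A []       ys = refl
size-++ A (x ∷ xs) ys = cong suc (begin
  suc (size′ A x + size′ (ListE A) (xs ++ ys)) ≡⟨ +-suc (size′ A x) _ ⟨
  size′ A x + suc (size′ (ListE A) (xs ++ ys)) ≡⟨ cong (size′ A x +_) (size-++ A xs ys) ⟩
  size′ A x + (size′ (ListE A) xs + size′ (ListE A) ys) ≡⟨ +-assoc (size′ A x) _ _ ⟨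
  size′ A x + size′ (ListE A) xs + size′ (ListE A) ys ∎)
  where open ≡-Reasoning

infixr 5 _++C_

_++C_ : ∀ {l k : Carrier Γ → List (Carrier A)} →
        Computable Γ (ListE A) l → Computable Γ (ListE A) k →
        Computable Γ (ListE A) (λ γ → l γ ++ k γ)
_++C_ {Γ} {A} {l} {k} L K = extC (λ γ → lemma (k γ) (l γ))
  (additiveC L K (fstC ∷C fstC ∘C sndC ∘C sndC) arg
    (λ h t r γ → ≤-trans (≤-reflexive (cong suc (+-comm (size′ A h) _)))
      (≤-trans (≤-reflexive (sym (+-suc _ _)))
        (+-monoʳ-≤ (size′ (ListE A) r) (s≤s (≤-trans (m≤m+n _ _) (m≤m+n _ _)))))))
  where
  lemma : ∀ ys xs → para ys (λ h _ r → h ∷ r) xs ≡ xs ++ ys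
  lemma ys []       = refl
  lemma ys (x ∷ xs) = cong (x ∷_) (lemma ys xs)

concatC : ∀ {l : Carrier Γ → List (List (Carrier A))} → Computable Γ (ListE (ListE A)) l →
          Computable Γ (ListE A) (λ γ → concat (l γ))
concatC {Γ} {A} {l} L = extC (λ γ → para-foldr [] _++_ (l γ))
  (additiveC L []C (fstC ++C fstC ∘C sndC ∘C sndC) arg
    (λ h t r γ → ≤-trans (n≤1+n _) (≤-trans (≤-reflexive (size-++ A h r))
      (≤-trans (≤-reflexive (+-comm _ (size′ (ListE A) r)))
        (+-monoʳ-≤ (size′ (ListE A) r) (≤-trans (m≤m+n _ _) (≤-trans (n≤1+n _) (m≤m+n _ _))))))))

-- The construction runs in polynomial time

VarsE LitsE EntryE BlockE NetE StateE : Encoding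
VarsE  = ListE VarE
LitsE  = ListE LiteralE
EntryE = LitsE ⊠ ℕE
BlockE = EntryE ⊠ ListE EntryE
NetE   = encoding {Net} λ (n , G) → encodeGates G
StateE = NetE ⊠ ListE EntryE

∈?C : ∀ {x : Carrier Γ → Var} {ys : Carrier Γ → List Var} →
      Computable Γ VarE x → Computable Γ VarsE ys →
      Computable Γ BoolE (λ γ → does (x γ ∈? ys γ))
∈?C {x = x} X Y = anyC (λ γ y → x γ ≟ y) Y (≟C (X ∘C sndC) fstC)

isNeg : Literal → Bool
isNeg (pos x) = false
isNeg (neg x) = true

literalC : ∀ {ℓ : Carrier Γ → Literal} → Computable Γ LiteralE ℓ →
           Computable Γ (BoolE ⊠ VarE) (λ γ → isNeg (ℓ γ) , litVar (ℓ γ))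
literalC {ℓ = ℓ} = castC λ γ → lemma (ℓ γ)
  where
  lemma : ∀ ℓ → encode LiteralE ℓ ≡ encode (BoolE ⊠ VarE) (isNeg ℓ , litVar ℓ)
  lemma (pos x) = refl
  lemma (neg x) = refl

litVarC : ∀ {ℓ : Carrier Γ → Literal} → Computable Γ LiteralE ℓ → Computable Γ VarE (litVar ∘ ℓ)
litVarC L = sndC ∘C literalC L

posC negC : ∀ {x : Carrier Γ → Var} → Computable Γ VarE x → Computable Γ LiteralE _
posC {x = x} X = castC {g = pos ∘ x} (λ _ → refl) (falseC ,C X)
negC {x = x} X = castC {g = neg ∘ x} (λ _ → refl) (trueC ,C X)

≟ᴸC : ∀ {ℓ ℓ′ : Carrier Γ → Literal} → Computable Γ LiteralE ℓ → Computable Γ LiteralE ℓ′ →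
      Computable Γ BoolE (λ γ → does (ℓ γ ≟ᴸ ℓ′ γ))
≟ᴸC {ℓ = ℓ} {ℓ′} L L′ = extC (λ γ → lemma (ℓ γ) (ℓ′ γ))
  (ifC (fstC ∘C literalC L) (fstC ∘C literalC L′) (notC (fstC ∘C literalC L′)) ∧C
   ≟C (litVarC L) (litVarC L′))
  where
  lemma : ∀ ℓ ℓ′ → (if isNeg ℓ then isNeg ℓ′ else not (isNeg ℓ′)) ∧ does (litVar ℓ ≟ litVar ℓ′) ≡
                   does (ℓ ≟ᴸ ℓ′)
  lemma (pos x) (pos y) = refl
  lemma (pos x) (neg y) = refl
  lemma (neg x) (pos y) = refl
  lemma (neg x) (neg y) = refl

∈ᴸ?C : ∀ {ℓ : Carrier Γ → Literal} {c : Carrier Γ → Literals} →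
       Computable Γ LiteralE ℓ → Computable Γ LitsE c →
       Computable Γ BoolE (λ γ → does (ℓ γ ∈ᴸ? c γ))
∈ᴸ?C {ℓ = ℓ} L C = anyC (λ γ ℓ′ → ℓ γ ≟ᴸ ℓ′) C (≟ᴸC (L ∘C sndC) fstC)

varsOfC : ∀ {c : Carrier Γ → Literals} → Computable Γ LitsE c → Computable Γ VarsE (varsOf ∘ c)
varsOfC C = mapC C (litVarC fstC)

belowC : ∀ {zs e f : Carrier Γ → List Var} →
         Computable Γ VarsE zs → Computable Γ VarsE e → Computable Γ VarsE f →
         Computable Γ BoolE (λ γ → does (below? (zs γ) (e γ) (f γ)))
belowC Z E F = allC _ E (∈?C fstC (Z ∘C sndC) ∨C ∈?C fstC (F ∘C sndC))

subC : ∀ {zs : Carrier Γ → List Var} {c d : Carrier Γ → Literals} →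
       Computable Γ VarsE zs → Computable Γ LitsE c → Computable Γ LitsE d →
       Computable Γ BoolE (λ γ → does (sub? (zs γ) (c γ) (d γ)))
subC Z C D = allC _ C (∈?C (litVarC fstC) (Z ∘C sndC) ∨C ∈ᴸ?C fstC (D ∘C sndC))

prependC : ∀ {es ys : Carrier Γ → List Var} → Computable Γ VarsE es → Computable Γ VarsE ys →
           Computable Γ VarsE (λ γ → prepend (es γ) (ys γ))
prependC {es = es} {ys} E Y = extC (λ γ → lemma (es γ) (ys γ))
  (caseListC E Y (fstC ∷C Y ∘C sndC ∘C sndC))
  where
  lemma : ∀ es ys → caseList ys (λ x _ → x ∷ ys) es ≡ prepend es ys
  lemma []      ys = refl
  lemma (x ∷ _) ys = refl

nestedAtC : ∀ {ys e f : Carrier Γ → List Var} {x : Carrier Γ → Var} →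
  Computable Γ VarsE ys → Computable Γ VarE x → Computable Γ VarsE e → Computable Γ VarsE f →
  Computable Γ BoolE (λ γ → does (nestedAt? (ys γ) (x γ) (e γ) (f γ)))
nestedAtC Y X E F = notC (∈?C X E) ∨C notC (∈?C X F) ∨C
                    belowC (X ∷C Y) E F ∨C belowC (X ∷C Y) F E

eligibleC : ∀ {H : Carrier Γ → Hypergraph} {ys : Carrier Γ → List Var} {x : Carrier Γ → Var} →
  Computable Γ (ListE VarsE) H → Computable Γ VarsE ys → Computable Γ VarE x →
  Computable Γ BoolE (λ γ → does (eligible? (H γ) (ys γ) (x γ)))
eligibleC {H = H} {ys} {x} HC Y X = notC (∈?C X Y) ∧C
  allC (λ γ e → all? (nestedAt? (ys γ) (x γ) e) (H γ)) HC
    (allC (λ (e , γ) f → nestedAt? (ys γ) (x γ) e f) (HC ∘C sndC)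
      (nestedAtC (Y ∘C sndC ∘C sndC) (X ∘C sndC ∘C sndC) (fstC ∘C sndC) fstC))

growC : ∀ {H : Carrier Γ → Hypergraph} {ys : Carrier Γ → List Var} →
        Computable Γ (ListE VarsE) H → Computable Γ VarsE ys →
        Computable Γ VarsE (λ γ → grow (H γ) (ys γ))
growC {H = H} {ys} HC Y = prependC
  (filterC (λ γ x → eligible? (H γ) (ys γ) x) (concatC HC) (eligibleC (HC ∘C sndC) (Y ∘C sndC) fstC)) Y

eliminationOrderC : Computable (ListE VarsE) VarsE eliminationOrder
eliminationOrderC = extC (λ H → para-foldr [] (λ _ → grow H) (concat H))
  (additiveC (concatC idC) []C (growC (sndC ∘C sndC ∘C sndC) (fstC ∘C sndC ∘C sndC)) (con 2)
    (λ _ _ r H → prepend-size (filter (eligible? H r) (concat H)) r))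
  where
  prepend-size : ∀ es ys → size′ VarsE (prepend es ys) ≤ size′ VarsE ys + 2
  prepend-size []      ys = m≤m+n _ 2
  prepend-size (x ∷ _) ys = ≤-reflexive (+-comm 2 (size′ VarsE ys))

varsC : ∀ {D : Carrier Γ → Entry} → Computable Γ EntryE D → Computable Γ VarsE (vars ∘ D)
varsC D = varsOfC (fstC ∘C D)

membersC : ∀ {b : Carrier Γ → Block} → Computable Γ BlockE b → Computable Γ (ListE EntryE) (members ∘ b)
membersC = castC λ _ → refl

glueC : ∀ {b c : Carrier Γ → Block} → Computable Γ BlockE b → Computable Γ BlockE c →
        Computable Γ BlockE (λ γ → glue (b γ) (c γ))
glueC B C = fstC ∘C C ,C (sndC ∘C C ++C membersC B)

absorbC : ∀ {zs : Carrier Γ → List Var} {b c : Carrier Γ → Block} →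
          Computable Γ VarsE zs → Computable Γ BlockE b → Computable Γ BlockE c →
          Computable Γ BlockE (λ γ → absorb (zs γ) (b γ) (c γ))
absorbC Z B C = ifC (belowC Z (varsC (fstC ∘C B)) (varsC (fstC ∘C C))) (glueC B C) (glueC C B)

-- Two lists become one and a `nil` is saved. Merging only rearranges entries, so iterating it does
-- not make the blocks grow.
glue-size : ∀ b c → suc (size′ BlockE (glue b c)) ≡ size′ BlockE b + size′ BlockE c
glue-size (r , m) (r′ , m′) = begin
  suc (suc (∣r′∣ + size′ (ListE EntryE) (m′ ++ r ∷ m)))
    ≡⟨ cong suc (+-suc ∣r′∣ _) ⟨
  suc (∣r′∣ + suc (size′ (ListE EntryE) (m′ ++ r ∷ m)))
    ≡⟨ cong (λ k → suc (∣r′∣ + k)) (size-++ EntryE m′ (r ∷ m)) ⟩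
  suc (∣r′∣ + (size′ (ListE EntryE) m′ + size′ BlockE (r , m)))
    ≡⟨ cong suc (+-assoc ∣r′∣ _ _) ⟨
  size′ BlockE (r′ , m′) + size′ BlockE (r , m)
    ≡⟨ +-comm (size′ BlockE (r′ , m′)) _ ⟩
  size′ BlockE (r , m) + size′ BlockE (r′ , m′) ∎
  where
  open ≡-Reasoning
  ∣r′∣ = size′ EntryE r′

absorb-size : ∀ zs b c → size′ BlockE (absorb zs b c) ≤ size′ BlockE b + size′ BlockE c
absorb-size zs b c with does (below? zs (vars (rep b)) (vars (rep c)))
... | true  = ≤-trans (n≤1+n _) (≤-reflexive (glue-size b c))
... | false = ≤-trans (n≤1+n _) (≤-reflexive (trans (glue-size c b) (+-comm (size′ BlockE c) _)))

foldr-absorb-size : ∀ zs t ts →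
  size′ BlockE (foldr (absorb zs) t ts) ≤ size′ BlockE t + size′ (ListE BlockE) ts
foldr-absorb-size zs t []       = m≤m+n _ 1
foldr-absorb-size zs t (c ∷ cs) = begin
  size′ BlockE (absorb zs c (foldr (absorb zs) t cs))
    ≤⟨ absorb-size zs c (foldr (absorb zs) t cs) ⟩
  size′ BlockE c + size′ BlockE (foldr (absorb zs) t cs)
    ≤⟨ +-monoʳ-≤ (size′ BlockE c) (foldr-absorb-size zs t cs) ⟩
  size′ BlockE c + (size′ BlockE t + size′ (ListE BlockE) cs)
    ≡⟨ x∙yz≈y∙xz (size′ BlockE c) (size′ BlockE t) _ ⟩
  size′ BlockE t + (size′ BlockE c + size′ (ListE BlockE) cs)
    ≤⟨ +-monoʳ-≤ (size′ BlockE t) (n≤1+n _) ⟩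
  size′ BlockE t + size′ (ListE BlockE) (c ∷ cs) ∎
  where
  open ≤-Reasoning

joinC : ∀ {zs : Carrier Γ → List Var} {ts us : Carrier Γ → List Block} →
        Computable Γ VarsE zs → Computable Γ (ListE BlockE) ts → Computable Γ (ListE BlockE) us →
        Computable Γ (ListE BlockE) (λ γ → join (zs γ) (ts γ) (us γ))
joinC {Γ} {zs} {ts} {us} Z T U = extC (λ γ → lemma (zs γ) (ts γ) (us γ))
  (caseListC T U (folded ∷C U ∘C sndC ∘C sndC))
  where
  lemma : ∀ zs ts us → caseList us (λ t ts → foldr (absorb zs) t ts ∷ us) ts ≡ join zs ts us
  lemma zs []       us = refl
  lemma zs (t ∷ ts) us = refl
  folded : Computable (BlockE ⊠ ListE BlockE ⊠ Γ) BlockE (λ (t , ts , γ) → foldr (absorb (zs γ)) t ts)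
  folded = extC (λ (t , ts , γ) → para-foldr t (absorb (zs γ)) ts)
    (additiveC (fstC ∘C sndC) fstC
      (absorbC (Z ∘C sndC ∘C sndC ∘C sndC ∘C sndC ∘C sndC) fstC (fstC ∘C sndC ∘C sndC)) arg
      (λ h t r (_ , _ , γ) → ≤-trans (absorb-size (zs γ) h r)
        (≤-trans (≤-reflexive (+-comm (size′ BlockE h) _))
          (+-monoʳ-≤ (size′ BlockE r)
            (≤-trans (m≤n⇒m≤1+n (m≤m+n (size′ BlockE h) _)) (m≤m+n _ _))))))

mergeC : ∀ {x : Carrier Γ → Var} {ys : Carrier Γ → List Var} {bs : Carrier Γ → List Block} →
         Computable Γ VarE x → Computable Γ VarsE ys → Computable Γ (ListE BlockE) bs →
         Computable Γ (ListE BlockE) (λ γ → merge (x γ) (ys γ) (bs γ))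
mergeC {x = x} X Y B = joinC (X ∷C Y)
  (filterC (λ γ → touches? (x γ)) B touchC) (filterC (λ γ → ¬? ∘ touches? (x γ)) B (notC touchC))
  where touchC = ∈?C (X ∘C sndC) (varsC (fstC ∘C fstC))

filter-size : ∀ (A : Encoding) {P : Carrier A → Set} (P? : ∀ a → Dec (P a)) xs →
  size′ (ListE A) (filter P? xs) + size′ (ListE A) (filter (¬? ∘ P?) xs) ≡ suc (size′ (ListE A) xs)
filter-size A P? []       = refl
filter-size A P? (x ∷ xs) with does (P? x)
... | true  = cong suc (trans (+-assoc (size′ A x) _ _)
                (trans (cong (size′ A x +_) (filter-size A P? xs)) (+-suc (size′ A x) _)))
... | false = trans (+-suc (size′ (ListE A) (filter P? xs)) _) (cong suc
                (trans (x∙yz≈y∙xz (size′ (ListE A) (filter P? xs)) (size′ A x) _)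
                  (trans (cong (size′ A x +_) (filter-size A P? xs)) (+-suc (size′ A x) _))))

join-size : ∀ zs ts us → size′ (ListE BlockE) (join zs ts us) ≤ size′ (ListE BlockE) ts + size′ (ListE BlockE) us
join-size zs []       us = n≤1+n _
join-size zs (t ∷ ts) us = s≤s (+-monoˡ-≤ (size′ (ListE BlockE) us) (foldr-absorb-size zs t ts))

-- The extra 1 is the second `nil` that splitting the list by `touches?` introduces.
merge-size : ∀ x ys bs → size′ (ListE BlockE) (merge x ys bs) ≤ size′ (ListE BlockE) bs + 1
merge-size x ys bs = ≤-trans (join-size (x ∷ ys) (filter (touches? x) bs) (filter (¬? ∘ touches? x) bs))
  (≤-reflexive (trans (filter-size BlockE (touches? x) bs) (+-comm 1 _)))

componentsC : ∀ {ys : Carrier Γ → List Var} {S : Carrier Γ → List Entry} →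
  Computable Γ VarsE ys → Computable Γ (ListE EntryE) S →
  Computable Γ (ListE BlockE) (λ γ → components (ys γ) (S γ))
componentsC {ys = ys} {S} Y SC = extC (λ γ → lemma (S γ) (ys γ))
  (additiveC Y (mapC SC (fstC ,C []C)) (mergeC fstC (fstC ∘C sndC) (fstC ∘C sndC ∘C sndC)) (con 1)
    (λ x ys r _ → merge-size x ys r))
  where
  lemma : ∀ S ys → para (map (_, []) S) merge ys ≡ components ys S
  lemma S []       = refl
  lemma S (x ∷ ys) = cong (merge x ys) (lemma S ys)

pointersC : ∀ {ys : Carrier Γ → List Var} {S : Carrier Γ → List Entry} →
  Computable Γ VarsE ys → Computable Γ (ListE EntryE) S →
  Computable Γ (ListE ℕE) (λ γ → pointers (ys γ) (S γ))
pointersC Y S = mapC (componentsC Y S) (sndC ∘C fstC ∘C fstC)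

firstBlockC : ∀ {bs : Carrier Γ → List Block} → Computable Γ (ListE BlockE) bs →
              Computable Γ (ListE EntryE) (firstBlock ∘ bs)
firstBlockC {bs = bs} B = extC (λ γ → lemma (bs γ)) (caseListC B []C (membersC fstC))
  where
  lemma : ∀ bs → caseList [] (λ b _ → members b) bs ≡ firstBlock bs
  lemma []      = refl
  lemma (b ∷ _) = refl

keyC : ∀ {x : Carrier Γ → Var} {ys : Carrier Γ → List Var} {T : Carrier Γ → List Entry}
       {c : Carrier Γ → Literals} →
       Computable Γ VarE x → Computable Γ VarsE ys → Computable Γ (ListE EntryE) T →
       Computable Γ LitsE c → Computable Γ (ListE EntryE) (λ γ → key (x γ) (ys γ) (T γ) (c γ))
keyC {x = x} {ys} {T} {c} X Y TC C = firstBlockC (componentsC (X ∷C Y)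
  (filterC (λ γ E → sub? (x γ ∷ ys γ) (proj₁ E) (c γ)) TC
    (subC ((X ∷C Y) ∘C sndC) (fstC ∘C fstC) (C ∘C sndC))))

-- The variable is recovered from the literal, so that one program, and one size bound, serves both
-- branches.
keyPointers : Literal → List Var → List Entry → Literals → List ℕ
keyPointers ℓ ys T c = pointers ys (restrict ℓ (key (litVar ℓ) ys T c))

keyPointersC : Computable (LiteralE ⊠ VarsE ⊠ ListE EntryE ⊠ LitsE) (ListE ℕE)
               (λ (ℓ , ys , T , c) → keyPointers ℓ ys T c)
keyPointersC = pointersC (fstC ∘C sndC)
  (filterC (λ (ℓ , _) E → ¬? (ℓ ∈ᴸ? proj₁ E))
    (keyC (litVarC fstC) (fstC ∘C sndC) (fstC ∘C sndC ∘C sndC) (sndC ∘C sndC ∘C sndC))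
    (notC (∈ᴸ?C (fstC ∘C sndC) (fstC ∘C fstC))))

TreeE UnitE : Encoding
TreeE = encoding id
UnitE = encoding {⊤} λ _ → nil

numeralC : ∀ k → Computable Γ ℕE (λ _ → k)
numeralC zero    = nilC λ _ → refl
numeralC (suc k) = castC (λ _ → refl) (nilC {B = UnitE} {f = λ _ → tt} (λ _ → refl) ,C numeralC k)

unary : ℕ → List ⊤
unary n = replicate n tt

encode-unary : ∀ n → encode ℕE n ≡ encode (ListE UnitE) (unary n)
encode-unary zero    = refl
encode-unary (suc n) = cong (nil ∙_) (encode-unary n)

size-ℕ : ∀ n → size′ ℕE n ≡ suc (n + n)
size-ℕ zero    = refl
size-ℕ (suc n) = cong (2 +_) (trans (size-ℕ n) (sym (+-suc n n)))

unaryC : ∀ {k : Carrier Γ → ℕ} → Computable Γ ℕE k → Computable Γ (ListE UnitE) (unary ∘ k)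
unaryC {k = k} = castC λ γ → encode-unary (k γ)

predC : ∀ {k : Carrier Γ → ℕ} → Computable Γ ℕE k → Computable Γ ℕE (pred ∘ k)
predC {k = k} K = castC (λ γ → lemma (k γ)) (caseListC (unaryC K) []C (fstC ∘C sndC))
  where
  lemma : ∀ n → encode (ListE UnitE) (caseList [] (λ _ t → t) (unary n)) ≡ encode ℕE (pred n)
  lemma zero    = refl
  lemma (suc n) = sym (encode-unary n)

-- By `toℕ-ref`, subtraction turns the stable addresses into the backward references of the
-- encoding.
∸C : ∀ {m k : Carrier Γ → ℕ} → Computable Γ ℕE m → Computable Γ ℕE k →
     Computable Γ ℕE (λ γ → m γ ∸ k γ)
∸C {m = m} {k} M K = extC (λ γ → lemma (m γ) (k γ))
  (additiveC (unaryC K) M (predC (fstC ∘C sndC ∘C sndC)) (con 0)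
    (λ _ _ r _ → ≤-trans (size-pred r) (m≤m+n _ 0)))
  where
  size-pred : ∀ r → size′ ℕE (pred r) ≤ size′ ℕE r
  size-pred zero    = ≤-refl
  size-pred (suc r) = m≤n⇒m≤1+n (n≤1+n _)
  lemma : ∀ m k → para m (λ _ _ → pred) (unary k) ≡ m ∸ k
  lemma m zero    = refl
  lemma m (suc k) = trans (cong pred (lemma m k)) (pred[m∸n]≡m∸[1+n] m k)

lengthC : ∀ {l : Carrier Γ → List (Carrier A)} → Computable Γ (ListE A) l → Computable Γ ℕE (length ∘ l)
lengthC {A = A} {l = l} L = extC (λ γ → length-map {A = Carrier A} (λ _ → tt) (l γ))
  (castC (λ γ → lemma (l γ)) (mapC {B = UnitE} L (nilC λ _ → refl)))
  where
  lemma : ∀ xs → encode (ListE UnitE) (map (λ _ → tt) xs) ≡ encode ℕE (length (map (λ _ → tt) xs))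
  lemma []       = refl
  lemma (x ∷ xs) = cong (nil ∙_) (lemma xs)

gateTrees : ∀ {n} → Gates n → List Tree
gateTrees []      = []
gateTrees (G ▷ g) = encodeGate g ∷ gateTrees G

gateTrees-encode : ∀ {n} (G : Gates n) → encodeGates G ≡ encode (ListE TreeE) (gateTrees G)
gateTrees-encode []      = refl
gateTrees-encode (G ▷ g) = cong (encodeGate g ∙_) (gateTrees-encode G)

length-gateTrees : ∀ {n} (G : Gates n) → length (gateTrees G) ≡ n
length-gateTrees []      = refl
length-gateTrees (G ▷ g) = cong suc (length-gateTrees G)

newestC : ∀ {N : Carrier Γ → Net} → Computable Γ NetE N → Computable Γ ℕE (newest ∘ N)
newestC {N = N} NC = extC (λ γ → cong pred (length-gateTrees (proj₂ (N γ))))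
  (predC (lengthC {A = TreeE} {l = λ γ → gateTrees (proj₂ (N γ))} (castC (λ γ → gateTrees-encode (proj₂ (N γ))) NC)))

encode-refs : ∀ n ps → encode (ListE ℕE) (map (λ p → n ∸ p) ps) ≡ encodeRefs (map (ref n) ps)
encode-refs n []       = refl
encode-refs n (p ∷ ps) = cong₂ (λ k t → encodeℕ k ∙ t) (sym (toℕ-ref n p)) (encode-refs n ps)

pushAndC : ∀ {ps : Carrier Γ → List ℕ} {N : Carrier Γ → Net} →
           Computable Γ (ListE ℕE) ps → Computable Γ NetE N →
           Computable Γ NetE (λ γ → pushAnd (ps γ) (N γ))
pushAndC {ps = ps} {N} P NC =
  castC (λ γ → cong (λ t → (encodeℕ 2 ∙ t) ∙ encode NetE (N γ)) (encode-refs (newest (N γ)) (ps γ)))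
    ((numeralC 2 ,C mapC P (∸C (newestC (NC ∘C sndC)) fstC)) ,C NC)

literalGatesC : ∀ {x : Carrier Γ → Var} {N : Carrier Γ → Net} →
  Computable Γ VarE x → Computable Γ NetE N →
  Computable Γ NetE (λ γ → literalGates (x γ) (N γ))
literalGatesC {x = x} {N} X NC = castC (λ _ → refl)
  ((numeralC 0 ,C negC X) ,C (numeralC 0 ,C posC X) ,C NC)

emitC : ∀ {x : Carrier Γ → Var} {ps qs : Carrier Γ → List ℕ} {N : Carrier Γ → Net} →
  Computable Γ VarE x → Computable Γ (ListE ℕE) ps → Computable Γ (ListE ℕE) qs →
  Computable Γ NetE N → Computable Γ NetE (λ γ → emit (x γ) (ps γ) (qs γ) (N γ))
emitC X P Q NC = castC (λ _ → refl)
  ((numeralC 3 ,C numeralC 1 ∷C numeralC 0 ∷C []C) ,C both ,C both ,C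
   pushAndC Q (pushAndC P (literalGatesC X NC)))
  where
  both : Computable _ (ℕE ⊠ ListE ℕE) _
  both = numeralC 2 ,C numeralC 3 ∷C numeralC 1 ∷C []C

emitKeyC : ∀ {x : Carrier Γ → Var} {ys : Carrier Γ → List Var} {T : Carrier Γ → List Entry}
  {c : Carrier Γ → Literals} {N : Carrier Γ → Net} →
  Computable Γ VarE x → Computable Γ VarsE ys → Computable Γ (ListE EntryE) T → Computable Γ LitsE c →
  Computable Γ NetE N →
  Computable Γ NetE (λ γ → emitKey (x γ) (ys γ) (key (x γ) (ys γ) (T γ) (c γ)) (N γ))
emitKeyC X Y TC C NC = emitC X (keyPointersC ∘C (posC X ,C Y ,C TC ,C C))
                              (keyPointersC ∘C (negC X ,C Y ,C TC ,C C)) NC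

enterC : ∀ {c : Carrier Γ → Literals} {S : Carrier Γ → State} →
         Computable Γ LitsE c → Computable Γ StateE S → Computable Γ StateE (λ γ → enter (c γ) (S γ))
enterC C S = fstC ∘C S ,C ((C ,C newestC (fstC ∘C S)) ∷C sndC ∘C S)

visitC : ∀ {x : Carrier Γ → Var} {ys : Carrier Γ → List Var} {T : Carrier Γ → List Entry}
  {E : Carrier Γ → Entry} {S : Carrier Γ → State} →
  Computable Γ VarE x → Computable Γ VarsE ys → Computable Γ (ListE EntryE) T → Computable Γ EntryE E →
  Computable Γ StateE S →
  Computable Γ StateE (λ γ → visit (x γ) (ys γ) (T γ) (E γ) (S γ))
visitC X Y TC E S = ifC (∈?C X (varsC E))
  (enterC (fstC ∘C E) (emitKeyC X Y TC (fstC ∘C E) (fstC ∘C S) ,C sndC ∘C S))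
  (fstC ∘C S ,C (E ∷C sndC ∘C S))

-- Size bounds for circuits and tables on arbitrary inputs

size-refs : ∀ {m n} → m ≤ suc n → (vs : List (Fin m)) →
            treeSize (encodeRefs vs) ≤ 1 + length vs * (2 + 2 * n)
size-refs         m≤ []       = ≤-refl
size-refs {n = n} m≤ (v ∷ vs) = s≤s (≤-trans (+-mono-≤ size-v (size-refs m≤ vs))
  (≤-reflexive (lemma n (length vs * (2 + 2 * n)))))
  where
  v≤ : toℕ v ≤ n
  v≤ = s≤s⁻¹ (≤-trans (toℕ<n v) m≤)
  size-v : treeSize (encodeℕ (toℕ v)) ≤ 1 + (n + n)
  size-v = ≤-trans (≤-reflexive (size-ℕ (toℕ v))) (s≤s (+-mono-≤ v≤ v≤))
  lemma : ∀ n k → 1 + (n + n) + (1 + k) ≡ 2 + 2 * n + k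
  lemma = solve-∀

size-literal : ∀ ℓ → treeSize (encodeLiteral ℓ) ≤ 5
size-literal (pos x) = s≤s (s≤s (s≤s z≤n))
size-literal (neg x) = ≤-refl

size-gate : ∀ {m n w} → m ≤ suc n → (g : Gate m) → inputCount g ≤ w →
            treeSize (encodeGate g) ≤ 9 + w * (2 + 2 * n)
size-gate         m≤ (lit ℓ)       _  =
  ≤-trans (+-monoʳ-≤ 2 (size-literal ℓ)) (≤-trans (m≤m+n 7 2) (m≤m+n 9 _))
size-gate         m≤ (const false) _  = ≤-trans (m≤m+n 5 4) (m≤m+n 9 _)
size-gate         m≤ (const true)  _  = ≤-trans (m≤m+n 7 2) (m≤m+n 9 _)
size-gate {n = n} m≤ (and vs)      v≤ = ≤-trans (+-monoʳ-≤ 6 (size-refs m≤ vs))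
  (≤-trans (m≤n+m _ 2) (+-monoʳ-≤ 9 (*-monoˡ-≤ (2 + 2 * n) v≤)))
size-gate {n = n} m≤ (or vs)       v≤ =
  +-monoʳ-≤ 8 (≤-trans (size-refs m≤ vs) (s≤s (*-monoˡ-≤ (2 + 2 * n) v≤)))

-- n bounds the addresses of the gates, and w their numbers of inputs.
size-gates : ∀ {m n w} (G : Gates m) → m ≤ suc n → maxInputCount G ≤ w →
             treeSize (encodeGates G) ≤ 1 + m * (10 + w * (2 + 2 * n))
size-gates         []      _  _  = ≤-refl
size-gates {suc m} {n} {w} (G ▷ g) m≤ G≤ = s≤s (≤-trans
  (+-mono-≤ (size-gate (≤-trans (n≤1+n _) m≤) g (≤-trans (m≤n⊔m _ _) G≤))
            (size-gates {n = n} G (≤-trans (n≤1+n _) m≤) (≤-trans (m≤m⊔n _ _) G≤)))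
  (≤-reflexive (+-suc (9 + w * (2 + 2 * n)) (m * (10 + w * (2 + 2 * n))))))

record Small (n w : ℕ) (N : Net) : Set where
  field
    newest≤ : newest N ≤ n
    inputs≤ : maxInputCount (proj₂ N) ≤ w

open Small

netBound : ℕ → ℕ → ℕ
netBound n w = 1 + suc n * (10 + w * (2 + 2 * n))

size-net : ∀ {n w N} → Small n w N → size′ NetE N ≤ netBound n w
size-net {n} {w} {N} S = ≤-trans (size-gates (proj₂ N) (s≤s (newest≤ S)) (inputs≤ S))
  (s≤s (*-monoˡ-≤ (10 + w * (2 + 2 * n)) (s≤s (newest≤ S))))

Thin : ℕ → Var → List Var → List Entry → Literals → Set
Thin w x ys T c = length (keyPointers (pos x) ys T c) ≤ w × length (keyPointers (neg x) ys T c) ≤ w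

-- The length of the table is tracked exactly, because it determines how many gates a stage may add.
record SmallState (n w t l : ℕ) (S : State) : Set where
  field
    net    : Small n w (proj₁ S)
    table  : size′ (ListE EntryE) (proj₂ S) ≤ t
    length-table : length (proj₂ S) ≡ l

-- `n₀` bounds all addresses in advance, so each new unary address has size at most `1 + 2 * n₀`,
-- independently of when it is entered.
visit-small : ∀ {x ys T n n₀ w t l E S} → 2 ≤ w → Thin w x ys T (proj₁ E) → 7 + n ≤ n₀ →
  SmallState n w t l S →
  SmallState (7 + n) w (suc (size′ EntryE E + (1 + 2 * n₀) + t)) (suc l) (visit x ys T E S)
visit-small {x} {ys} {T} {n} {n₀} {w} {t} {l} {c , p} {N , T′} 2≤w (thin⁺ , thin⁻) n≤n₀ St
  with does (x ∈? varsOf c)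
... | true = record
  { net    = record
      { newest≤ = new≤
      ; inputs≤ = emit-maxInputCount {x} {keyPointers (pos x) ys T c} {keyPointers (neg x) ys T c} {N}
                    (inputs≤ St.net) thin⁺ thin⁻ 2≤w
      }
  ; table  = s≤s (+-mono-≤ (s≤s (≤-trans (+-monoʳ-≤ (size′ LitsE c) size-new)
               (+-monoˡ-≤ (1 + 2 * n₀) (m≤m+n (size′ LitsE c) (size′ ℕE p))))) St.table)
  ; length-table = cong suc St.length-table
  }
  where
  module St = SmallState St
  new≤ : 7 + newest N ≤ 7 + n
  new≤ = +-monoʳ-≤ 7 (newest≤ St.net)
  size-new : size′ ℕE (7 + newest N) ≤ 1 + 2 * n₀
  size-new = ≤-trans (≤-reflexive (size-ℕ (7 + newest N)))
    (s≤s (≤-trans (+-mono-≤ (≤-trans new≤ n≤n₀) (≤-trans new≤ n≤n₀))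
      (≤-reflexive (cong (n₀ +_) (sym (+-identityʳ n₀))))))
... | false = record
  { net    = record { newest≤ = ≤-trans (newest≤ St.net) (m≤n+m n 7) ; inputs≤ = inputs≤ St.net }
  ; table  = s≤s (+-mono-≤ (m≤m+n _ _) St.table)
  ; length-table = cong suc St.length-table
  }
  where module St = SmallState St

visits-small : ∀ {x ys T n n₀ w} N L → 2 ≤ w → (∀ {E} → E ∈ L → Thin w x ys T (proj₁ E)) →
  7 * length L + n ≤ n₀ → Small n w N →
  SmallState (7 * length L + n) w (size′ (ListE EntryE) L + length L * (1 + 2 * n₀)) (length L)
    (foldr (visit x ys T) (N , []) L)
visits-small N []      2≤w thin n≤ S = record { net = S ; table = ≤-refl ; length-table = refl }
visits-small {x} {ys} {T} {n} {n₀} {w} N (E ∷ L) 2≤w thin n≤ S = subst₂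
  (λ m t → SmallState m w t (suc (length L)) (foldr (visit x ys T) (N , []) (E ∷ L)))
  (sym m≡)
  (cong suc (lemma (size′ EntryE E) (1 + 2 * n₀) (size′ (ListE EntryE) L) (length L * (1 + 2 * n₀))))
  (visit-small {x} {ys} {T} 2≤w (thin (here refl)) (≤-trans (≤-reflexive (sym m≡)) n≤)
    (visits-small {x} {ys} {T} N L 2≤w (thin ∘ there) (≤-trans (+-monoˡ-≤ n (*-monoʳ-≤ 7 (n≤1+n (length L)))) n≤) S))
  where
  m≡ : 7 * length (E ∷ L) + n ≡ 7 + (7 * length L + n)
  m≡ = cong (_+ n) (*-suc 7 (length L))
  lemma : ∀ a b c d → a + b + (c + d) ≡ a + c + (b + d)
  lemma = solve-∀

SmallState-≤ : ∀ {n n′ w t t′ l l′ S} → n ≤ n′ → t ≤ t′ → l ≡ l′ →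
               SmallState n w t l S → SmallState n′ w t′ l′ S
SmallState-≤ n≤ t≤ refl St = record
  { net    = record { newest≤ = ≤-trans (newest≤ St.net) n≤ ; inputs≤ = inputs≤ St.net }
  ; table  = ≤-trans St.table t≤
  ; length-table = St.length-table
  }
  where module St = SmallState St

size-state : ∀ {n w t l S} → SmallState n w t l S → size′ StateE S ≤ suc (netBound n w + t)
size-state St = s≤s (+-mono-≤ (size-net (SmallState.net St)) (SmallState.table St))

∈-size : ∀ {x : Carrier A} {xs} → x ∈ xs → size′ A x ≤ size′ (ListE A) xs
∈-size (here refl) = m≤n⇒m≤1+n (m≤m+n _ _)
∈-size (there x∈)  = m≤n⇒m≤1+n (≤-trans (∈-size x∈) (m≤n+m _ _))

-- The size bound that comes with keyPointersC also limits the number of pointers.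
widthP : Poly → Poly
widthP p = con 2 ⊕ size keyPointersC ⟨ con 8 ⊕ (p ⊕ (p ⊕ p)) ⟩

thin : ∀ p s {x ys T c} → size′ VarsE ys ≤ ⟪ p ⟫ s → size′ (ListE EntryE) T ≤ ⟪ p ⟫ s →
       size′ LitsE c ≤ ⟪ p ⟫ s → Thin (⟪ widthP p ⟫ s) x ys T c
thin p s {x} {ys} {T} {c} ys≤ T≤ c≤ = bound (pos x) , bound (neg x)
  where
  bound : ∀ ℓ → length (keyPointers ℓ ys T c) ≤ ⟪ widthP p ⟫ s
  bound ℓ = ≤-trans (length≤size ℕE (keyPointers ℓ ys T c))
    (≤-trans (size-≤ keyPointersC (ℓ , ys , T , c))
      (≤-trans (≤-⟨⟩ (size keyPointersC) (con 8 ⊕ (p ⊕ (p ⊕ p)))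
        (≤-trans (s≤s (+-mono-≤ (size-literal ℓ) (s≤s (+-mono-≤ ys≤ (s≤s (+-mono-≤ T≤ c≤))))))
          (≤-reflexive (lemma (⟪ p ⟫ s)))))
        (m≤n+m _ 2)))
    where
    lemma : ∀ k → 1 + (5 + (1 + (k + (1 + (k + k))))) ≡ 8 + (k + (k + k))
    lemma = solve-∀

netBoundP : Poly → Poly → Poly
netBoundP n w = con 1 ⊕ (con 1 ⊕ n) ⊗ (con 10 ⊕ w ⊗ (con 2 ⊕ con 2 ⊗ n))

newest≤size : ∀ N → newest N ≤ size′ NetE N
newest≤size (n , G) = begin
  n                                       ≤⟨ n≤1+n n ⟩
  suc n                                   ≡⟨ length-gateTrees G ⟨
  length (gateTrees G)                    ≤⟨ length≤size TreeE (gateTrees G) ⟩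
  size′ (ListE TreeE) (gateTrees G)       ≡⟨ cong treeSize (gateTrees-encode G) ⟨
  treeSize (encodeGates G)                ∎
  where open ≤-Reasoning

inputs≤size : ∀ {n} (G : Gates n) → maxInputCount G ≤ treeSize (encodeGates G)
inputs≤size []      = z≤n
inputs≤size (G ▷ g) = ⊔-lub (m≤n⇒m≤1+n (≤-trans (inputs≤size G) (m≤n+m _ _)))
                            (m≤n⇒m≤1+n (≤-trans (inputs g) (m≤m+n _ _)))
  where
  refs : ∀ {n} (vs : List (Fin n)) → length vs ≤ treeSize (encodeRefs vs)
  refs []       = z≤n
  refs (v ∷ vs) = s≤s (≤-trans (refs vs) (m≤n+m _ (treeSize (encodeℕ (toℕ v)))))
  inputs : ∀ {n} (g : Gate n) → inputCount g ≤ treeSize (encodeGate g)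
  inputs (lit ℓ)   = z≤n
  inputs (const b) = z≤n
  inputs (and vs)  = ≤-trans (refs vs) (m≤n+m _ 6)
  inputs (or vs)   = ≤-trans (refs vs) (m≤n+m _ 8)

stageC : Computable (VarE ⊠ VarsE ⊠ StateE) StateE (λ (x , ys , S) → stage x ys S)
stageC = extC (λ (x , ys , N , T) → para-foldr (N , []) (visit x ys T) T)
  (paraC (sndC ∘C sndC ∘C sndC) (fstC ∘C sndC ∘C sndC ,C []C)
    (visitC (fstC ∘C γ) (fstC ∘C sndC ∘C γ) (sndC ∘C sndC ∘C sndC ∘C γ) fstC (fstC ∘C sndC ∘C sndC))
    q bound)
  where
  γ : ∀ {A B C D} → Computable (A ⊠ B ⊠ C ⊠ D) D (λ (_ , _ , _ , d) → d)
  γ = sndC ∘C sndC ∘C sndC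
  nP wP q : Poly
  -- Seven new gates for each entry, on top of the gates already present.
  nP = con 7 ⊗ arg ⊕ arg
  wP = arg ⊕ widthP arg
  q  = con 1 ⊕ (netBoundP nP wP ⊕ (arg ⊕ arg ⊗ (con 1 ⊕ con 2 ⊗ nP)))
  bound : ∀ δ L → let (x , ys , N , T) = δ in
          size′ StateE (para (N , []) (λ h _ r → visit x ys T h r) L) ≤
          ⟪ q ⟫ (size′ (ListE EntryE) L + size′ (VarE ⊠ VarsE ⊠ StateE) δ)
  bound (x , ys , N , T) L =
    subst (λ S → size′ StateE S ≤ ⟪ q ⟫ s) (sym (para-foldr (N , []) (visit x ys T) L))
      (size-state (SmallState-≤ (+-monoˡ-≤ s (*-monoʳ-≤ 7 L≤))
        (+-mono-≤ (m≤m+n _ _) (*-monoˡ-≤ (1 + 2 * ⟪ nP ⟫ s) L≤)) refl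
        (visits-small {x} {ys} {T} {s} {⟪ nP ⟫ s} {⟪ wP ⟫ s} N L
          (≤-trans (m≤m+n 2 _) (m≤n+m _ s))
          (λ {E} E∈ → widen (thin arg s {x} {ys} {T} {proj₁ E} ys≤ T≤ (c≤ E∈)))
          (+-monoˡ-≤ s (*-monoʳ-≤ 7 L≤))
          record { newest≤ = ≤-trans (newest≤size N) N≤
                 ; inputs≤ = ≤-trans (inputs≤size (proj₂ N)) (≤-trans N≤ (m≤m+n s _)) })))
    where
    s = size′ (ListE EntryE) L + size′ (VarE ⊠ VarsE ⊠ StateE) (x , ys , N , T)
    δ≤ : size′ (VarE ⊠ VarsE ⊠ StateE) (x , ys , N , T) ≤ s
    δ≤ = m≤n+m _ _
    L≤ : length L ≤ s
    L≤ = ≤-trans (length≤size EntryE L) (m≤m+n _ _)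
    ys≤ : size′ VarsE ys ≤ s
    ys≤ = ≤-trans (≤-trans (m≤m+n _ _) (m≤n+m _ 3)) δ≤
    N≤ : size′ NetE N ≤ s
    N≤ = ≤-trans (≤-trans (≤-trans (m≤m+n _ _) (≤-trans (n≤1+n _) (m≤n+m _ (size′ VarsE ys)))) (m≤n+m _ 3)) δ≤
    T≤ : size′ (ListE EntryE) T ≤ s
    T≤ = ≤-trans (≤-trans (≤-trans (m≤n+m _ (size′ NetE N))
           (≤-trans (n≤1+n _) (m≤n+m _ (size′ VarsE ys)))) (m≤n+m _ 3)) δ≤
    c≤ : ∀ {E} → E ∈ L → size′ LitsE (proj₁ E) ≤ s
    c≤ {E} E∈ = ≤-trans (m≤n⇒m≤1+n (m≤m+n _ _)) (≤-trans (∈-size {A = EntryE} E∈) (m≤m+n _ _))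
    widen : ∀ {c} → Thin (⟪ widthP arg ⟫ s) x ys T c → Thin (⟪ wP ⟫ s) x ys T c
    widen (p , q) = ≤-trans p (m≤n+m _ s) , ≤-trans q (m≤n+m _ s)

initialTableC : Computable (ListE LitsE) (ListE EntryE) (map (_, 0))
initialTableC = mapC idC (fstC ,C numeralC 0)

buildC : Computable (VarsE ⊠ ListE LitsE) StateE (λ (xs , F) → build F xs)
buildC = extC (λ (xs , F) → para-build F xs)
  (paraC fstC (netC ,C initialTableC ∘C sndC)
    (stageC ∘C (fstC ,C fstC ∘C sndC ,C fstC ∘C sndC ∘C sndC)) q bound)
  where
  netC : Computable (VarsE ⊠ ListE LitsE) NetE (λ _ → 0 , [] ▷ const false)
  netC = castC (λ _ → refl) ((numeralC 1 ,C numeralC 0) ,C []C {A = TreeE})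
  para-build : ∀ F xs → para (build F []) stage xs ≡ build F xs
  para-build F []       = refl
  para-build F (x ∷ xs) = cong (stage x xs) (para-build F xs)
  nP tP wP q : Poly
  nP = arg ⊗ (con 7 ⊗ arg)
  tP = size initialTableC ⊕ arg ⊗ (arg ⊗ (con 1 ⊕ con 2 ⊗ nP))
  wP = widthP (arg ⊕ tP)
  q  = con 1 ⊕ (netBoundP nP wP ⊕ tP)
  module _ (F : List Literals) (s : ℕ) (F≤ : size′ (ListE LitsE) F ≤ s) where
    l = length F
    l≤ : l ≤ s
    l≤ = ≤-trans (length≤size LitsE F) F≤
    t : ℕ → ℕ
    t k = ⟪ size initialTableC ⟫ s + k * (l * (1 + 2 * ⟪ nP ⟫ s))
    n≤ : ∀ {k} → k ≤ s → k * (7 * l) ≤ ⟪ nP ⟫ s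
    n≤ k≤ = *-mono-≤ k≤ (*-monoʳ-≤ 7 l≤)
    t≤ : ∀ {k} → k ≤ s → t k ≤ ⟪ tP ⟫ s
    t≤ k≤ = +-monoʳ-≤ (⟪ size initialTableC ⟫ s) (*-mono-≤ k≤ (*-monoˡ-≤ (1 + 2 * ⟪ nP ⟫ s) l≤))
    -- Iterating the size bound of `stageC` would nest polynomials once per stage. A direct count
    -- avoids this without circularity: the number of gates depends on the numbers of clauses and
    -- stages only, the table on the addresses, and the width on the table.
    build-small : ∀ ys → size′ VarsE ys ≤ s →
                SmallState (length ys * (7 * l)) (⟪ wP ⟫ s) (t (length ys)) l (build F ys)
    build-small []       _   = record
      { net    = record { newest≤ = z≤n ; inputs≤ = z≤n }
      ; table  = ≤-trans (size-≤ initialTableC F)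
                   (≤-trans (⟪⟫-mono (size initialTableC) F≤) (m≤m+n _ 0))
      ; length-table = length-map (_, 0) F
      }
    build-small (x ∷ ys) ys≤ = SmallState-≤
      (≤-reflexive (cong (λ k → 7 * k + length ys * (7 * l)) St.length-table))
      (≤-trans (+-mono-≤ St.table (*-monoˡ-≤ (1 + 2 * ⟪ nP ⟫ s) (≤-reflexive St.length-table)))
        (≤-reflexive (lemma (⟪ size initialTableC ⟫ s) (length ys * b) b)))
      St.length-table
      (visits-small {x} {ys} {T} {length ys * (7 * l)} {⟪ nP ⟫ s} {⟪ wP ⟫ s} N T (m≤m+n 2 _)
        (λ {E} E∈ → thin (arg ⊕ tP) s {x} {ys} {T} {proj₁ E} (≤-trans ys≤′ (m≤m+n s _)) T≤
           (≤-trans (m≤n⇒m≤1+n (m≤m+n _ _)) (≤-trans (∈-size {A = EntryE} E∈) T≤)))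
        (≤-trans (≤-reflexive (cong (λ k → 7 * k + length ys * (7 * l)) St.length-table))
          (n≤ (≤-trans (length≤size VarE (x ∷ ys)) ys≤)))
        St.net)
      where
      b = l * (1 + 2 * ⟪ nP ⟫ s)
      ys≤′ : size′ VarsE ys ≤ s
      ys≤′ = ≤-trans (≤-trans (n≤1+n _) (n≤1+n _)) ys≤
      N = proj₁ (build F ys)
      T = proj₂ (build F ys)
      St = build-small ys ys≤′
      module St = SmallState St
      T≤ : size′ (ListE EntryE) T ≤ s + ⟪ tP ⟫ s
      T≤ = ≤-trans St.table (≤-trans (t≤ (≤-trans (length≤size VarE ys) ys≤′)) (m≤n+m _ s))
      lemma : ∀ a c b → a + c + b ≡ a + (b + c)
      lemma = solve-∀
  bound : ∀ δ xs → let (_ , F) = δ in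
          size′ StateE (para (build F []) stage xs) ≤ ⟪ q ⟫ (size′ VarsE xs + size′ (VarsE ⊠ ListE LitsE) δ)
  bound (zs , F) xs = subst (λ S → size′ StateE S ≤ ⟪ q ⟫ s) (sym (para-build F xs))
    (size-state (SmallState-≤ (n≤ F s F≤ k≤) (t≤ F s F≤ k≤) refl (build-small F s F≤ xs (m≤m+n _ _))))
    where
    s = size′ VarsE xs + size′ (VarsE ⊠ ListE LitsE) (zs , F)
    F≤ : size′ (ListE LitsE) F ≤ s
    F≤ = ≤-trans (≤-trans (m≤n+m _ (size′ VarsE zs)) (n≤1+n _)) (m≤n+m _ (size′ VarsE xs))
    k≤ : length xs ≤ s
    k≤ = ≤-trans (length≤size VarE xs) (m≤m+n _ _)

-- The program, its running time and the final bounds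

construct : List Literals → Net
construct F = let xs = eliminationOrder (map varsOf F) in finish xs (build F xs)

finishC : Computable (VarsE ⊠ StateE) NetE (λ (xs , S) → finish xs S)
finishC = pushAndC (pointersC fstC (sndC ∘C sndC)) (fstC ∘C sndC)

constructC : Computable (ListE LitsE) NetE construct
constructC = finishC ∘C (fstC ,C buildC) ∘C (eliminationOrderC ∘C mapC idC (varsOfC fstC) ,C idC)

toCircuit : Net → Circuit
toCircuit (n , G) = record { size = suc n ; gates = G ; output = zero }

CircuitE : Encoding
CircuitE = encoding encodeCircuit

circuitC : Computable (ListE LitsE) CircuitE (toCircuit ∘ construct)
circuitC = castC (λ _ → refl) (nilC {B = UnitE} {f = λ _ → tt} (λ _ → refl) ,C constructC)

program : ∀ {A B f} → Computable A B f → Program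
program M = record { helpers = helpers M ; bodies = code M suc Vec.∷ bodies M suc }

program-returns : ∀ {A B f} (M : Computable A B f) a →
  ∃[ t ] (program M on encode A a Returns encode B (f a) In t × t ≤ ⟪ time M ⟫ (size′ A a))
program-returns M a = run M _ suc (λ _ → refl) Vec.[] a

literalCount : List Literals → ℕ
literalCount F = sum (map (length ∘ varsOf) F)

-- Clauses are distinct, so at most one is empty, and every other one contributes a literal. This
-- bounds the encoded input in terms of `cnfSize`.
length≤literalCount : ∀ {F} → AllPairs (λ c d → ¬ c ≐ d) F → length F ≤ suc (literalCount F)
length≤literalCount {[]}          _        = z≤n
length≤literalCount {[] ∷ F}      (n ∷ _)  = s≤s (nonempty F n)
  where
  nonempty : ∀ F → All (λ d → ¬ [] ≐ d) F → length F ≤ literalCount F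
  nonempty []            _        = z≤n
  nonempty ([] ∷ F)      (n ∷ _)  = ⊥-elim (n (≐-refl {xs = []}))
  nonempty ((_ ∷ c) ∷ F) (_ ∷ ns) = s≤s (≤-trans (nonempty F ns) (m≤n+m _ (length (varsOf c))))
length≤literalCount {(_ ∷ c) ∷ F} (_ ∷ ds) =
  s≤s (≤-trans (length≤literalCount ds) (s≤s (m≤n+m _ (length (varsOf c)))))

size-clause : ∀ c → size′ LitsE c ≤ 1 + 6 * length (varsOf c)
size-clause []      = ≤-refl
size-clause (ℓ ∷ c) = s≤s (≤-trans (+-mono-≤ (size-literal ℓ) (size-clause c))
  (≤-reflexive (lemma (length (varsOf c)))))
  where
  lemma : ∀ k → 5 + (1 + 6 * k) ≡ 6 * (1 + k)
  lemma = solve-∀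

size-formula : ∀ F → size′ (ListE LitsE) F ≤ 1 + 2 * length F + 6 * literalCount F
size-formula []      = ≤-refl
size-formula (c ∷ F) = s≤s (≤-trans (+-mono-≤ (size-clause c) (size-formula F))
  (≤-reflexive (lemma (length (varsOf c)) (length F) (literalCount F))))
  where
  lemma : ∀ k m s → 1 + 6 * k + (1 + 2 * m + 6 * s) ≡ 2 * (1 + m) + 6 * (k + s)
  lemma = solve-∀

-- An upper bound for the fan-in; decision gates need two inputs even if there is only one edge.
width : ℕ → ℕ
width 1 = 2
width n = n

≤-width : ∀ n → n ≤ width n
≤-width 0             = ≤-refl
≤-width 1             = s≤s z≤n
≤-width (suc (suc n)) = ≤-refl

2≤width : ∀ n → 2 ≤ width (suc n)
2≤width zero    = ≤-refl
2≤width (suc n) = s≤s (s≤s z≤n)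

width-≢1 : ∀ n → n ≢ 1 → width n ≡ n
width-≢1 0             _  = refl
width-≢1 1             n≢ = ⊥-elim (n≢ refl)
width-≢1 (suc (suc n)) _  = refl

any-true⁺ : {A : Set} {f : A → Bool} → ∀ {xs x} → x ∈ xs → f x ≡ true → any f xs ≡ true
any-true⁺             (here refl) eq rewrite eq = refl
any-true⁺ {f = f} {y ∷ ys} (there x∈)  eq with f y
... | true  = refl
... | false = any-true⁺ x∈ eq

any-true⁻ : {A : Set} {f : A → Bool} → ∀ xs → any f xs ≡ true → ∃[ x ] x ∈ xs × f x ≡ true
any-true⁻ {f = f} (x ∷ xs) eq with f x in fx
... | true  = x , here refl , fx
... | false = let (y , y∈ , fy) = any-true⁻ xs eq in y , there y∈ , fy

true-ext : ∀ {a b} → (a ≡ true → b ≡ true) → (b ≡ true → a ≡ true) → a ≡ b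
true-ext {true}  {b}     f g = sym (f refl)
true-ext {false} {true}  f g = g refl
true-ext {false} {false} f g = refl

-- An encoded formula has size at most 3 + 8 size(F).
timeP : Poly
timeP = time circuitC ⟨ con 3 ⊕ con 8 ⊗ arg ⟩

module Correctness (F : CNF) (β : βAcyclic (hypergraph F)) where

  Fs : List Literals
  Fs = map literals (clauses F)

  H : Hypergraph
  H = map varsOf Fs

  H≡ : H ≡ hypergraph F
  H≡ = sym (map-∘ (clauses F))

  xs : List Var
  xs = eliminationOrder H

  xs-elim : Elim H xs
  xs-elim = proj₁ (greedy-elim H (concat H))

  xs-complete : ∀ {c x} → c ∈ Fs → x ∈ varsOf c → x ∈ xs
  xs-complete c∈ x∈ = eliminationOrder-complete H (subst βAcyclic (sym H≡) β)
    (∈-concat⁺′ x∈ (∈-map⁺ varsOf c∈))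

  nonTaut : ∀ {c} → c ∈ Fs → ∀ x → pos x ∈ c → ¬ neg x ∈ c
  nonTaut c∈ with ∈-map⁻ literals c∈
  ... | C , _ , refl = nonTautological C

  Fs-distinct : AllPairs (λ c d → ¬ c ≐ d) Fs
  Fs-distinct = AllPairs.map⁺ (distinct F)

  2≤ : ∀ F {c : Literals} → c ∈ F → 2 ≤ width ∣ map varsOf F ∣
  2≤ (_ ∷ F) _ = 2≤width _

  open Assembly Fs Fs-distinct nonTaut (width ∣ H ∣) (≤-width ∣ H ∣) (2≤ Fs)
  open Final xs-elim xs-complete

  D : Circuit
  D = toCircuit N

  literalCount≡ : literalCount Fs ≡ cnfSize F
  literalCount≡ = cong sum (sym (map-∘ (clauses F)))

  input≡ : encode (ListE LitsE) Fs ≡ encodeCNF F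
  input≡ = cong encodeList (sym (map-∘ (clauses F)))

  returns : ∃[ t ] (program circuitC on encodeCNF F Returns encodeCircuit D In t ×
                    t ≤ coefficient timeP * suc (cnfSize F) ^ exponent timeP)
  returns = let (t , e , t≤) = program-returns circuitC Fs in
    t , subst (λ u → program circuitC on u Returns encodeCircuit D In t) input≡ e ,
    ≤-trans t≤ (≤-trans (≤-⟨⟩ (time circuitC) (con 3 ⊕ con 8 ⊗ arg) input-size)
                        (monomial-bound timeP (cnfSize F)))
    where
    lemma : ∀ s → 1 + 2 * (1 + s) + 6 * s ≡ 3 + 8 * s
    lemma = solve-∀
    input-size : size′ (ListE LitsE) Fs ≤ 3 + 8 * cnfSize F
    input-size = subst (λ s → size′ (ListE LitsE) Fs ≤ 3 + 8 * s) literalCount≡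
      (≤-trans (size-formula Fs) (≤-trans
        (+-monoˡ-≤ (6 * literalCount Fs) (s≤s (*-monoʳ-≤ 2 (length≤literalCount Fs-distinct))))
        (≤-reflexive (lemma (literalCount Fs)))))

  -- Seven gates for each incidence of a clause and a variable, plus the constant at the start and
  -- the conjunction at the end.
  size-≤9 : size D ≤ 9 * (1 ⊔ cnfSize F)
  size-≤9 = begin
    suc (newest N)                     ≡⟨ cong suc final-size ⟩
    2 + 7 * occs xs Fs                 ≤⟨ +-monoʳ-≤ 2 (*-monoʳ-≤ 7 (occs-≤ (Elim-unique xs-elim) Fs)) ⟩
    2 + 7 * literalCount Fs            ≡⟨ cong (λ s → 2 + 7 * s) literalCount≡ ⟩
    2 + 7 * cnfSize F                  ≤⟨ +-mono-≤ (*-monoʳ-≤ 2 (m≤m⊔n 1 (cnfSize F)))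
                                                   (*-monoʳ-≤ 7 (m≤n⊔m 1 (cnfSize F))) ⟩
    2 * (1 ⊔ cnfSize F) + 7 * (1 ⊔ cnfSize F) ≡⟨ *-distribʳ-+ (1 ⊔ cnfSize F) 2 7 ⟨
    9 * (1 ⊔ cnfSize F)                ∎
    where open ≤-Reasoning

  isDecisionDNNF : IsDecisionDNNF D
  isDecisionDNNF = record
    { decomposable = legal-decomposable (proj₂ N) final-legal
    ; decisions    = legal-decision (proj₂ N) final-legal
    }

  fanIn-≢1 : ∣ hypergraph F ∣ ≢ 1 → fanIn D ≤ ∣ hypergraph F ∣
  fanIn-≢1 ≢1 = subst (λ H → ∣ H ∣ ≢ 1 → fanIn D ≤ ∣ H ∣) H≡
    (λ ≢1 → ≤-trans final-inputs (≤-reflexive (width-≢1 ∣ H ∣ ≢1))) ≢1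

  fanIn-≡1 : ∣ hypergraph F ∣ ≡ 1 → fanIn D ≤ 2
  fanIn-≡1 ≡1 = ≤-trans final-inputs
    (≤-reflexive (cong width (trans (cong ∣_∣ H≡) ≡1)))

  computes : D Computes F
  computes = record
    { variables = λ v z∈ → subst (λ H → _ ∈ concat H) H≡
        (proj₂ (greedy-elim H (concat H)) (final-vars v z∈))
    ; values    = λ τ → true-ext
        (λ v → all-true⁺ (clauses F) λ C∈ →
           let (ℓ , ℓ∈ , _ , τℓ) = final-sound v (∈-map⁺ literals C∈) in any-true⁺ ℓ∈ τℓ)
        (λ v → final-complete (sat v))
    }
    where
    sat : ∀ {τ} → evalCNF τ F ≡ true → ∀ {c} → c ∈ Fs → Sat xs τ c
    sat v c∈ with ∈-map⁻ literals c∈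
    ... | C , C∈ , refl = let (ℓ , ℓ∈ , τℓ) = any-true⁻ (literals C) (all-true⁻ v C∈) in
      ℓ , ℓ∈ , xs-complete c∈ (∈-map⁺ litVar ℓ∈) , τℓ

-- The program and the constants are chosen before the formula. A circuit has a gate even when the
-- formula has size 0, hence `1 ⊔ cnfSize F`; decision gates are binary, hence fan-in 2 in the case
-- of a single edge.
theorem8 : Σ[ P ∈ Program ] Σ[ c ∈ ℕ ] Σ[ k ∈ ℕ ] Σ[ d ∈ ℕ ]
    ((F : CNF) → βAcyclic (hypergraph F) →
    Σ[ D ∈ Circuit ]
    ((∃[ t ] (P on encodeCNF F Returns encodeCircuit D In t × t ≤ c * suc (cnfSize F) ^ k))
    × IsDecisionDNNF D
    × size D ≤ d * (1 ⊔ cnfSize F)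
    × (∣ hypergraph F ∣ ≢ 1 → fanIn D ≤ ∣ hypergraph F ∣)
    × (∣ hypergraph F ∣ ≡ 1 → fanIn D ≤ 2)
    × D Computes F))
theorem8 = program circuitC , coefficient timeP , exponent timeP , 9 , λ F β →
  let open Correctness F β in
  D , returns , isDecisionDNNF , size-≤9 , fanIn-≢1 , fanIn-≡1 , computes
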